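{- Let $1\le\ell_1\le\dots\le\ell_r\le n$ and $T=C_r\otimes\cdots\otimes C_1\in B(\varpi_{\ell_r})\otimes\cdots\otimes B(\varpi_{\ell_1})$. (a) If $T$ is not semistandard then $\Psi_T=0$. (b) If $T$ is highest weight, of shape $\lambda=\sum_{i=1}^r\varpi_{\ell_i}$, then $\Psi_T=\mathbf 1_\lambda$. (c) Let $\mu\in(\mathbb Z^n_{\ge0})_+$ with $\ell(\mu)\le\ell_1$ and suppose $T\otimes T^0_\mu$ is semistandard. Let $j\in[n-1]$ with $j\notin C_1$ and $j+1\in C_1$. Then, writing $\Sigma=\sum_{1\le k<r,\ \sigma^j_{C_k}\sigma^j_{C_{k+1}}=-1}\sigma^j_{C_k}(1-t)\Psi_{\Omega^j_k(T)\otimes T^0_\mu}$, $$\Psi_{T\otimes T^0_\mu}=\begin{cases}T_j\,\Psi_{\Omega^j_r(T)\otimes T^0_\mu}+\Sigma, & \text{if } j\in C_r,\ j+1\notin C_r,\\ tT_j^{ -1}\,\Psi_{\Omega^j_r(T)\otimes T^0_\mu}+\Sigma, & \text{otherwise.}\end{cases}$$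
   Context: Fix $n\ge1$, $[n]=\{1,\dots,n\}$. $S_n$ is the symmetric group with simple transpositions $s_i=(i,i+1)$ and length function $\ell(\cdot)$. $S_n$ acts on $\mathbb Z^n$ by permuting coordinates; $\varepsilon_1,\dots,\varepsilon_n$ is the standard basis, $\varpi_k=\varepsilon_1+\dots+\varepsilon_k$. $(\mathbb Z^n_{\ge0})_+=\{\lambda\in\mathbb Z^n_{\ge0}:\lambda_1\ge\dots\ge\lambda_n\}$; $\ell(\mu)$ is the number of nonzero parts of $\mu$. For $\lambda\in\mathbb Z^n$, $S_{n,\lambda}=\{w:w\lambda=\lambda\}$. The affine Hecke algebra $H$ is the $\mathbb Z[t^{\pm1}]$-algebra with generators $T_1,\dots,T_{n-1},X_1^{\pm1},\dots,X_n^{\pm1}$ and relations $T_i^2=(t-1)T_i+t$, $T_iT_{i+1}T_i=T_{i+1}T_iT_{i+1}$, $T_iT_j=T_jT_i$ for $|i-j|>1$, $X_iX_j=X_jX_i$, $T_iX_iT_i=tX_{i+1}$, $T_iX_j=X_jT_i$ for $j\notin\{i,i+1\}$ ($tT_i^{ -1}=T_i+1-t$). $T_w=T_{i_1}\cdots T_{i_m}$ for a reduced expression $w=s_{i_1}\cdots s_{i_m}$. $H_n$ is the subalgebra generated by the $T_i$ (basis $\{T_w\}_{w\in S_n}$); $H_{n,\lambda}$ is the span of $\{T_w:w\in S_{n,\lambda}\}$, and $\mathbf 1_\lambda=\sum_{w\in S_{n,\lambda}}T_w$. Columns: a column of length $\ell$ is $C=(c_1<\dots<c_\ell)\subseteq[n]$;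 $B(\varpi_\ell)$ is their set. $u_C\in S_n$ sends $k\mapsto c_k$ ($k\le\ell$) and sends $\ell+1,\dots,n$ increasingly onto $[n]\setminus C$. $s_jC$ is the column whose underlying set is the image of $C$ under the transposition $(j,j+1)$. $\sigma^j_C=-1$ if $j\in C$, $j+1\notin C$, and $\sigma^j_C=+1$ otherwise. The column $(1,\dots,\ell)$ is highest weight. Tableaux: for $1\le\ell_1\le\dots\le\ell_r\le n$, $B(\varpi_{\ell_r})\otimes\cdots\otimes B(\varpi_{\ell_1})$ is the set of $T=C_r\otimes\cdots\otimes C_1$, $C_i\in B(\varpi_{\ell_i})$, viewed as a filling of the Young diagram of $\sum\varpi_{\ell_i}$ with columns $C_r,\dots,C_1$ from left to right; $T$ is semistandard if rows weakly increase left to right, and highest weight if all its columns are highest weight. Concatenation $T\otimes T'$ is defined when every column of $T$ is at least as long as every column of $T'$. For $\mu\in(\mathbb Z^n_{\ge0})_+$, $T^0_\mu$ is the tableau of shape $\mu$ all of whose columns are highest weight (row $i$ filled with $i$); $T^0_0$ is empty. For $k\in[r]$, $\Omega^j_k(T)=C_r\otimes\cdots\otimes C_{k+1}\otimes s_jC_k\otimes\cdots\otimes s_jC_1$. Definition of $\Psi$: every $h\in H_n$ is uniquely $h=\sum_{F\in B(\varpi_\ell)}T_{u_F}h_F$ with $h_F\in H_{n,\varpi_\ell}$. For a column $C\in B(\varpi_\ell)$, $\Psi_C=t^{\ell(u_C)}(T_{u_C^{ -1}})^{ -1}\mathbf 1_{\varpi_\ell}$; for $T=C\otimes S$ with $C\in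 B(\varpi_\ell)$, $S$ a tensor of columns of lengths $\le\ell$, write $\Psi_S=\sum_{E\in B(\varpi_\ell)}T_{u_E}h_{E,S}$ with $h_{E,S}\in H_{n,\varpi_\ell}$, and set $\Psi_T=t^{\ell(u_C)}(T_{u_C^{ -1}})^{ -1}h_{C,S}$. -}

module Defs where

open import Algebra.Bundles using (Monoid; Ring)
open import Data.Bool.Base using (true; false; if_then_else_; _∧_; not)
open import Data.Fin.Base using (Fin; zero; suc; toℕ; fromℕ; fromℕ<; inject₁; punchIn; _<_)
import Data.Fin.Base as Fin
open import Data.Fin.Induction using (<-weakInduction)
open import Data.Fin.Permutation as Perm
  using (Permutation′; _⟨$⟩ʳ_; _⟨$⟩ˡ_; _∘ₚ_; inverseˡ; inverseʳ; insert; remove; lift₀; transpose)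
  renaming (_≈_ to _≗ₚ_)
import Data.Fin.Permutation.Components as PC
open import Data.Fin.Properties as Finₚ using (_≟_)
open import Data.Fin.Subset using (Subset; inside; outside; ∣_∣; _∈_; _∉_)
open import Data.Fin.Subset.Properties using (∣p∣≤n; _∈?_)
open import Data.List.Base as List using (List; []; _∷_; _++_; map; length)
open import Data.List.Base using (filter)
open import Data.List.NonEmpty.Base using (List⁺; _∷_; toList; _⁺++_)
open import Data.List.Relation.Unary.Linked using (Linked)
open import Data.Sign.Base as Sign using (Sign)
import Data.List.Properties as Listₚ
import Data.Bool.Properties as Boolₚ
open import Data.List.Membership.Propositional using () renaming (_∈_ to _∈ˡ_)
import Data.List.Membership.Propositional.Properties as ∈ˡₚ
open import Data.List.Relation.Unary.All as All using (All)
open import Data.List.Relation.Unary.Any using (here; there)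
import Data.List.Relation.Unary.AllPairs as AllPairs
open import Data.List.Relation.Unary.Unique.Propositional using (Unique)
import Data.List.Relation.Unary.Unique.Propositional.Properties as Uniqueₚ
open import Data.Nat as ℕ using (ℕ; zero; suc)
import Data.Nat.ListAction as ListAction
import Data.Nat.Properties as ℕₚ
open import Data.Product.Base using (∃; _×_; _,_; proj₁; proj₂)
open import Data.Sum.Base using (_⊎_; inj₁; inj₂; [_,_]′)
import Data.Vec.Base as Vec
import Data.Vec.Properties as Vecₚ
open import Data.Empty using (⊥)
open import Function.Base using (_∘_)
open import Level using (0ℓ)
open import Relation.Binary.PropositionalEquality
  using (_≡_; _≢_; refl; sym; trans; cong; cong₂; subst; subst₂)
open import Relation.Binary.Definitions using (Tri; tri<; tri≈; tri>)
open import Relation.Nullary using (¬_; Dec; yes; no; does; contradiction)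
open import Relation.Nullary.Decidable using (dec-true; dec-false)

-- Indices are counted from 0: Fin n stands for [n], and for n = m + 1 the simple
-- transposition s j with j : Fin m swaps inject₁ j and suc j.  Products of
-- permutations v w (apply w first) are written w ∘ₚ v.

s : ∀ {m} → Fin m → Permutation′ (suc m)
s i = transpose (inject₁ i) (suc i)

-- The product s_{i₁} ⋯ s_{iₖ} (rightmost factor acts first).
⟦_⟧ : ∀ {m} → List (Fin m) → Permutation′ (suc m)
⟦ [] ⟧     = Perm.id
⟦ i ∷ is ⟧ = ⟦ is ⟧ ∘ₚ s i

Reduced : ∀ {m} → List (Fin m) → Set
Reduced is = ∀ js → ⟦ js ⟧ ≗ₚ ⟦ is ⟧ → length is ℕ.≤ length js

-- The word s_{k-1} ⋯ s₁ s₀ of the cycle sending 0 to k.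
cyc : ∀ {m} → Fin (suc m) → List (Fin m)
cyc         zero    = []
cyc {suc m} (suc k) = map suc (cyc k) ++ zero ∷ []

-- A chosen reduced expression of w; see word-correct and word-reduced.
word : ∀ {m} → Permutation′ (suc m) → List (Fin m)
word {zero}  w = []
word {suc m} w = cyc (w ⟨$⟩ʳ zero) ++ map suc (word (remove zero w))

ℓ : ∀ {m} → Permutation′ (suc m) → ℕ
ℓ w = length (word w)

module PermutationLemmas where

  inv-eq : ∀ {n} (w : Permutation′ n) {x y} → w ⟨$⟩ʳ x ≡ y → w ⟨$⟩ˡ y ≡ x
  inv-eq w refl = inverseˡ w

  inv-cong : ∀ {n} {v w : Permutation′ n} → v ≗ₚ w → ∀ y → v ⟨$⟩ˡ y ≡ w ⟨$⟩ˡ y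
  inv-cong {v = v} {w} v≈w y = inv-eq v (trans (v≈w _) (inverseʳ w))

  w-inj : ∀ {n} (w : Permutation′ n) {x y} → w ⟨$⟩ʳ x ≡ w ⟨$⟩ʳ y → x ≡ y
  w-inj w eq = trans (sym (inverseˡ w)) (trans (cong (w ⟨$⟩ˡ_) eq) (inverseˡ w))

  rem-unique : ∀ {n} (w : Permutation′ (suc n)) (f : Fin n → Fin n) →
               (∀ j → punchIn (w ⟨$⟩ʳ zero) (f j) ≡ w ⟨$⟩ʳ suc j) →
               ∀ j → remove zero w ⟨$⟩ʳ j ≡ f j
  rem-unique w f h j = Finₚ.punchIn-injective (w ⟨$⟩ʳ zero) _ _
    (trans (sym (Perm.punchIn-permute w zero j)) (sym (h j)))

  word-cong : ∀ {m} (v w : Permutation′ (suc m)) → v ≗ₚ w → word v ≡ word w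
  word-cong {zero}  v w v≈w = refl
  word-cong {suc m} v w v≈w = cong₂ _++_ (cong cyc (v≈w zero))
    (cong (map suc) (word-cong (remove zero v) (remove zero w) (rem-unique v _ λ j →
      trans (cong (λ k → punchIn k (remove zero w ⟨$⟩ʳ j)) (v≈w zero))
            (trans (sym (Perm.punchIn-permute w zero j)) (sym (v≈w (suc j)))))))

  s-at : ∀ {m} (i : Fin m) → s i ⟨$⟩ʳ inject₁ i ≡ suc i
  s-at i with inject₁ i ≟ inject₁ i
  ... | yes _ = refl
  ... | no ≢ = contradiction refl ≢

  s-at⁺ : ∀ {m} (i : Fin m) → s i ⟨$⟩ʳ suc i ≡ inject₁ i
  s-at⁺ i with suc i ≟ inject₁ i
  ... | yes eq = eq
  ... | no _ with i ≟ i
  ...   | yes _ = refl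
  ...   | no ≢ = contradiction refl ≢

  s-off : ∀ {m} (i : Fin m) {x} → x ≢ inject₁ i → x ≢ suc i → s i ⟨$⟩ʳ x ≡ x
  s-off i {x} p q with x ≟ inject₁ i
  ... | yes eq = contradiction eq p
  ... | no _ with x ≟ suc i
  ...   | yes eq = contradiction eq q
  ...   | no _ = refl

  s-cases : ∀ {m} (i : Fin m) x → x ≡ inject₁ i ⊎ x ≡ suc i ⊎ (x ≢ inject₁ i × x ≢ suc i)
  s-cases i x with x ≟ inject₁ i
  ... | yes eq = inj₁ eq
  ... | no p with x ≟ suc i
  ...   | yes eq = inj₂ (inj₁ eq)
  ...   | no q = inj₂ (inj₂ (p , q))

  s-invol : ∀ {m} (i : Fin m) x → s i ⟨$⟩ʳ (s i ⟨$⟩ʳ x) ≡ x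
  s-invol i x with s-cases i x
  ... | inj₁ refl = trans (cong (s i ⟨$⟩ʳ_) (s-at i)) (s-at⁺ i)
  ... | inj₂ (inj₁ refl) = trans (cong (s i ⟨$⟩ʳ_) (s-at⁺ i)) (s-at i)
  ... | inj₂ (inj₂ (p , q)) = trans (cong (s i ⟨$⟩ʳ_) (s-off i p q)) (s-off i p q)

  s-swap : ∀ {m} (i : Fin m) {x y} → s i ⟨$⟩ʳ x ≡ y → x ≡ s i ⟨$⟩ʳ y
  s-swap i {x} refl = sym (s-invol i x)

  s-inv : ∀ {m} (i : Fin m) x → s i ⟨$⟩ˡ x ≡ s i ⟨$⟩ʳ x
  s-inv i x = inv-eq (s i) (s-invol i x)

  -- A function intertwines transpositions when it matches the transposed points.
  s-conj : ∀ {m n} (f : Fin (suc m) → Fin (suc n)) (f-inj : ∀ {x y} → f x ≡ f y → x ≡ y)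
           (k : Fin m) (i : Fin n) → f (inject₁ k) ≡ inject₁ i → f (suc k) ≡ suc i →
           ∀ x → s i ⟨$⟩ʳ f x ≡ f (s k ⟨$⟩ʳ x)
  s-conj f f-inj k i p q x with s-cases k x
  ... | inj₁ refl = trans (cong (s i ⟨$⟩ʳ_) p)
                      (trans (s-at i) (sym (trans (cong f (s-at k)) q)))
  ... | inj₂ (inj₁ refl) = trans (cong (s i ⟨$⟩ʳ_) q)
                      (trans (s-at⁺ i) (sym (trans (cong f (s-at⁺ k)) p)))
  ... | inj₂ (inj₂ (a , b)) = trans
          (s-off i (λ e → a (f-inj (trans e (sym p)))) (λ e → b (f-inj (trans e (sym q)))))
          (sym (cong f (s-off k a b)))

  -- s_k preserves the order of any pair other than (k , k+1).
  s-mono : ∀ {m} (k : Fin m) {a b : Fin (suc m)} → a < b →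
           s k ⟨$⟩ʳ a < s k ⟨$⟩ʳ b ⊎ (a ≡ inject₁ k × b ≡ suc k)
  s-mono k {a} {b} a<b with s-cases k a | s-cases k b
  ... | inj₁ refl | inj₁ refl = contradiction a<b (ℕₚ.<-irrefl refl)
  ... | inj₁ refl | inj₂ (inj₁ refl) = inj₂ (refl , refl)
  ... | inj₁ refl | inj₂ (inj₂ (p , q)) = inj₁ (subst₂ _<_ (sym (s-at k)) (sym (s-off k p q))
          (ℕₚ.≤∧≢⇒< (subst (λ z → suc z ℕ.≤ toℕ b) (Finₚ.toℕ-inject₁ k) a<b)
                    (λ e → q (sym (Finₚ.toℕ-injective e)))))
  ... | inj₂ (inj₁ refl) | inj₁ refl = contradiction
          (ℕₚ.<-trans a<b (ℕₚ.≤-reflexive (cong suc (Finₚ.toℕ-inject₁ k)))) (ℕₚ.<-irrefl refl)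
  ... | inj₂ (inj₁ refl) | inj₂ (inj₁ refl) = contradiction a<b (ℕₚ.<-irrefl refl)
  ... | inj₂ (inj₁ refl) | inj₂ (inj₂ (p , q)) = inj₁ (subst₂ _<_ (sym (s-at⁺ k)) (sym (s-off k p q))
          (ℕₚ.<-trans (ℕₚ.≤-reflexive (cong suc (Finₚ.toℕ-inject₁ k))) a<b))
  ... | inj₂ (inj₂ (p , q)) | inj₁ refl = inj₁ (subst₂ _<_ (sym (s-off k p q)) (sym (s-at k))
          (ℕₚ.<-trans a<b (ℕₚ.≤-reflexive (cong suc (Finₚ.toℕ-inject₁ k)))))
  ... | inj₂ (inj₂ (p , q)) | inj₂ (inj₁ refl) = inj₁ (subst₂ _<_ (sym (s-off k p q)) (sym (s-at⁺ k))
          (ℕₚ.≤∧≢⇒< (subst (toℕ a ℕ.≤_) (sym (Finₚ.toℕ-inject₁ k)) (ℕₚ.≤-pred a<b))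
                    (λ e → p (Finₚ.toℕ-injective e))))
  ... | inj₂ (inj₂ (p , q)) | inj₂ (inj₂ (p′ , q′)) =
          inj₁ (subst₂ _<_ (sym (s-off k p q)) (sym (s-off k p′ q′)) a<b)

  -- i is an ascent of w⁻¹, that is, ℓ (s_i w) = ℓ w + 1.
  Asc : ∀ {m} → Fin m → Permutation′ (suc m) → Set
  Asc i w = w ⟨$⟩ˡ inject₁ i < w ⟨$⟩ˡ suc i

  inject₁≢suc : ∀ {m} (i : Fin m) → inject₁ i ≢ suc i
  inject₁≢suc i e = ℕₚ.m≢1+m+n (toℕ i) {0}
    (trans (sym (Finₚ.toℕ-inject₁ i)) (trans (cong toℕ e) (cong suc (sym (ℕₚ.+-identityʳ _)))))

  ¬Asc⇒Asc-s : ∀ {m} (i : Fin m) w → ¬ Asc i w → Asc i (w ∘ₚ s i)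
  ¬Asc⇒Asc-s i w ¬a = subst₂ _<_
    (cong (w ⟨$⟩ˡ_) (sym (trans (s-inv i (inject₁ i)) (s-at i))))
    (cong (w ⟨$⟩ˡ_) (sym (trans (s-inv i (suc i)) (s-at⁺ i))))
    (ℕₚ.≤∧≢⇒< (ℕₚ.≮⇒≥ ¬a) (λ e → inject₁≢suc i
      (sym (w-inj (Perm.flip w) (Finₚ.toℕ-injective e)))))

  asc? : ∀ {m} (i : Fin m) w → Dec (Asc i w)
  asc? i w = (w ⟨$⟩ˡ inject₁ i) Finₚ.<? (w ⟨$⟩ˡ suc i)

  s-s : ∀ {m} (i : Fin m) (w : Permutation′ (suc m)) → (w ∘ₚ s i) ∘ₚ s i ≗ₚ w
  s-s i w x = s-invol i (w ⟨$⟩ʳ x)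

  punchIn-mono-< : ∀ {n} (k : Fin (suc n)) {x y : Fin n} → x < y → punchIn k x < punchIn k y
  punchIn-mono-< k {x} {y} x<y = ℕₚ.≤∧≢⇒<
    (Finₚ.punchIn-mono-≤ k x y (ℕₚ.<⇒≤ x<y))
    (λ e → Finₚ.<⇒≢ x<y (Finₚ.punchIn-injective k x y (Finₚ.toℕ-injective e)))

  punchIn-cancel-< : ∀ {n} (k : Fin (suc n)) {x y : Fin n} → punchIn k x < punchIn k y → x < y
  punchIn-cancel-< k {x} {y} lt = ℕₚ.≤∧≢⇒<
    (Finₚ.punchIn-cancel-≤ k x y (ℕₚ.<⇒≤ lt))
    (λ e → Finₚ.<⇒≢ lt (cong (punchIn k) (Finₚ.toℕ-injective e)))

  data PunchView {n} (k : Fin (suc n)) : Fin (suc n) → Set where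
    here  : PunchView k k
    there : ∀ x → PunchView k (punchIn k x)

  punchView : ∀ {n} (k x : Fin (suc n)) → PunchView k x
  punchView k x with k ≟ x
  ... | yes refl = here
  ... | no k≢x = subst (PunchView k) (Finₚ.punchIn-punchOut k≢x) (there _)

  insert-at : ∀ {n} (i j : Fin (suc n)) (π : Permutation′ n) → insert i j π ⟨$⟩ʳ i ≡ j
  insert-at i j π with i ≟ i
  ... | yes _ = refl
  ... | no ≢ = contradiction refl ≢

  ⟦⟧-++ : ∀ {m} (is js : List (Fin m)) x → ⟦ is ++ js ⟧ ⟨$⟩ʳ x ≡ ⟦ is ⟧ ⟨$⟩ʳ (⟦ js ⟧ ⟨$⟩ʳ x)
  ⟦⟧-++ []       js x = refl
  ⟦⟧-++ (i ∷ is) js x = cong (s i ⟨$⟩ʳ_) (⟦⟧-++ is js x)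

  ⟦⟧-zero : ∀ {m} (is : List (Fin m)) → ⟦ map suc is ⟧ ⟨$⟩ʳ zero ≡ zero
  ⟦⟧-zero []       = refl
  ⟦⟧-zero (i ∷ is) = cong (s (suc i) ⟨$⟩ʳ_) (⟦⟧-zero is)

  ⟦⟧-suc : ∀ {m} (is : List (Fin m)) x → ⟦ map suc is ⟧ ⟨$⟩ʳ suc x ≡ suc (⟦ is ⟧ ⟨$⟩ʳ x)
  ⟦⟧-suc []       x = refl
  ⟦⟧-suc (i ∷ is) x = trans (cong (s (suc i) ⟨$⟩ʳ_) (⟦⟧-suc is x))
                            (Perm.lift₀-transpose (inject₁ i) (suc i) (suc (⟦ is ⟧ ⟨$⟩ʳ x)))

  cyc-zero : ∀ {m} (k : Fin (suc m)) → ⟦ cyc k ⟧ ⟨$⟩ʳ zero ≡ k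
  cyc-zero         zero    = refl
  cyc-zero {suc m} (suc k) = trans (⟦⟧-++ (map suc (cyc k)) (zero ∷ []) zero)
    (trans (⟦⟧-suc (cyc k) zero) (cong suc (cyc-zero k)))

  cyc-suc : ∀ {m} (k : Fin (suc m)) x → ⟦ cyc k ⟧ ⟨$⟩ʳ suc x ≡ punchIn k x
  cyc-suc         zero    x       = refl
  cyc-suc {suc m} (suc k) zero    =
    trans (⟦⟧-++ (map suc (cyc k)) (zero ∷ []) (suc zero)) (⟦⟧-zero (cyc k))
  cyc-suc {suc m} (suc k) (suc x) =
    trans (⟦⟧-++ (map suc (cyc k)) (zero ∷ []) (suc (suc x)))
      (trans (⟦⟧-suc (cyc k) (suc x)) (cong suc (cyc-suc k x)))

open PermutationLemmas

word-correct : ∀ {m} (w : Permutation′ (suc m)) → ⟦ word w ⟧ ≗ₚ w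
word-correct {zero}  w zero with w ⟨$⟩ʳ zero
... | zero = refl
word-correct {suc m} w zero = trans (⟦⟧-++ (cyc (w ⟨$⟩ʳ zero)) _ zero)
  (trans (cong (⟦ cyc (w ⟨$⟩ʳ zero) ⟧ ⟨$⟩ʳ_) (⟦⟧-zero (word (remove zero w))))
    (cyc-zero (w ⟨$⟩ʳ zero)))
word-correct {suc m} w (suc x) = trans (⟦⟧-++ (cyc (w ⟨$⟩ʳ zero)) _ (suc x))
  (trans (cong (⟦ cyc (w ⟨$⟩ʳ zero) ⟧ ⟨$⟩ʳ_)
           (trans (⟦⟧-suc (word (remove zero w)) x) (cong suc (word-correct (remove zero w) x))))
    (trans (cyc-suc (w ⟨$⟩ʳ zero) _) (sym (Perm.punchIn-permute w zero x))))

module WordLemmas where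

  -- Off k i x: neither i nor i+1 is k, and punchIn k sends x , x+1 to i , i+1.
  data Off : ∀ {m} → Fin (suc (suc m)) → Fin (suc m) → Fin m → Set where
    far  : ∀ {m} {i : Fin m} → Off zero (suc i) i
    near : ∀ {m} {k : Fin (suc m)} → Off (suc (suc k)) zero zero
    step : ∀ {m k i} {x : Fin m} → Off k i x → Off (suc k) (suc i) (suc x)

  Pos : ∀ {m} → Fin (suc (suc m)) → Fin (suc m) → Set
  Pos k i = k ≡ inject₁ i ⊎ k ≡ suc i ⊎ ∃ (Off k i)

  pos : ∀ {m} (k : Fin (suc (suc m))) i → Pos k i
  pos zero zero = inj₁ refl
  pos {suc m} zero (suc i) = inj₂ (inj₂ (i , far))
  pos (suc zero) zero = inj₂ (inj₁ refl)
  pos {suc m} (suc (suc k)) zero = inj₂ (inj₂ (zero , near))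
  pos {suc m} (suc k) (suc i) with pos k i
  ... | inj₁ refl = inj₁ refl
  ... | inj₂ (inj₁ refl) = inj₂ (inj₁ refl)
  ... | inj₂ (inj₂ (x , o)) = inj₂ (inj₂ (suc x , step o))

  off-inject : ∀ {m k i} {x : Fin m} → Off k i x → punchIn k (inject₁ x) ≡ inject₁ i
  off-inject far      = refl
  off-inject near     = refl
  off-inject (step o) = cong suc (off-inject o)

  off-suc : ∀ {m k i} {x : Fin m} → Off k i x → punchIn k (suc x) ≡ suc i
  off-suc far      = refl
  off-suc near     = refl
  off-suc (step o) = cong suc (off-suc o)

  cyc-inject : ∀ {m} (i : Fin m) → cyc (suc i) ≡ i ∷ cyc (inject₁ i)
  cyc-inject zero    = refl
  cyc-inject (suc i) = cong (λ is → map suc is ++ zero ∷ []) (cyc-inject i)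

  s-punch : ∀ {m} (i : Fin m) y → s i ⟨$⟩ʳ punchIn (inject₁ i) y ≡ punchIn (suc i) y
  s-punch zero    zero    = refl
  s-punch zero    (suc y) = refl
  s-punch (suc i) zero    = refl
  s-punch (suc i) (suc y) = trans
    (Perm.lift₀-transpose (inject₁ i) (suc i) (suc (punchIn (inject₁ i) y)))
    (cong suc (s-punch i y))

  rem-inv : ∀ {n} (w : Permutation′ (suc n)) y →
            w ⟨$⟩ˡ punchIn (w ⟨$⟩ʳ zero) y ≡ suc (remove zero w ⟨$⟩ˡ y)
  rem-inv w y = inv-eq w (trans (Perm.punchIn-permute w zero (remove zero w ⟨$⟩ˡ y))
    (cong (punchIn (w ⟨$⟩ʳ zero)) (inverseʳ (remove zero w))))

  word-at : ∀ {m} (i : Fin (suc m)) w → w ⟨$⟩ʳ zero ≡ inject₁ i → word (w ∘ₚ s i) ≡ i ∷ word w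
  word-at i w e = cong₂ (λ c r → c ++ map suc r)
    (trans (cong cyc sk) (trans (cyc-inject i) (cong (λ k → i ∷ cyc k) (sym e))))
    (word-cong (remove zero (w ∘ₚ s i)) (remove zero w) (rem-unique (w ∘ₚ s i) (remove zero w ⟨$⟩ʳ_) λ j →
      trans (cong (λ k → punchIn k (remove zero w ⟨$⟩ʳ j)) sk)
        (trans (sym (s-punch i _))
          (cong (s i ⟨$⟩ʳ_) (trans (cong (λ k → punchIn k (remove zero w ⟨$⟩ʳ j)) (sym e))
            (sym (Perm.punchIn-permute w zero j)))))))
    where
    sk : s i ⟨$⟩ʳ (w ⟨$⟩ʳ zero) ≡ suc i
    sk = trans (cong (s i ⟨$⟩ʳ_) e) (s-at i)

  word-off : ∀ {m} (i : Fin (suc m)) w x → Off (w ⟨$⟩ʳ zero) i x →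
             word (w ∘ₚ s i) ≡ cyc (w ⟨$⟩ʳ zero) ++ map suc (word (remove zero w ∘ₚ s x))
  word-off i w x o = cong₂ (λ c r → c ++ map suc r) (cong cyc fix)
    (word-cong (remove zero (w ∘ₚ s i)) (remove zero w ∘ₚ s x) (rem-unique (w ∘ₚ s i) (λ j → s x ⟨$⟩ʳ (remove zero w ⟨$⟩ʳ j)) λ j →
      trans (cong (λ k′ → punchIn k′ (s x ⟨$⟩ʳ (remove zero w ⟨$⟩ʳ j))) fix)
        (trans (sym (s-conj (punchIn k) (Finₚ.punchIn-injective k _ _) x i
                       (off-inject o) (off-suc o) (remove zero w ⟨$⟩ʳ j)))
          (cong (s i ⟨$⟩ʳ_) (sym (Perm.punchIn-permute w zero j))))))
    where
    k = w ⟨$⟩ʳ zero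
    fix : s i ⟨$⟩ʳ k ≡ k
    fix = s-off i (λ e → Finₚ.punchInᵢ≢i k (inject₁ x) (trans (off-inject o) (sym e)))
                  (λ e → Finₚ.punchInᵢ≢i k (suc x) (trans (off-suc o) (sym e)))

  lift-asc : ∀ {m} (i : Fin (suc m)) w x → Off (w ⟨$⟩ʳ zero) i x → Asc i w → Asc x (remove zero w)
  lift-asc i w x o a = ℕₚ.≤-pred (subst₂ _<_
    (trans (cong (w ⟨$⟩ˡ_) (sym (off-inject o))) (rem-inv w _))
    (trans (cong (w ⟨$⟩ˡ_) (sym (off-suc o))) (rem-inv w _)) a)

  not-asc-at⁺ : ∀ {m} (i : Fin m) (w : Permutation′ (suc m)) → w ⟨$⟩ʳ zero ≡ suc i → ¬ Asc i w
  not-asc-at⁺ i w e a = ℕₚ.n≮0 (subst (λ z → toℕ (w ⟨$⟩ˡ inject₁ i) ℕ.< toℕ z) (inv-eq w e) a)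

  asc-right : ∀ {m} (i k : Fin m) (w : Permutation′ (suc m)) → Asc i w →
              s i ⟨$⟩ʳ (w ⟨$⟩ʳ inject₁ k) < s i ⟨$⟩ʳ (w ⟨$⟩ʳ suc k) →
              w ⟨$⟩ʳ inject₁ k < w ⟨$⟩ʳ suc k
  asc-right i k w a lt = [ subst₂ _<_ (s-invol i wk) (s-invol i wk⁺) , absurd ]′
                           (s-mono i {s i ⟨$⟩ʳ wk} {s i ⟨$⟩ʳ wk⁺} lt)
    where
    wk  = w ⟨$⟩ʳ inject₁ k
    wk⁺ = w ⟨$⟩ʳ suc k
    absurd : s i ⟨$⟩ʳ wk ≡ inject₁ i × s i ⟨$⟩ʳ wk⁺ ≡ suc i → wk < wk⁺
    absurd (e , e′) = contradiction
      (ℕₚ.<-trans (subst₂ _<_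
        (inv-eq w {suc k} (trans (s-swap i {wk⁺} e′) (s-at⁺ i)))
        (inv-eq w {inject₁ k} (trans (s-swap i {wk} e) (s-at i))) a)
        (ℕₚ.≤-reflexive (cong suc (Finₚ.toℕ-inject₁ k))))
      (ℕₚ.<-irrefl refl)

  asc-left : ∀ {m} (i k : Fin m) (w : Permutation′ (suc m)) → Asc i w →
             s i ⟨$⟩ʳ (w ⟨$⟩ʳ inject₁ k) < s i ⟨$⟩ʳ (w ⟨$⟩ʳ suc k) → Asc i (s k ∘ₚ w)
  asc-left i k w a lt = [ subst₂ _<_ (sym (s-inv k x)) (sym (s-inv k y)) , absurd ]′
                          (s-mono k {x} {y} a)
    where
    x = w ⟨$⟩ˡ inject₁ i
    y = w ⟨$⟩ˡ suc i
    absurd : x ≡ inject₁ k × y ≡ suc k → Asc i (s k ∘ₚ w)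
    absurd (e , e′) = contradiction
      (ℕₚ.<-trans (subst₂ _<_
        (trans (cong (s i ⟨$⟩ʳ_) (trans (cong (w ⟨$⟩ʳ_) (sym e)) (inverseʳ w))) (s-at i))
        (trans (cong (s i ⟨$⟩ʳ_) (trans (cong (w ⟨$⟩ʳ_) (sym e′)) (inverseʳ w))) (s-at⁺ i)) lt)
        (ℕₚ.≤-reflexive (cong suc (Finₚ.toℕ-inject₁ i))))
      (ℕₚ.<-irrefl refl)

  word-id : ∀ {m} → word {m} Perm.id ≡ []
  word-id {zero}  = refl
  word-id {suc m} = cong (map suc) (trans (word-cong (remove zero Perm.id) Perm.id (rem-unique Perm.id (λ x → x) λ j → refl)) word-id)

  perm-ind : ∀ {m p} (P : Permutation′ (suc m) → Set p) →
             (∀ {v w} → v ≗ₚ w → P v → P w) → P Perm.id →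
             (∀ i w → Asc i w → P w → P (w ∘ₚ s i)) → ∀ w → P w
  perm-ind {zero} P resp Pid Pstep w = resp (λ { zero → one (w ⟨$⟩ʳ zero) }) Pid
    where
    one : (x : Fin 1) → zero ≡ x
    one zero = refl
  perm-ind {suc m} P resp Pid Pstep w =
    resp (Perm.insert-remove zero w) (P-insert (remove zero w) (w ⟨$⟩ʳ zero))
    where
    P-lift : ∀ v → P (lift₀ v)
    P-lift = perm-ind (P ∘ lift₀) (λ {v} {w} e → resp (Perm.lift₀-cong v w e))
      (resp (λ x → sym (Perm.lift₀-id x)) Pid)
      (λ i v a Pv → resp (λ { zero → refl
                            ; (suc x) → Perm.lift₀-transpose (inject₁ i) (suc i) (suc (v ⟨$⟩ʳ x)) })
                         (Pstep (suc i) (lift₀ v) (ℕ.s≤s a) Pv))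

    P-insert : ∀ v k → P (insert zero k v)
    P-insert v = <-weakInduction (λ k → P (insert zero k v))
      (resp (λ { zero → refl ; (suc x) → refl }) (P-lift v))
      (λ i Pi → resp (λ { zero → s-at i ; (suc x) → s-punch i (v ⟨$⟩ʳ x) })
         (Pstep i (insert zero (inject₁ i) v)
           (subst (_< (insert zero (inject₁ i) v ⟨$⟩ˡ suc i))
              (sym (inv-eq (insert zero (inject₁ i) v) {zero} refl))
              (nonzero _ λ e → inject₁≢suc i
                (trans (cong (insert zero (inject₁ i) v ⟨$⟩ʳ_) (sym e))
                       (inverseʳ (insert zero (inject₁ i) v)))))
           Pi))
      where
      nonzero : ∀ {n} (x : Fin (suc n)) → x ≢ zero → zero {n} < x
      nonzero zero    x≢0 = contradiction refl x≢0
      nonzero (suc x) _   = ℕ.z<s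

open WordLemmas

module _ {c ℓ′} (M : Monoid c ℓ′) where
  open Monoid M using (Carrier; _∙_; ε)

  prod : ∀ {m} → (Fin m → Carrier) → List (Fin m) → Carrier
  prod τ []       = ε
  prod τ (i ∷ is) = τ i ∙ prod τ is

module BraidLemmas where
  module Braid {c ℓ′} (M : Monoid c ℓ′) where
    open Monoid M hiding (refl; sym; trans)
    open Monoid M using () renaming (refl to ≈-refl; sym to ≈-sym; trans to ≈-trans)
    open import Relation.Binary.Reasoning.Setoid setoid

    record IsBraided {m} (τ : Fin m → Carrier) : Set ℓ′ where
      field
        far-comm : ∀ i j → 1 ℕ.< ℕ.∣ toℕ i - toℕ j ∣ → τ i ∙ τ j ≈ τ j ∙ τ i
        braid    : ∀ i j → toℕ j ≡ suc (toℕ i) → τ i ∙ (τ j ∙ τ i) ≈ τ j ∙ (τ i ∙ τ j)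
    open IsBraided

    shift : ∀ {m} {τ : Fin (suc m) → Carrier} → IsBraided τ → IsBraided (τ ∘ suc)
    shift β = record
      { far-comm = λ i j d → far-comm β (suc i) (suc j) d
      ; braid    = λ i j e → braid β (suc i) (suc j) (cong suc e) }

    prod-++ : ∀ {m} (τ : Fin m → Carrier) is js → prod M τ (is ++ js) ≈ prod M τ is ∙ prod M τ js
    prod-++ τ []       js = ≈-sym (identityˡ _)
    prod-++ τ (i ∷ is) js = ≈-trans (∙-congˡ (prod-++ τ is js)) (≈-sym (assoc _ _ _))

    prod-map : ∀ {m} (τ : Fin (suc m) → Carrier) is → prod M τ (map suc is) ≡ prod M (τ ∘ suc) is
    prod-map τ []       = refl
    prod-map τ (i ∷ is) = cong (τ (suc i) ∙_) (prod-map τ is)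

    comm-prod : ∀ {m} (τ : Fin m → Carrier) {a} → (∀ i → a ∙ τ i ≈ τ i ∙ a) →
                ∀ is → a ∙ prod M τ is ≈ prod M τ is ∙ a
    comm-prod τ {a} h []       = ≈-trans (identityʳ a) (≈-sym (identityˡ a))
    comm-prod τ {a} h (i ∷ is) = begin
      a ∙ (τ i ∙ prod M τ is)   ≈⟨ assoc _ _ _ ⟨
      a ∙ τ i ∙ prod M τ is     ≈⟨ ∙-congʳ (h i) ⟩
      τ i ∙ a ∙ prod M τ is     ≈⟨ assoc _ _ _ ⟩
      τ i ∙ (a ∙ prod M τ is)   ≈⟨ ∙-congˡ (comm-prod τ h is) ⟩
      τ i ∙ (prod M τ is ∙ a)   ≈⟨ assoc _ _ _ ⟨
      τ i ∙ prod M τ is ∙ a     ∎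

    far-0 : ∀ {m} {τ : Fin (suc (suc m)) → Carrier} → IsBraided τ →
            ∀ i → τ zero ∙ τ (suc (suc i)) ≈ τ (suc (suc i)) ∙ τ zero
    far-0 β i = far-comm β zero (suc (suc i)) (ℕ.s≤s (ℕ.s≤s ℕ.z≤n))

    snoc0 : ∀ {m} (τ : Fin (suc m) → Carrier) is →
            prod M τ (map suc is ++ zero ∷ []) ≈ prod M (τ ∘ suc) is ∙ τ zero
    snoc0 τ is = ≈-trans (prod-++ τ (map suc is) (zero ∷ []))
      (∙-cong (reflexive (prod-map τ is)) (identityʳ _))

    off-comm : ∀ {m k i} {x : Fin m} → Off k i x → (τ : Fin (suc m) → Carrier) → IsBraided τ →
               τ i ∙ prod M τ (cyc k) ≈ prod M τ (cyc k) ∙ τ (suc x)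
    off-comm far τ β = ≈-trans (identityʳ _) (≈-sym (identityˡ _))
    off-comm (near {k = k}) τ β = begin
      τ zero ∙ prod M τ (cyc (suc (suc k)))  ≈⟨ ∙-congˡ eq ⟩
      τ zero ∙ (A ∙ (τ 1F ∙ τ zero))          ≈⟨ assoc _ _ _ ⟨
      (τ zero ∙ A) ∙ (τ 1F ∙ τ zero)          ≈⟨ ∙-congʳ (comm-prod _ (far-0 β) (cyc k)) ⟩
      (A ∙ τ zero) ∙ (τ 1F ∙ τ zero)          ≈⟨ assoc _ _ _ ⟩
      A ∙ (τ zero ∙ (τ 1F ∙ τ zero))          ≈⟨ ∙-congˡ (braid β zero 1F refl) ⟩
      A ∙ (τ 1F ∙ (τ zero ∙ τ 1F))            ≈⟨ ∙-congˡ (assoc _ _ _) ⟨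
      A ∙ ((τ 1F ∙ τ zero) ∙ τ 1F)            ≈⟨ assoc _ _ _ ⟨
      (A ∙ (τ 1F ∙ τ zero)) ∙ τ 1F            ≈⟨ ∙-congʳ eq ⟨
      prod M τ (cyc (suc (suc k))) ∙ τ 1F     ∎
      where
      1F = suc zero
      A = prod M (λ i → τ (suc (suc i))) (cyc k)
      eq : prod M τ (cyc (suc (suc k))) ≈ A ∙ (τ 1F ∙ τ zero)
      eq = ≈-trans (snoc0 τ (cyc (suc k))) (≈-trans (∙-congʳ (snoc0 (τ ∘ suc) (cyc k))) (assoc _ _ _))
    off-comm (step {k = k} {i} {x} o) τ β = begin
      τ (suc i) ∙ prod M τ (cyc (suc k))  ≈⟨ ∙-congˡ (snoc0 τ (cyc k)) ⟩
      τ (suc i) ∙ (A ∙ τ zero)            ≈⟨ assoc _ _ _ ⟨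
      τ (suc i) ∙ A ∙ τ zero              ≈⟨ ∙-congʳ (off-comm o (τ ∘ suc) (shift β)) ⟩
      A ∙ τ (suc (suc x)) ∙ τ zero        ≈⟨ assoc _ _ _ ⟩
      A ∙ (τ (suc (suc x)) ∙ τ zero)      ≈⟨ ∙-congˡ (far-0 β x) ⟨
      A ∙ (τ zero ∙ τ (suc (suc x)))      ≈⟨ assoc _ _ _ ⟨
      A ∙ τ zero ∙ τ (suc (suc x))        ≈⟨ ∙-congʳ (snoc0 τ (cyc k)) ⟨
      prod M τ (cyc (suc k)) ∙ τ (suc (suc x)) ∎
      where A = prod M (τ ∘ suc) (cyc k)

    -- τ_i τ_w = τ_{s_i w} whenever ℓ (s_i w) > ℓ w.
    ascend : ∀ {m} (τ : Fin m → Carrier) → IsBraided τ → ∀ i w → Asc i w →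
             τ i ∙ prod M τ (word w) ≈ prod M τ (word (w ∘ₚ s i))
    ascend {suc m} τ β i w a =
      [ (λ e → reflexive (cong (prod M τ) (sym (word-at i w e))))
      , [ (λ e → contradiction a (not-asc-at⁺ i w e)) , (λ (x , o) → ascend-off x o) ]′ ]′
      (pos (w ⟨$⟩ʳ zero) i)
      where
      k = w ⟨$⟩ʳ zero
      w′ = remove zero w
      C = prod M τ (cyc k)
      split : ∀ is → prod M τ (cyc k ++ map suc is) ≈ C ∙ prod M (τ ∘ suc) is
      split is = ≈-trans (prod-++ τ (cyc k) (map suc is)) (∙-congˡ (reflexive (prod-map τ is)))
      ascend-off : ∀ x → Off k i x → τ i ∙ prod M τ (word w) ≈ prod M τ (word (w ∘ₚ s i))
      ascend-off x o = begin
        τ i ∙ prod M τ (cyc k ++ map suc (word w′))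
          ≈⟨ ∙-congˡ (split (word w′)) ⟩
        τ i ∙ (C ∙ prod M (τ ∘ suc) (word w′))
          ≈⟨ assoc _ _ _ ⟨
        τ i ∙ C ∙ prod M (τ ∘ suc) (word w′)
          ≈⟨ ∙-congʳ (off-comm o τ β) ⟩
        C ∙ τ (suc x) ∙ prod M (τ ∘ suc) (word w′)
          ≈⟨ assoc _ _ _ ⟩
        C ∙ (τ (suc x) ∙ prod M (τ ∘ suc) (word w′))
          ≈⟨ ∙-congˡ (ascend (τ ∘ suc) (shift β) x w′ (lift-asc i w x o a)) ⟩
        C ∙ prod M (τ ∘ suc) (word (w′ ∘ₚ s x))
          ≈⟨ split (word (w′ ∘ₚ s x)) ⟨
        prod M τ (cyc k ++ map suc (word (w′ ∘ₚ s x)))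
          ≡⟨ cong (prod M τ) (word-off i w x o) ⟨
        prod M τ (word (w ∘ₚ s i)) ∎

    -- τ_w τ_k = τ_{w s_k} whenever ℓ (w s_k) > ℓ w.
    ascendʳ : ∀ {m} (τ : Fin m → Carrier) → IsBraided τ → ∀ w k → w ⟨$⟩ʳ inject₁ k < w ⟨$⟩ʳ suc k →
              prod M τ (word w) ∙ τ k ≈ prod M τ (word (s k ∘ₚ w))
    ascendʳ {m} τ β = perm-ind
      (λ w → ∀ k → w ⟨$⟩ʳ inject₁ k < w ⟨$⟩ʳ suc k → prod M τ (word w) ∙ τ k ≈ prod M τ (word (s k ∘ₚ w)))
      (λ {v} {w} e h k lt → ≈-trans (∙-congʳ (reflexive (cong (prod M τ) (word-cong w v (λ x → sym (e x))))))
        (≈-trans (h k (subst₂ _<_ (sym (e (inject₁ k))) (sym (e (suc k))) lt))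
          (reflexive (cong (prod M τ) (word-cong (s k ∘ₚ v) (s k ∘ₚ w) (λ x → e (s k ⟨$⟩ʳ x)))))))
      (λ k lt → begin
        prod M τ (word Perm.id) ∙ τ k   ≡⟨ cong (λ is → prod M τ is ∙ τ k) word-id ⟩
        ε ∙ τ k                         ≈⟨ identityˡ _ ⟩
        τ k                             ≈⟨ identityʳ _ ⟨
        τ k ∙ ε                         ≡⟨ cong (λ is → τ k ∙ prod M τ is) word-id ⟨
        τ k ∙ prod M τ (word Perm.id)   ≈⟨ ascend τ β k Perm.id lt ⟩
        prod M τ (word (Perm.id ∘ₚ s k)) ≡⟨ cong (prod M τ) (word-cong (Perm.id ∘ₚ s k) (s k ∘ₚ Perm.id) (λ x → refl)) ⟩
        prod M τ (word (s k ∘ₚ Perm.id)) ∎)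
      stepʳ
      where
      stepʳ : ∀ i w → Asc i w →
        (∀ k → w ⟨$⟩ʳ inject₁ k < w ⟨$⟩ʳ suc k → prod M τ (word w) ∙ τ k ≈ prod M τ (word (s k ∘ₚ w))) →
        ∀ k → s i ⟨$⟩ʳ (w ⟨$⟩ʳ inject₁ k) < s i ⟨$⟩ʳ (w ⟨$⟩ʳ suc k) →
        prod M τ (word (w ∘ₚ s i)) ∙ τ k ≈ prod M τ (word (s k ∘ₚ (w ∘ₚ s i)))
      stepʳ i w a h k lt = begin
        prod M τ (word (w ∘ₚ s i)) ∙ τ k   ≈⟨ ∙-congʳ (ascend τ β i w a) ⟨
        τ i ∙ prod M τ (word w) ∙ τ k      ≈⟨ assoc _ _ _ ⟩
        τ i ∙ (prod M τ (word w) ∙ τ k)    ≈⟨ ∙-congˡ (h k wk<) ⟩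
        τ i ∙ prod M τ (word (s k ∘ₚ w))   ≈⟨ ascend τ β i (s k ∘ₚ w) a′ ⟩
        prod M τ (word ((s k ∘ₚ w) ∘ₚ s i)) ≡⟨ cong (prod M τ) (word-cong ((s k ∘ₚ w) ∘ₚ s i) (s k ∘ₚ (w ∘ₚ s i)) (λ x → refl)) ⟩
        prod M τ (word (s k ∘ₚ (w ∘ₚ s i))) ∎
        where
        wk< = asc-right i k w a lt
        a′ = asc-left i k w a lt

  open Braid

  ℓ-step : ∀ {m} (i : Fin m) w → Asc i w → ℓ (w ∘ₚ s i) ≡ suc (ℓ w)
  ℓ-step i w a = trans (sym (count (word (w ∘ₚ s i))))
    (trans (sym (ascend ℕₚ.+-0-monoid (λ _ → 1)
      (record { far-comm = λ _ _ _ → refl ; braid = λ _ _ _ → refl }) i w a))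
      (cong suc (count (word w))))
    where
    count : ∀ {m} (is : List (Fin m)) → prod ℕₚ.+-0-monoid (λ _ → 1) is ≡ length is
    count []       = refl
    count (i ∷ is) = cong suc (count is)

  ℓ-≤ : ∀ {m} (i : Fin m) w → ℓ (w ∘ₚ s i) ℕ.≤ suc (ℓ w)
  ℓ-≤ i w with asc? i w
  ... | yes a = ℕₚ.≤-reflexive (ℓ-step i w a)
  ... | no ¬a = ℕₚ.m≤n⇒m≤1+n (ℕₚ.≤-trans (ℕₚ.n≤1+n _) (ℕₚ.≤-reflexive
    (trans (sym (ℓ-step i (w ∘ₚ s i) (¬Asc⇒Asc-s i w ¬a))) (cong length (word-cong ((w ∘ₚ s i) ∘ₚ s i) w (s-s i w))))))

  ℓ-⟦⟧ : ∀ {m} (is : List (Fin m)) → ℓ ⟦ is ⟧ ℕ.≤ length is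
  ℓ-⟦⟧ {m} [] = ℕₚ.≤-reflexive (cong length (word-id {m}))
  ℓ-⟦⟧ (i ∷ is) = ℕₚ.≤-trans (ℓ-≤ i ⟦ is ⟧) (ℕ.s≤s (ℓ-⟦⟧ is))

open BraidLemmas

word-reduced : ∀ {m} (w : Permutation′ (suc m)) → Reduced (word w)
word-reduced w is eq = ℕₚ.≤-trans
  (ℕₚ.≤-reflexive (cong length (word-cong w ⟦ is ⟧ (λ x → sym (trans (eq x) (word-correct w x))))))
  (ℓ-⟦⟧ is)

-- A column of length l is a subset of Fin n of size l; columns n l is B(ϖ_l).

subsets : ∀ n → List (Subset n)
subsets zero    = Vec.[] ∷ []
subsets (suc n) = map (inside Vec.∷_) (subsets n) ++ map (outside Vec.∷_) (subsets n)

columns : ∀ n → ℕ → List (Subset n)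
columns n l = filter (λ C → ∣ C ∣ ℕ.≟ l) (subsets n)

entries : ∀ {n} → Subset n → List (Fin n)
entries Vec.[]              = []
entries (inside  Vec.∷ C) = zero ∷ map suc (entries C)
entries (outside Vec.∷ C) = map suc (entries C)

top : ∀ n → ℕ → Subset n
top n l = Vec.tabulate (λ i → toℕ i ℕ.<ᵇ l)

-- The permutation u_C, by recursion on n: if 0 ∈ C then 0 ↦ 0, and if 0 ∉ C then
-- 0 is the value at position ∣ C ∣.  By u-∈, u-∉ and u-mono below, it maps the
-- positions < ∣ C ∣ increasingly to C and the others increasingly to the complement.
u : ∀ {n} → Subset n → Permutation′ n
u Vec.[]            = Perm.id
u (inside  Vec.∷ C) = lift₀ (u C)
u (outside Vec.∷ C) = insert (fromℕ< (ℕ.s≤s (∣p∣≤n C))) zero (u C)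

-- The image of C under s_j, which is also the preimage as s_j is an involution.
sᶜ : ∀ {m} → Fin m → Subset (suc m) → Subset (suc m)
sᶜ j C = Vec.tabulate (λ i → Vec.lookup C (s j ⟨$⟩ʳ i))

module GapLemmas where

  gap : ∀ {n} → Subset n → Fin (suc n)
  gap C = fromℕ< (ℕ.s≤s (∣p∣≤n C))

  toℕ-gap : ∀ {n} (C : Subset n) → toℕ (gap C) ≡ ∣ C ∣
  toℕ-gap C = Finₚ.toℕ-fromℕ< (ℕ.s≤s (∣p∣≤n C))

  punchIn-below : ∀ {n} (k : Fin (suc n)) x → toℕ x ℕ.< toℕ k → toℕ (punchIn k x) ≡ toℕ x
  punchIn-below (suc k) zero    lt = refl
  punchIn-below (suc k) (suc x) lt = cong suc (punchIn-below k x (ℕₚ.≤-pred lt))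

  punchIn-above : ∀ {n} (k : Fin (suc n)) x → toℕ k ℕ.≤ toℕ x → toℕ (punchIn k x) ≡ suc (toℕ x)
  punchIn-above zero    x       le = refl
  punchIn-above (suc k) (suc x) le = cong suc (punchIn-above k x (ℕₚ.≤-pred le))

  punchIn-<⁻ : ∀ {n} (k : Fin (suc n)) x → toℕ (punchIn k x) ℕ.< toℕ k → toℕ x ℕ.< toℕ k
  punchIn-<⁻ k x lt with toℕ x ℕ.<? toℕ k
  ... | yes p = p
  ... | no p = contradiction (ℕₚ.<-trans (subst (ℕ._< toℕ k) (punchIn-above k x (ℕₚ.≮⇒≥ p)) lt)
                                         (ℕ.s≤s (ℕₚ.≮⇒≥ p))) (ℕₚ.<-irrefl refl)

  punchIn-≤⁻ : ∀ {n} (k : Fin (suc n)) x → toℕ k ℕ.≤ toℕ (punchIn k x) → toℕ k ℕ.≤ toℕ x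
  punchIn-≤⁻ k x le with toℕ x ℕ.<? toℕ k
  ... | yes p = contradiction (ℕₚ.≤-<-trans (subst (toℕ k ℕ.≤_) (punchIn-below k x p) le) p)
                              (ℕₚ.<-irrefl refl)
  ... | no p = ℕₚ.≮⇒≥ p

  u-there : ∀ {n} (C : Subset n) x → u (outside Vec.∷ C) ⟨$⟩ʳ punchIn (gap C) x ≡ suc (u C ⟨$⟩ʳ x)
  u-there C x = Perm.insert-punchIn (gap C) zero (u C) x

  u-gap : ∀ {n} (C : Subset n) → u (outside Vec.∷ C) ⟨$⟩ʳ gap C ≡ zero
  u-gap C = insert-at (gap C) zero (u C)

open GapLemmas

u-∈ : ∀ {n} (C : Subset n) k → toℕ k ℕ.< ∣ C ∣ → u C ⟨$⟩ʳ k ∈ C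
u-∈ (inside  Vec.∷ C) zero    lt = Vec.here
u-∈ (inside  Vec.∷ C) (suc k) lt = Vec.there (u-∈ C k (ℕₚ.≤-pred lt))
u-∈ (outside Vec.∷ C) k       lt with punchView (gap C) k
... | here    = contradiction (subst (ℕ._< ∣ C ∣) (toℕ-gap C) lt) (ℕₚ.<-irrefl refl)
... | there x = subst (_∈ outside Vec.∷ C) (sym (u-there C x)) (Vec.there (u-∈ C x
        (subst (toℕ x ℕ.<_) (toℕ-gap C) (punchIn-<⁻ (gap C) x (subst (toℕ (punchIn (gap C) x) ℕ.<_) (sym (toℕ-gap C)) lt)))))

u-∉ : ∀ {n} (C : Subset n) k → ∣ C ∣ ℕ.≤ toℕ k → u C ⟨$⟩ʳ k ∉ C
u-∉ (inside  Vec.∷ C) (suc k) le (Vec.there p) = u-∉ C k (ℕₚ.≤-pred le) p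
u-∉ (outside Vec.∷ C) k       le p with punchView (gap C) k
... | here with () ← subst (_∈ outside Vec.∷ C) (u-gap C) p
u-∉ (outside Vec.∷ C) k       le p | there x
  with Vec.there q ← subst (_∈ outside Vec.∷ C) (u-there C x) p =
  u-∉ C x (subst (ℕ._≤ toℕ x) (toℕ-gap C)
    (punchIn-≤⁻ (gap C) x (subst (ℕ._≤ toℕ (punchIn (gap C) x)) (sym (toℕ-gap C)) le))) q

u-mono : ∀ {n} (C : Subset n) {k l} → k < l → toℕ l ℕ.< ∣ C ∣ ⊎ ∣ C ∣ ℕ.≤ toℕ k →
         u C ⟨$⟩ʳ k < u C ⟨$⟩ʳ l
u-mono (inside  Vec.∷ C) {zero}  {suc l} lt side        = ℕ.z<s
u-mono (inside  Vec.∷ C) {suc k} {suc l} lt (inj₁ side) =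
  ℕ.s<s (u-mono C (ℕₚ.≤-pred lt) (inj₁ (ℕₚ.≤-pred side)))
u-mono (inside  Vec.∷ C) {suc k} {suc l} lt (inj₂ side) =
  ℕ.s<s (u-mono C (ℕₚ.≤-pred lt) (inj₂ (ℕₚ.≤-pred side)))
u-mono (outside Vec.∷ C) {k} {l} lt side with punchView (gap C) k | punchView (gap C) l
... | here    | here    = contradiction lt (ℕₚ.<-irrefl refl)
... | here    | there y = subst₂ _<_ (sym (u-gap C)) (sym (u-there C y)) ℕ.z<s
... | there x | here    with side
...   | inj₁ p = contradiction (subst (ℕ._< ∣ C ∣) (toℕ-gap C) p) (ℕₚ.<-irrefl refl)
...   | inj₂ p = contradiction
        (ℕₚ.<-≤-trans lt (subst (ℕ._≤ toℕ (punchIn (gap C) x)) (sym (toℕ-gap C)) p)) (ℕₚ.<-irrefl refl)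
u-mono (outside Vec.∷ C) {k} {l} lt side | there x | there y =
  subst₂ _<_ (sym (u-there C x)) (sym (u-there C y))
    (ℕ.s<s (u-mono C (punchIn-cancel-< (gap C) lt) (side′ side)))
  where
  a = gap C
  side′ : toℕ (punchIn a y) ℕ.< ∣ C ∣ ⊎ ∣ C ∣ ℕ.≤ toℕ (punchIn a x) →
          toℕ y ℕ.< ∣ C ∣ ⊎ ∣ C ∣ ℕ.≤ toℕ x
  side′ (inj₁ p) = inj₁ (subst (toℕ y ℕ.<_) (toℕ-gap C)
    (punchIn-<⁻ a y (subst (toℕ (punchIn a y) ℕ.<_) (sym (toℕ-gap C)) p)))
  side′ (inj₂ p) = inj₂ (subst (ℕ._≤ toℕ x) (toℕ-gap C)
    (punchIn-≤⁻ a x (subst (ℕ._≤ toℕ (punchIn a x)) (sym (toℕ-gap C)) p)))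

module ColumnLemmas where

  sᶜ-zero : ∀ {m} b b′ (C : Subset m) → sᶜ zero (b Vec.∷ b′ Vec.∷ C) ≡ b′ Vec.∷ b Vec.∷ C
  sᶜ-zero b b′ C = cong (λ D → b′ Vec.∷ b Vec.∷ D) (Vecₚ.tabulate∘lookup C)

  sᶜ-suc : ∀ {m} (j : Fin m) b (C : Subset (suc m)) → sᶜ (suc j) (b Vec.∷ C) ≡ b Vec.∷ sᶜ j C
  sᶜ-suc j b C = cong (b Vec.∷_) (Vecₚ.tabulate-cong λ i →
    cong (Vec.lookup (b Vec.∷ C)) (Perm.lift₀-transpose (inject₁ j) (suc j) (suc i)))

  sᶜ-size : ∀ {m} (j : Fin m) C → ∣ sᶜ j C ∣ ≡ ∣ C ∣
  sᶜ-size zero (b Vec.∷ b′ Vec.∷ C) = trans (cong ∣_∣ (sᶜ-zero b b′ C)) (swap b b′)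
    where
    swap : ∀ b b′ → ∣ b′ Vec.∷ b Vec.∷ C ∣ ≡ ∣ b Vec.∷ b′ Vec.∷ C ∣
    swap true  true  = refl
    swap true  false = refl
    swap false true  = refl
    swap false false = refl
  sᶜ-size (suc j) (true  Vec.∷ C) = trans (cong ∣_∣ (sᶜ-suc j true C)) (cong suc (sᶜ-size j C))
  sᶜ-size (suc j) (false Vec.∷ C) = trans (cong ∣_∣ (sᶜ-suc j false C)) (sᶜ-size j C)

  sᶜ-lookup : ∀ {m} (j : Fin m) C i → Vec.lookup (sᶜ j C) i ≡ Vec.lookup C (s j ⟨$⟩ʳ i)
  sᶜ-lookup j C i = Vecₚ.lookup∘tabulate (λ i′ → Vec.lookup C (s j ⟨$⟩ʳ i′)) i

  sᶜ-invol : ∀ {m} (j : Fin m) C → sᶜ j (sᶜ j C) ≡ C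
  sᶜ-invol j C = trans (Vecₚ.tabulate-cong (λ i →
    trans (sᶜ-lookup j C (s j ⟨$⟩ʳ i)) (cong (Vec.lookup C) (s-invol j i)))) (Vecₚ.tabulate∘lookup C)

  u-cover : ∀ {m} (j : Fin m) C → Vec.lookup C (inject₁ j) ≡ true → Vec.lookup C (suc j) ≡ false →
            Asc j (u C) × (u C ∘ₚ s j ≗ₚ u (sᶜ j C))
  u-cover zero (true Vec.∷ false Vec.∷ C) refl refl = asc , λ x →
    trans (eq x) (cong (λ D → u D ⟨$⟩ʳ x) (sym (sᶜ-zero true false C)))
    where
    a = gap C
    v = u (outside Vec.∷ C)
    asc : Asc zero (lift₀ v)
    asc = ℕ.z<s
    eq : ∀ x → s zero ⟨$⟩ʳ (lift₀ v ⟨$⟩ʳ x) ≡ u (false Vec.∷ true Vec.∷ C) ⟨$⟩ʳ x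
    eq zero = sym (u-there (true Vec.∷ C) zero)
    eq (suc x) with punchView a x
    ... | here = trans (cong (λ z → s zero ⟨$⟩ʳ suc z) (u-gap C)) (sym (u-gap (true Vec.∷ C)))
    ... | there y = trans (cong (λ z → s zero ⟨$⟩ʳ suc z) (u-there C y))
                          (sym (u-there (true Vec.∷ C) (suc y)))
  u-cover (suc j) (true Vec.∷ C) p q with u-cover j C p q
  ... | a , e = ℕ.s<s a , λ x → trans (eq x) (cong (λ D → u D ⟨$⟩ʳ x) (sym (sᶜ-suc j true C)))
    where
    eq : ∀ x → s (suc j) ⟨$⟩ʳ (lift₀ (u C) ⟨$⟩ʳ x) ≡ lift₀ (u (sᶜ j C)) ⟨$⟩ʳ x
    eq zero    = refl
    eq (suc x) = trans (Perm.lift₀-transpose (inject₁ j) (suc j) (suc (u C ⟨$⟩ʳ x))) (cong suc (e x))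
  u-cover (suc j) (false Vec.∷ C) p q with u-cover j C p q
  ... | a , e = subst₂ _<_ (sym (inv-there (inject₁ j))) (sym (inv-there (suc j)))
                  (punchIn-mono-< (gap C) a)
              , λ x → trans (eq x) (cong (λ D → u D ⟨$⟩ʳ x) (sym (sᶜ-suc j false C)))
    where
    D = sᶜ j C
    inv-there : ∀ y → u (false Vec.∷ C) ⟨$⟩ˡ suc y ≡ punchIn (gap C) (u C ⟨$⟩ˡ y)
    inv-there y = inv-eq (u (false Vec.∷ C)) (trans (u-there C (u C ⟨$⟩ˡ y)) (cong suc (inverseʳ (u C))))
    gap≡ : gap D ≡ gap C
    gap≡ = Finₚ.toℕ-injective (trans (toℕ-gap D) (trans (sᶜ-size j C) (sym (toℕ-gap C))))
    eq : ∀ x → s (suc j) ⟨$⟩ʳ (u (false Vec.∷ C) ⟨$⟩ʳ x) ≡ u (false Vec.∷ D) ⟨$⟩ʳ x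
    eq x with punchView (gap C) x
    ... | here = trans (cong (s (suc j) ⟨$⟩ʳ_) (u-gap C))
                   (sym (trans (cong (u (false Vec.∷ D) ⟨$⟩ʳ_) (sym gap≡)) (u-gap D)))
    ... | there y = trans (cong (s (suc j) ⟨$⟩ʳ_) (u-there C y))
        (trans (Perm.lift₀-transpose (inject₁ j) (suc j) (suc (u C ⟨$⟩ʳ y)))
          (trans (cong suc (e y))
            (sym (trans (cong (λ g → u (false Vec.∷ D) ⟨$⟩ʳ punchIn g y) (sym gap≡)) (u-there D y)))))

  u-bit : ∀ {n} (C : Subset n) k → Vec.lookup C (u C ⟨$⟩ʳ k) ≡ (toℕ k ℕ.<ᵇ ∣ C ∣)
  u-bit C k with toℕ k ℕ.<? ∣ C ∣
  ... | yes p = trans (Vecₚ.[]=⇒lookup (u-∈ C k p)) (sym (dec-true (toℕ k ℕ.<? ∣ C ∣) p))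
  ... | no p with Vec.lookup C (u C ⟨$⟩ʳ k) in e
  ...   | true  = contradiction (Vecₚ.lookup⇒[]= _ C e) (u-∉ C k (ℕₚ.≮⇒≥ p))
  ...   | false = sym (dec-false (toℕ k ℕ.<? ∣ C ∣) p)

  -- If j and j+1 lie on the same side of C, they are consecutive values of u_C
  -- at positions on the same side of ∣ C ∣.
  u-same : ∀ {m} (j : Fin m) C → Vec.lookup C (inject₁ j) ≡ Vec.lookup C (suc j) →
           ∃ λ k → u C ⟨$⟩ʳ inject₁ k ≡ inject₁ j × u C ⟨$⟩ʳ suc k ≡ suc j
                 × (toℕ (inject₁ k) ℕ.<ᵇ ∣ C ∣) ≡ (toℕ (suc k) ℕ.<ᵇ ∣ C ∣)
  u-same {m} j C bits = result (ℕₚ.<-cmp (toℕ x) (toℕ y))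
    where
    w = u C
    x = w ⟨$⟩ˡ inject₁ j
    y = w ⟨$⟩ˡ suc j
    ux : w ⟨$⟩ʳ x ≡ inject₁ j
    ux = inverseʳ w
    uy : w ⟨$⟩ʳ y ≡ suc j
    uy = inverseʳ w
    bit : (toℕ x ℕ.<ᵇ ∣ C ∣) ≡ (toℕ y ℕ.<ᵇ ∣ C ∣)
    bit = trans (sym (u-bit C x)) (trans (cong (Vec.lookup C) ux)
            (trans bits (trans (cong (Vec.lookup C) (sym uy)) (u-bit C y))))
    Side : ℕ → ℕ → Set
    Side a b = (a ℕ.< ∣ C ∣ × b ℕ.< ∣ C ∣) ⊎ (∣ C ∣ ℕ.≤ a × ∣ C ∣ ℕ.≤ b)
    side : Side (toℕ x) (toℕ y)
    side with toℕ x ℕ.<? ∣ C ∣ | toℕ y ℕ.<? ∣ C ∣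
    ... | yes p | yes q = inj₁ (p , q)
    ... | no p  | no q  = inj₂ (ℕₚ.≮⇒≥ p , ℕₚ.≮⇒≥ q)
    ... | yes p | no q with () ← trans (sym (dec-true (toℕ x ℕ.<? ∣ C ∣) p))
                                  (trans bit (dec-false (toℕ y ℕ.<? ∣ C ∣) q))
    ... | no p | yes q with () ← trans (sym (dec-false (toℕ x ℕ.<? ∣ C ∣) p))
                                  (trans bit (dec-true (toℕ y ℕ.<? ∣ C ∣) q))
    mono : ∀ {a b} → a < b → Side (toℕ a) (toℕ b) → w ⟨$⟩ʳ a < w ⟨$⟩ʳ b
    mono a<b (inj₁ (_ , q)) = u-mono C a<b (inj₁ q)
    mono a<b (inj₂ (p , _)) = u-mono C a<b (inj₂ p)
    flipˢ : ∀ {a b} → Side a b → Side b a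
    flipˢ (inj₁ (p , q)) = inj₁ (q , p)
    flipˢ (inj₂ (p , q)) = inj₂ (q , p)
    result : Tri (toℕ x ℕ.< toℕ y) (toℕ x ≡ toℕ y) (toℕ y ℕ.< toℕ x) →
             ∃ λ k → w ⟨$⟩ʳ inject₁ k ≡ inject₁ j × w ⟨$⟩ʳ suc k ≡ suc j
                   × (toℕ (inject₁ k) ℕ.<ᵇ ∣ C ∣) ≡ (toℕ (suc k) ℕ.<ᵇ ∣ C ∣)
    result (tri> _ _ y<x) = contradiction
      (ℕₚ.<-trans (subst₂ _<_ uy ux (mono y<x (flipˢ side)))
        (ℕₚ.≤-reflexive (cong suc (Finₚ.toℕ-inject₁ j)))) (ℕₚ.<-irrefl refl)
    result (tri≈ _ e _) = contradiction
      (trans (sym ux) (trans (cong (w ⟨$⟩ʳ_) (Finₚ.toℕ-injective e)) uy)) (inject₁≢suc j)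
    result (tri< x<y _ _) = k , trans (cong (w ⟨$⟩ʳ_) (sym x≡)) ux , trans (cong (w ⟨$⟩ʳ_) (sym y≡)) uy
                          , trans (cong (λ z → toℕ z ℕ.<ᵇ ∣ C ∣) (sym x≡))
                              (trans bit (cong (λ z → toℕ z ℕ.<ᵇ ∣ C ∣) y≡))
      where
      x<m : toℕ x ℕ.< m
      x<m = ℕₚ.<-≤-trans x<y (ℕₚ.≤-pred (Finₚ.toℕ<n y))
      k = fromℕ< x<m
      toℕ-k : toℕ k ≡ toℕ x
      toℕ-k = Finₚ.toℕ-fromℕ< x<m
      x≡ : x ≡ inject₁ k
      x≡ = Finₚ.toℕ-injective (sym (trans (Finₚ.toℕ-inject₁ k) toℕ-k))
      between : toℕ (suc k) ℕ.< toℕ y → Side (toℕ x) (toℕ (suc k)) × Side (toℕ (suc k)) (toℕ y)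
      between lt with side
      ... | inj₁ (p , q) = inj₁ (p , ℕₚ.<-trans lt q) , inj₁ (ℕₚ.<-trans lt q , q)
      ... | inj₂ (p , q) = inj₂ (p , p′) , inj₂ (p′ , q)
        where p′ = ℕₚ.≤-trans p (ℕₚ.≤-trans (ℕₚ.≤-reflexive (sym toℕ-k)) (ℕₚ.n≤1+n (toℕ k)))
      squeeze : toℕ (suc k) ℕ.< toℕ y → toℕ (inject₁ j) ℕ.< toℕ (w ⟨$⟩ʳ suc k) × w ⟨$⟩ʳ suc k < suc j
      squeeze lt =
          subst (_< w ⟨$⟩ʳ suc k) ux (mono (ℕₚ.≤-reflexive (cong suc (sym toℕ-k))) (proj₁ (between lt)))
        , subst (w ⟨$⟩ʳ suc k <_) uy (mono lt (proj₂ (between lt)))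
      y≡ : y ≡ suc k
      y≡ with ℕₚ.m≤n⇒m<n∨m≡n (subst (λ z → suc z ℕ.≤ toℕ y) (sym toℕ-k) x<y)
      ... | inj₂ e  = Finₚ.toℕ-injective (sym e)
      ... | inj₁ lt = contradiction
        (ℕₚ.<-≤-trans (subst (ℕ._< toℕ (w ⟨$⟩ʳ suc k)) (Finₚ.toℕ-inject₁ j) (proj₁ (squeeze lt)))
                      (ℕₚ.≤-pred (proj₂ (squeeze lt)))) (ℕₚ.<-irrefl refl)

  top-size : ∀ n l → l ℕ.≤ n → ∣ top n l ∣ ≡ l
  top-size zero    zero    _  = refl
  top-size (suc n) zero    _  = top-size n zero ℕ.z≤n
  top-size (suc n) (suc l) le = cong suc (top-size n l (ℕₚ.≤-pred le))

  u-top : ∀ n l → l ℕ.≤ n → u (top n l) ≗ₚ Perm.id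
  u-top (suc n) zero le x with punchView (gap (top n zero)) x
  ... | here = trans (u-gap (top n zero))
    (Finₚ.toℕ-injective (sym (trans (toℕ-gap (top n zero)) (top-size n zero ℕ.z≤n))))
  ... | there y = trans (u-there (top n zero) y) (trans (cong suc (u-top n zero ℕ.z≤n y))
    (Finₚ.toℕ-injective (sym (punchIn-above (gap (top n zero)) y
      (subst (ℕ._≤ toℕ y) (sym (trans (toℕ-gap (top n zero)) (top-size n zero ℕ.z≤n))) ℕ.z≤n)))))
  u-top (suc n) (suc l) le zero    = refl
  u-top (suc n) (suc l) le (suc x) = cong suc (u-top n l (ℕₚ.≤-pred le) x)

  subsets-complete : ∀ {n} (C : Subset n) → C ∈ˡ subsets n
  subsets-complete Vec.[]            = here refl
  subsets-complete (true  Vec.∷ C) = ∈ˡₚ.∈-++⁺ˡ (∈ˡₚ.∈-map⁺ _ (subsets-complete C))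
  subsets-complete {suc n} (false Vec.∷ C) =
    ∈ˡₚ.∈-++⁺ʳ (map (inside Vec.∷_) (subsets n)) (∈ˡₚ.∈-map⁺ _ (subsets-complete C))

  subsets-unique : ∀ n → Unique (subsets n)
  subsets-unique zero    = All.[] AllPairs.∷ AllPairs.[]
  subsets-unique (suc n) = Uniqueₚ.++⁺
    (Uniqueₚ.map⁺ Vecₚ.∷-injectiveʳ (subsets-unique n))
    (Uniqueₚ.map⁺ Vecₚ.∷-injectiveʳ (subsets-unique n))
    λ {C} (p , q) → disjoint (∈ˡₚ.∈-map⁻ (inside Vec.∷_) p) (∈ˡₚ.∈-map⁻ (outside Vec.∷_) q)
    where
    disjoint : ∀ {C : Subset (suc n)} {xs ys} → (∃ λ D → D ∈ˡ xs × C ≡ inside Vec.∷ D) →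
               (∃ λ D → D ∈ˡ ys × C ≡ outside Vec.∷ D) → ⊥
    disjoint (_ , _ , refl) (_ , _ , ())

open ColumnLemmas

infix  8 ⊖_
infixl 7 _⊛_
infixl 6 _⊕_

data Expr (G : Set) : Set where
  gen     : G → Expr G
  0ᴱ 1ᴱ   : Expr G
  _⊕_ _⊛_ : Expr G → Expr G → Expr G
  ⊖_      : Expr G → Expr G

module Presentation {G : Set} (_~_ : Expr G → Expr G → Set) where

  infix 4 _≈_

  data _≈_ : Expr G → Expr G → Set where
    rel      : ∀ {a b} → a ~ b → a ≈ b
    ≈-refl   : ∀ {a} → a ≈ a
    ≈-sym    : ∀ {a b} → a ≈ b → b ≈ a
    ≈-trans  : ∀ {a b c} → a ≈ b → b ≈ c → a ≈ c
    ⊕-cong   : ∀ {a b c d} → a ≈ b → c ≈ d → a ⊕ c ≈ b ⊕ d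
    ⊛-cong   : ∀ {a b c d} → a ≈ b → c ≈ d → a ⊛ c ≈ b ⊛ d
    ⊖-cong   : ∀ {a b} → a ≈ b → ⊖ a ≈ ⊖ b
    ⊕-assoc  : ∀ a b c → (a ⊕ b) ⊕ c ≈ a ⊕ (b ⊕ c)
    ⊕-comm   : ∀ a b → a ⊕ b ≈ b ⊕ a
    ⊕-zero   : ∀ a → 0ᴱ ⊕ a ≈ a
    ⊕-neg    : ∀ a → ⊖ a ⊕ a ≈ 0ᴱ
    ⊛-assoc  : ∀ a b c → (a ⊛ b) ⊛ c ≈ a ⊛ (b ⊛ c)
    ⊛-oneˡ   : ∀ a → 1ᴱ ⊛ a ≈ a
    ⊛-oneʳ   : ∀ a → a ⊛ 1ᴱ ≈ a
    distribˡ : ∀ a b c → a ⊛ (b ⊕ c) ≈ (a ⊛ b) ⊕ (a ⊛ c)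
    distribʳ : ∀ a b c → (b ⊕ c) ⊛ a ≈ (b ⊛ a) ⊕ (c ⊛ a)

  ring : Ring 0ℓ 0ℓ
  ring = record
    { Carrier = Expr G ; _≈_ = _≈_ ; _+_ = _⊕_ ; _*_ = _⊛_ ; -_ = ⊖_ ; 0# = 0ᴱ ; 1# = 1ᴱ
    ; isRing = record
      { +-isAbelianGroup = record
        { isGroup = record
          { isMonoid = record
            { isSemigroup = record
              { isMagma = record
                { isEquivalence = record { refl = ≈-refl ; sym = ≈-sym ; trans = ≈-trans }
                ; ∙-cong = ⊕-cong }
              ; assoc = ⊕-assoc }
            ; identity = ⊕-zero , λ a → ≈-trans (⊕-comm a 0ᴱ) (⊕-zero a) }
          ; inverse = ⊕-neg , λ a → ≈-trans (⊕-comm a (⊖ a)) (⊕-neg a)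
          ; ⁻¹-cong = ⊖-cong }
        ; comm = ⊕-comm }
      ; *-cong = ⊛-cong
      ; *-assoc = ⊛-assoc
      ; *-identity = ⊛-oneˡ , ⊛-oneʳ
      ; distrib = distribˡ , distribʳ } }

perms : ∀ n → List (Permutation′ n)
perms zero    = Perm.id ∷ []
perms (suc n) = List.cartesianProductWith (insert zero) (List.allFin (suc n)) (perms n)

-- The affine Hecke algebra for n = m + 1.  A ℤ[t^{±1}]-algebra is a ring with
-- a central unit t, so t^{±1} appear among the ring generators.

module AffineHecke (m : ℕ) where

  n : ℕ
  n = suc m

  data Gen : Set where
    ‵t ‵t⁻¹ : Gen
    ‵T      : Fin m → Gen
    ‵X ‵X⁻¹ : Fin n → Gen

  infix 4 _~_

  data _~_ : Expr Gen → Expr Gen → Set where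
    t-central   : ∀ g → gen ‵t ⊛ gen g ~ gen g ⊛ gen ‵t
    t⁻¹-central : ∀ g → gen ‵t⁻¹ ⊛ gen g ~ gen g ⊛ gen ‵t⁻¹
    t-inverse   : gen ‵t ⊛ gen ‵t⁻¹ ~ 1ᴱ
    X-inverseʳ  : ∀ i → gen (‵X i) ⊛ gen (‵X⁻¹ i) ~ 1ᴱ
    X-inverseˡ  : ∀ i → gen (‵X⁻¹ i) ⊛ gen (‵X i) ~ 1ᴱ
    quadratic   : ∀ i → gen (‵T i) ⊛ gen (‵T i) ~ (gen ‵t ⊕ ⊖ 1ᴱ) ⊛ gen (‵T i) ⊕ gen ‵t
    braid       : ∀ i j → toℕ j ≡ suc (toℕ i) →
                  gen (‵T i) ⊛ (gen (‵T j) ⊛ gen (‵T i)) ~ gen (‵T j) ⊛ (gen (‵T i) ⊛ gen (‵T j))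
    far-comm    : ∀ i j → 1 ℕ.< ℕ.∣ toℕ i - toℕ j ∣ → gen (‵T i) ⊛ gen (‵T j) ~ gen (‵T j) ⊛ gen (‵T i)
    XX-comm     : ∀ i j → gen (‵X i) ⊛ gen (‵X j) ~ gen (‵X j) ⊛ gen (‵X i)
    TXT         : ∀ i → gen (‵T i) ⊛ (gen (‵X (inject₁ i)) ⊛ gen (‵T i)) ~ gen ‵t ⊛ gen (‵X (suc i))
    TX-comm     : ∀ i j → j ≢ inject₁ i → j ≢ suc i → gen (‵T i) ⊛ gen (‵X j) ~ gen (‵X j) ⊛ gen (‵T i)

  H : Ring 0ℓ 0ℓ
  H = Presentation.ring _~_

  open Ring H public using (Carrier; _≈_; _+_; _*_; -_; _-_; 0#; 1#)
  open import Algebra.Properties.Semiring.Exp (Ring.semiring H) public using (_^_)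
  open Ring H using (*-monoid; setoid; +-cong; +-congˡ; +-congʳ; *-cong; *-congˡ; *-congʳ
      ; +-assoc; +-comm; *-assoc; distribˡ; distribʳ; +-identityˡ; +-identityʳ; *-identityˡ; *-identityʳ
      ; -‿inverseˡ; -‿inverseʳ; -‿cong; zeroˡ; zeroʳ; reflexive)
  open Ring H using () renaming (refl to ≈-refl; sym to ≈-sym; trans to ≈-trans)
  open import Algebra.Properties.Ring H using (-1*x≈-x; -‿distribˡ-*; -‿distribʳ-*)
  open import Relation.Binary.Reasoning.Setoid setoid
  open Presentation _~_ using (rel)

  t t⁻¹ : Carrier
  t   = gen ‵t
  t⁻¹ = gen ‵t⁻¹

  Tᵢ Tᵢ⁻¹ : Fin m → Carrier
  Tᵢ i   = gen (‵T i)
  Tᵢ⁻¹ i = t⁻¹ * (Tᵢ i + (1# - t))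

  T[_] : Permutation′ n → Carrier
  T[ w ] = prod *-monoid Tᵢ (word w)

  -- (T_{i₁} ⋯ T_{iₖ})⁻¹ = T_{iₖ}⁻¹ ⋯ T_{i₁}⁻¹
  T[_]⁻¹ : Permutation′ n → Carrier
  T[ w ]⁻¹ = prod *-monoid Tᵢ⁻¹ (List.reverse (word w))

  ∑ : ∀ {a} {A : Set a} → List A → (A → Carrier) → Carrier
  ∑ xs f = List.foldr (λ x acc → f x + acc) 0# xs

  infix 5 ∑
  syntax ∑ xs (λ x → e) = ∑[ x ∈ xs ] e

  data Generated (P : Gen → Set) : Carrier → Set where
    gen∈  : ∀ {g} → P g → Generated P (gen g)
    0∈    : Generated P 0#
    1∈    : Generated P 1#
    +∈    : ∀ {a b} → Generated P a → Generated P b → Generated P (a + b)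
    *∈    : ∀ {a b} → Generated P a → Generated P b → Generated P (a * b)
    -∈    : ∀ {a} → Generated P a → Generated P (- a)
    resp∈ : ∀ {a b} → a ≈ b → Generated P a → Generated P b

  data ScalarGen : Gen → Set where
    ‵t   : ScalarGen ‵t
    ‵t⁻¹ : ScalarGen ‵t⁻¹

  data FiniteGen : Gen → Set where
    scalar : ∀ {g} → ScalarGen g → FiniteGen g
    ‵T     : ∀ i → FiniteGen (‵T i)

  -- The image of ℤ[t^{±1}] in H, and the ℤ[t^{±1}]-subalgebra generated by the T_i.
  Scalar Hₙ : Carrier → Set
  Scalar = Generated ScalarGen
  Hₙ     = Generated FiniteGen

  -- H_{n,λ}, the span of the T_w with w λ = λ; here (w λ)_i = λ_{w⁻¹(i)}.
  Weight : Set
  Weight = Fin n → ℕ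

  Stabilises : Permutation′ n → Weight → Set
  Stabilises w λ′ = ∀ i → λ′ (w ⟨$⟩ˡ i) ≡ λ′ i

  stabilises? : ∀ λ′ w → Dec (Stabilises w λ′)
  stabilises? λ′ w = Finₚ.all? (λ i → λ′ (w ⟨$⟩ˡ i) ℕ.≟ λ′ i)

  data Parabolic (λ′ : Weight) : Carrier → Set where
    basis : ∀ w → Stabilises w λ′ → Parabolic λ′ T[ w ]
    0∈    : Parabolic λ′ 0#
    +∈    : ∀ {a b} → Parabolic λ′ a → Parabolic λ′ b → Parabolic λ′ (a + b)
    scale : ∀ {c a} → Scalar c → Parabolic λ′ a → Parabolic λ′ (c * a)
    resp∈ : ∀ {a b} → a ≈ b → Parabolic λ′ a → Parabolic λ′ b

  𝟏 : Weight → Carrier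
  𝟏 λ′ = ∑[ w ∈ filter (stabilises? λ′) (perms n) ] T[ w ]

  ϖ : ℕ → Weight
  ϖ l i = if toℕ i ℕ.<ᵇ l then 1 else 0

  Column : Set
  Column = Subset n

  -- An expression h = Σ_E T_{u_E} h_E over the columns E of length l.  It always
  -- exists for h ∈ H_n (decompose), and the h_E are determined by h because the T_w
  -- form a basis of H_n.
  record Decomposition (l : ℕ) (h : Carrier) : Set where
    field
      part      : Column → Carrier
      part∈     : ∀ E → ∣ E ∣ ≡ l → Parabolic (ϖ l) (part E)
      expansion : h ≈ ∑[ E ∈ columns n l ] T[ u E ] * part E
  open Decomposition public

  module HeckeLemmas where

    Comm : Carrier → Carrier → Set
    Comm a b = a * b ≈ b * a

    comm-0 : ∀ {a} → Comm a 0#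
    comm-0 {a} = ≈-trans (zeroʳ a) (≈-sym (zeroˡ a))

    comm-1 : ∀ {a} → Comm a 1#
    comm-1 {a} = ≈-trans (*-identityʳ a) (≈-sym (*-identityˡ a))

    comm-+ : ∀ {a b c} → Comm a b → Comm a c → Comm a (b + c)
    comm-+ {a} {b} {c} p q = ≈-trans (distribˡ a b c) (≈-trans (+-cong p q) (≈-sym (distribʳ a b c)))

    comm-* : ∀ {a b c} → Comm a b → Comm a c → Comm a (b * c)
    comm-* {a} {b} {c} p q = begin
      a * (b * c)  ≈⟨ *-assoc a b c ⟨
      a * b * c    ≈⟨ *-congʳ p ⟩
      b * a * c    ≈⟨ *-assoc b a c ⟩
      b * (a * c)  ≈⟨ *-congˡ q ⟩
      b * (c * a)  ≈⟨ *-assoc b c a ⟨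
      b * c * a    ∎

    comm-neg : ∀ {a b} → Comm a b → Comm a (- b)
    comm-neg {a} {b} p = ≈-trans (≈-sym (-‿distribʳ-* a b)) (≈-trans (-‿cong p) (-‿distribˡ-* b a))

    gen-central : ∀ {g} → ScalarGen g → ∀ h → Comm (gen g) h
    gen-central ‵t   (gen g) = rel (t-central g)
    gen-central ‵t⁻¹ (gen g) = rel (t⁻¹-central g)
    gen-central s    0ᴱ      = comm-0
    gen-central s    1ᴱ      = comm-1
    gen-central s    (a ⊕ b) = comm-+ (gen-central s a) (gen-central s b)
    gen-central s    (a ⊛ b) = comm-* (gen-central s a) (gen-central s b)
    gen-central s    (⊖ a)   = comm-neg (gen-central s a)

    central : ∀ {c} → Scalar c → ∀ h → Comm c h
    central (gen∈ s)    h = gen-central s h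
    central 0∈          h = ≈-sym comm-0
    central 1∈          h = ≈-sym comm-1
    central (+∈ p q)    h = ≈-sym (comm-+ (≈-sym (central p h)) (≈-sym (central q h)))
    central (*∈ p q)    h = ≈-sym (comm-* (≈-sym (central p h)) (≈-sym (central q h)))
    central (-∈ p)      h = ≈-sym (comm-neg (≈-sym (central p h)))
    central (resp∈ e p) h = ≈-trans (*-congʳ (≈-sym e)) (≈-trans (central p h) (*-congˡ e))

    t∈ : Scalar t
    t∈ = gen∈ ‵t

    t⁻¹∈ : Scalar t⁻¹
    t⁻¹∈ = gen∈ ‵t⁻¹

    -1∈ : Scalar (- 1#)
    -1∈ = -∈ 1∈

    weaken : ∀ {a} → Scalar a → Hₙ a
    weaken (gen∈ s)    = gen∈ (scalar s)
    weaken 0∈          = 0∈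
    weaken 1∈          = 1∈
    weaken (+∈ p q)    = +∈ (weaken p) (weaken q)
    weaken (*∈ p q)    = *∈ (weaken p) (weaken q)
    weaken (-∈ p)      = -∈ (weaken p)
    weaken (resp∈ e p) = resp∈ e (weaken p)

    pull : ∀ {c} → Scalar c → ∀ a b → a * (c * b) ≈ c * (a * b)
    pull {c} c∈ a b = begin
      a * (c * b)  ≈⟨ *-assoc a c b ⟨
      a * c * b    ≈⟨ *-congʳ (central c∈ a) ⟨
      c * a * b    ≈⟨ *-assoc c a b ⟩
      c * (a * b)  ∎

    TT : ∀ i → Tᵢ i * Tᵢ i ≈ (t - 1#) * Tᵢ i + t
    TT i = rel (quadratic i)

    cancel : (t - 1#) + (1# - t) ≈ 0#
    cancel = begin
      (t - 1#) + (1# - t)     ≈⟨ +-assoc t (- 1#) (1# - t) ⟩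
      t + (- 1# + (1# - t))   ≈⟨ +-congˡ (+-assoc (- 1#) 1# (- t)) ⟨
      t + ((- 1# + 1#) - t)   ≈⟨ +-congˡ (+-congʳ (-‿inverseˡ 1#)) ⟩
      t + (0# - t)            ≈⟨ +-congˡ (+-identityˡ (- t)) ⟩
      t - t                   ≈⟨ -‿inverseʳ t ⟩
      0#                      ∎

    T-T⁺ : ∀ i → Tᵢ i * (Tᵢ i + (1# - t)) ≈ t
    T-T⁺ i = begin
      Tᵢ i * (Tᵢ i + (1# - t))                    ≈⟨ distribˡ (Tᵢ i) (Tᵢ i) (1# - t) ⟩
      Tᵢ i * Tᵢ i + Tᵢ i * (1# - t)               ≈⟨ +-cong (TT i) (≈-sym (central (+∈ 1∈ (-∈ t∈)) (Tᵢ i))) ⟩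
      ((t - 1#) * Tᵢ i + t) + (1# - t) * Tᵢ i     ≈⟨ +-congʳ (+-comm ((t - 1#) * Tᵢ i) t) ⟩
      (t + (t - 1#) * Tᵢ i) + (1# - t) * Tᵢ i     ≈⟨ +-assoc t _ _ ⟩
      t + ((t - 1#) * Tᵢ i + (1# - t) * Tᵢ i)     ≈⟨ +-congˡ (distribʳ (Tᵢ i) (t - 1#) (1# - t)) ⟨
      t + ((t - 1#) + (1# - t)) * Tᵢ i            ≈⟨ +-congˡ (*-congʳ cancel) ⟩
      t + 0# * Tᵢ i                               ≈⟨ +-congˡ (zeroˡ (Tᵢ i)) ⟩
      t + 0#                                      ≈⟨ +-identityʳ t ⟩
      t                                           ∎

    t⁻¹t : t⁻¹ * t ≈ 1#
    t⁻¹t = ≈-trans (rel (t⁻¹-central ‵t)) (rel t-inverse)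

    Tᵢ-Tᵢ⁻¹ : ∀ i → Tᵢ i * Tᵢ⁻¹ i ≈ 1#
    Tᵢ-Tᵢ⁻¹ i = ≈-trans (pull t⁻¹∈ (Tᵢ i) _) (≈-trans (*-congˡ (T-T⁺ i)) t⁻¹t)

    Tᵢ⁻¹-Tᵢ : ∀ i → Tᵢ⁻¹ i * Tᵢ i ≈ 1#
    Tᵢ⁻¹-Tᵢ i = ≈-trans (≈-sym (comm-* (≈-sym (central t⁻¹∈ (Tᵢ i)))
      (comm-+ ≈-refl (≈-sym (central (+∈ 1∈ (-∈ t∈)) (Tᵢ i)))))) (Tᵢ-Tᵢ⁻¹ i)

    module B = Braid *-monoid

    prod-reverse : ∀ (f : Fin m → Carrier) i is →
      prod *-monoid f (List.reverse (i ∷ is)) ≈ prod *-monoid f (List.reverse is) * f i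
    prod-reverse f i is = ≈-trans (reflexive (cong (prod *-monoid f) (Listₚ.unfold-reverse i is)))
      (≈-trans (B.prod-++ f (List.reverse is) (i ∷ [])) (*-congˡ (*-identityʳ (f i))))

    inner : ∀ {a b c d} → b * c ≈ 1# → (a * b) * (c * d) ≈ a * d
    inner {a} {b} {c} {d} p = begin
      (a * b) * (c * d)  ≈⟨ *-assoc a b (c * d) ⟩
      a * (b * (c * d))  ≈⟨ *-congˡ (*-assoc b c d) ⟨
      a * (b * c * d)    ≈⟨ *-congˡ (*-congʳ p) ⟩
      a * (1# * d)       ≈⟨ *-congˡ (*-identityˡ d) ⟩
      a * d              ∎

  open HeckeLemmas

  T-inverseˡ : ∀ w → T[ w ]⁻¹ * T[ w ] ≈ 1#
  T-inverseˡ w = go (word w)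
    where
    go : ∀ is → prod *-monoid Tᵢ⁻¹ (List.reverse is) * prod *-monoid Tᵢ is ≈ 1#
    go []       = *-identityˡ 1#
    go (i ∷ is) = ≈-trans (*-congʳ (prod-reverse Tᵢ⁻¹ i is)) (≈-trans (inner (Tᵢ⁻¹-Tᵢ i)) (go is))

  T-inverseʳ : ∀ w → T[ w ] * T[ w ]⁻¹ ≈ 1#
  T-inverseʳ w = go (word w)
    where
    go : ∀ is → prod *-monoid Tᵢ is * prod *-monoid Tᵢ⁻¹ (List.reverse is) ≈ 1#
    go []       = *-identityˡ 1#
    go (i ∷ is) = begin
      (Tᵢ i * A) * prod *-monoid Tᵢ⁻¹ (List.reverse (i ∷ is))  ≈⟨ *-congˡ (prod-reverse Tᵢ⁻¹ i is) ⟩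
      (Tᵢ i * A) * (A′ * Tᵢ⁻¹ i)                               ≈⟨ inner (go is) ⟩
      Tᵢ i * Tᵢ⁻¹ i                                            ≈⟨ Tᵢ-Tᵢ⁻¹ i ⟩
      1#                                                       ∎
      where
      A  = prod *-monoid Tᵢ is
      A′ = prod *-monoid Tᵢ⁻¹ (List.reverse is)

  module DecompositionLemmas where

    prod-∈ : (f : Fin m → Carrier) → (∀ i → Hₙ (f i)) → ∀ is → Hₙ (prod *-monoid f is)
    prod-∈ f h []       = 1∈
    prod-∈ f h (i ∷ is) = *∈ (h i) (prod-∈ f h is)

    T∈ : ∀ w → Hₙ T[ w ]
    T∈ w = prod-∈ Tᵢ (λ i → gen∈ (‵T i)) (word w)

    T⁻¹∈ : ∀ w → Hₙ T[ w ]⁻¹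
    T⁻¹∈ w = prod-∈ Tᵢ⁻¹
      (λ i → *∈ (weaken t⁻¹∈) (+∈ (gen∈ (‵T i)) (weaken (+∈ 1∈ (-∈ t∈))))) (List.reverse (word w))

    ∑-∈ : ∀ {a} {A : Set a} (xs : List A) f → (∀ x → Hₙ (f x)) → Hₙ (∑ xs f)
    ∑-∈ []       f h = 0∈
    ∑-∈ (x ∷ xs) f h = +∈ (h x) (∑-∈ xs f h)

    𝟏∈ : ∀ λ′ → Hₙ (𝟏 λ′)
    𝟏∈ λ′ = ∑-∈ (filter (stabilises? λ′) (perms n)) T[_] T∈

    ^∈ : ∀ k → Hₙ (t ^ k)
    ^∈ zero    = 1∈
    ^∈ (suc k) = *∈ (weaken t∈) (^∈ k)

    Parabolic⇒Hₙ : ∀ {λ′ a} → Parabolic λ′ a → Hₙ a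
    Parabolic⇒Hₙ (basis w _) = T∈ w
    Parabolic⇒Hₙ 0∈          = 0∈
    Parabolic⇒Hₙ (+∈ p q)    = +∈ (Parabolic⇒Hₙ p) (Parabolic⇒Hₙ q)
    Parabolic⇒Hₙ (scale c p) = *∈ (weaken c) (Parabolic⇒Hₙ p)
    Parabolic⇒Hₙ (resp∈ e p) = resp∈ e (Parabolic⇒Hₙ p)

    braided : B.IsBraided Tᵢ
    braided = record { far-comm = λ i j d → rel (far-comm i j d) ; braid = λ i j e → rel (braid i j e) }

    T-cong : ∀ v w → v ≗ₚ w → T[ v ] ≈ T[ w ]
    T-cong v w e = reflexive (cong (prod *-monoid Tᵢ) (word-cong v w e))

    -- T_i² a = (t - 1) T_i a + t a
    TT-act : ∀ i a → Tᵢ i * (Tᵢ i * a) ≈ (t - 1#) * (Tᵢ i * a) + t * a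
    TT-act i a = begin
      Tᵢ i * (Tᵢ i * a)                ≈⟨ *-assoc (Tᵢ i) (Tᵢ i) a ⟨
      Tᵢ i * Tᵢ i * a                  ≈⟨ *-congʳ (TT i) ⟩
      ((t - 1#) * Tᵢ i + t) * a        ≈⟨ distribʳ a ((t - 1#) * Tᵢ i) t ⟩
      (t - 1#) * Tᵢ i * a + t * a      ≈⟨ +-congʳ (*-assoc (t - 1#) (Tᵢ i) a) ⟩
      (t - 1#) * (Tᵢ i * a) + t * a    ∎

    t-1∈ : Scalar (t - 1#)
    t-1∈ = +∈ t∈ -1∈

    -- If ℓ (s_i w) < ℓ w, then T_i T_w = (t - 1) T_w + t T_{s_i w}.
    descend : ∀ i w → ¬ Asc i w → Tᵢ i * T[ w ] ≈ (t - 1#) * T[ w ] + t * T[ w ∘ₚ s i ]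
    descend i w ¬a = begin
      Tᵢ i * T[ w ]                               ≈⟨ *-congˡ eq ⟩
      Tᵢ i * (Tᵢ i * T[ v ])                      ≈⟨ TT-act i T[ v ] ⟩
      (t - 1#) * (Tᵢ i * T[ v ]) + t * T[ v ]     ≈⟨ +-congʳ (*-congˡ eq) ⟨
      (t - 1#) * T[ w ] + t * T[ v ]              ∎
      where
      v = w ∘ₚ s i
      eq : T[ w ] ≈ Tᵢ i * T[ v ]
      eq = ≈-trans (T-cong w (v ∘ₚ s i) (λ x → sym (s-s i w x)))
                   (≈-sym (B.ascend Tᵢ braided i v (¬Asc⇒Asc-s i w ¬a)))

    stab-s : ∀ {λ′} k → λ′ (inject₁ k) ≡ λ′ (suc k) → ∀ w → Stabilises w λ′ → Stabilises (w ∘ₚ s k) λ′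
    stab-s {λ′} k e w st i = trans (st (s k ⟨$⟩ˡ i)) (trans (cong λ′ (s-inv k i)) (fix (s-cases k i)))
      where
      fix : i ≡ inject₁ k ⊎ i ≡ suc k ⊎ (i ≢ inject₁ k × i ≢ suc k) → λ′ (s k ⟨$⟩ʳ i) ≡ λ′ i
      fix (inj₁ refl) = trans (cong λ′ (s-at k)) (sym e)
      fix (inj₂ (inj₁ refl)) = trans (cong λ′ (s-at⁺ k)) e
      fix (inj₂ (inj₂ (p , q))) = cong λ′ (s-off k p q)

    Parabolic-T : ∀ {λ′} k → λ′ (inject₁ k) ≡ λ′ (suc k) → ∀ {a} → Parabolic λ′ a → Parabolic λ′ (Tᵢ k * a)
    Parabolic-T k e (basis w st) with asc? k w
    ... | yes a = resp∈ (≈-sym (B.ascend Tᵢ braided k w a)) (basis (w ∘ₚ s k) (stab-s k e w st))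
    ... | no ¬a = resp∈ (≈-sym (descend k w ¬a))
                    (+∈ (scale t-1∈ (basis w st)) (scale t∈ (basis (w ∘ₚ s k) (stab-s k e w st))))
    Parabolic-T k e 0∈ = resp∈ (≈-sym (zeroʳ (Tᵢ k))) 0∈
    Parabolic-T k e (+∈ {a} {b} p q) =
      resp∈ (≈-sym (distribˡ (Tᵢ k) a b)) (+∈ (Parabolic-T k e p) (Parabolic-T k e q))
    Parabolic-T k e (scale {c} {a} c∈ p) =
      resp∈ (≈-sym (pull c∈ (Tᵢ k) a)) (scale c∈ (Parabolic-T k e p))
    Parabolic-T k e (resp∈ eq p) = resp∈ (*-congˡ eq) (Parabolic-T k e p)

    ∑-cong : ∀ {a} {A : Set a} (xs : List A) {f g : A → Carrier} → (∀ x → f x ≈ g x) → ∑ xs f ≈ ∑ xs g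
    ∑-cong []       h = ≈-refl
    ∑-cong (x ∷ xs) h = +-cong (h x) (∑-cong xs h)

    ∑-0 : ∀ {a} {A : Set a} (xs : List A) {f : A → Carrier} → All (λ x → f x ≈ 0#) xs → ∑ xs f ≈ 0#
    ∑-0 []       All.[]       = ≈-refl
    ∑-0 (x ∷ xs) (p All.∷ ps) = ≈-trans (+-cong p (∑-0 xs ps)) (+-identityˡ 0#)

    ∑-* : ∀ {a} {A : Set a} c (xs : List A) (f : A → Carrier) → c * ∑ xs f ≈ ∑ xs (λ x → c * f x)
    ∑-* c []       f = zeroʳ c
    ∑-* c (x ∷ xs) f = ≈-trans (distribˡ c (f x) (∑ xs f)) (+-congˡ (∑-* c xs f))

    ∑-+ : ∀ {a} {A : Set a} (xs : List A) (f g : A → Carrier) → ∑ xs (λ x → f x + g x) ≈ ∑ xs f + ∑ xs g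
    ∑-+ []       f g = ≈-sym (+-identityˡ 0#)
    ∑-+ (x ∷ xs) f g = begin
      (f x + g x) + ∑ xs (λ x → f x + g x)  ≈⟨ +-congˡ (∑-+ xs f g) ⟩
      (f x + g x) + (F + G)                 ≈⟨ +-assoc (f x) (g x) (F + G) ⟩
      f x + (g x + (F + G))                 ≈⟨ +-congˡ (+-assoc (g x) F G) ⟨
      f x + ((g x + F) + G)                 ≈⟨ +-congˡ (+-congʳ (+-comm (g x) F)) ⟩
      f x + ((F + g x) + G)                 ≈⟨ +-congˡ (+-assoc F (g x) G) ⟩
      f x + (F + (g x + G))                 ≈⟨ +-assoc (f x) F (g x + G) ⟨
      (f x + F) + (g x + G)                 ∎
      where F = ∑ xs f
            G = ∑ xs g

    ∑-δ : ∀ {a} {A : Set a} {xs : List A} (f : A → Carrier) y → Unique xs → y ∈ˡ xs →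
          (∀ x → x ≢ y → f x ≈ 0#) → ∑ xs f ≈ f y
    ∑-δ f y (y≢ AllPairs.∷ us) (here refl) h =
      ≈-trans (+-congˡ (∑-0 _ (All.map (λ {x} y≢x → h x (λ e → y≢x (sym e))) y≢))) (+-identityʳ (f y))
    ∑-δ {xs = x ∷ xs} f y (x≢ AllPairs.∷ us) (there y∈) h =
      ≈-trans (+-cong (h x (λ { refl → All.lookup x≢ y∈ refl })) (∑-δ f y us y∈ h)) (+-identityˡ (f y))

    module _ {l : ℕ} where

      D-resp : ∀ {a b} → a ≈ b → Decomposition l a → Decomposition l b
      D-resp e d = record { part = part d ; part∈ = part∈ d ; expansion = ≈-trans (≈-sym e) (expansion d) }

      D-0 : Decomposition l 0#
      D-0 = record { part = λ _ → 0# ; part∈ = λ _ _ → 0∈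
                   ; expansion = ≈-sym (∑-0 (columns n l) (All.universal (λ E → zeroʳ T[ u E ]) _)) }

      D-+ : ∀ {a b} → Decomposition l a → Decomposition l b → Decomposition l (a + b)
      D-+ d e = record
        { part = λ E → part d E + part e E
        ; part∈ = λ E p → +∈ (part∈ d E p) (part∈ e E p)
        ; expansion = ≈-trans (+-cong (expansion d) (expansion e)) (≈-trans (≈-sym (∑-+ (columns n l) _ _))
            (∑-cong (columns n l) (λ E → ≈-sym (distribˡ T[ u E ] (part d E) (part e E))))) }

      D-scale : ∀ {c a} → Scalar c → Decomposition l a → Decomposition l (c * a)
      D-scale {c} c∈ d = record
        { part = λ E → c * part d E
        ; part∈ = λ E p → scale c∈ (part∈ d E p)
        ; expansion = ≈-trans (*-congˡ (expansion d)) (≈-trans (∑-* c (columns n l) _)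
            (∑-cong (columns n l) (λ E → ≈-sym (pull c∈ T[ u E ] (part d E))))) }

      D-∑ : ∀ xs (f : Column → Carrier) → (∀ E → E ∈ˡ xs → Decomposition l (f E)) → Decomposition l (∑ xs f)
      D-∑ []       f h = D-0
      D-∑ (E ∷ xs) f h = D-+ (h E (here refl)) (D-∑ xs f (λ E′ p → h E′ (there p)))

      D-single : ∀ F g → ∣ F ∣ ≡ l → Parabolic (ϖ l) g → Decomposition l (T[ u F ] * g)
      D-single F g size g∈ = record
        { part = δ
        ; part∈ = λ E _ → δ∈ E
        ; expansion = ≈-sym (≈-trans
            (∑-δ (λ E → T[ u E ] * δ E) F (Uniqueₚ.filter⁺ (λ C → ∣ C ∣ ℕ.≟ l) (subsets-unique n))
              (∈ˡₚ.∈-filter⁺ (λ C → ∣ C ∣ ℕ.≟ l) (subsets-complete F) size)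
              (λ E E≢F → ≈-trans (*-congˡ (reflexive (δ-off E E≢F))) (zeroʳ T[ u E ])))
            (*-congˡ (reflexive δ-at))) }
        where
        _≟ᶜ_ : (C D : Column) → Dec (C ≡ D)
        _≟ᶜ_ = Vecₚ.≡-dec Boolₚ._≟_
        δ : Column → Carrier
        δ E = if does (E ≟ᶜ F) then g else 0#
        δ-at : δ F ≡ g
        δ-at = cong (if_then g else 0#) (dec-true (F ≟ᶜ F) refl)
        δ-off : ∀ E → E ≢ F → δ E ≡ 0#
        δ-off E E≢F = cong (if_then g else 0#) (dec-false (E ≟ᶜ F) E≢F)
        δ∈ : ∀ E → Parabolic (ϖ l) (δ E)
        δ∈ E with does (E ≟ᶜ F)
        ... | true  = g∈
        ... | false = 0∈

      -- T_j T_{u_E} g for g ∈ H_{n,ϖ_l}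
      D-T : ∀ j E g → ∣ E ∣ ≡ l → Parabolic (ϖ l) g → Decomposition l (Tᵢ j * (T[ u E ] * g))
      D-T j E g size g∈ = cases (Vec.lookup E (inject₁ j)) (Vec.lookup E (suc j)) refl refl
        where
        up : ∀ F → Vec.lookup F (inject₁ j) ≡ true → Vec.lookup F (suc j) ≡ false →
             Tᵢ j * T[ u F ] ≈ T[ u (sᶜ j F) ]
        up F p q = ≈-trans (B.ascend Tᵢ braided j (u F) (proj₁ (u-cover j F p q)))
                           (T-cong (u F ∘ₚ s j) (u (sᶜ j F)) (proj₂ (u-cover j F p q)))

        same : Vec.lookup E (inject₁ j) ≡ Vec.lookup E (suc j) → Decomposition l (Tᵢ j * (T[ u E ] * g))
        same bits = D-resp eq (D-single E (Tᵢ k * g) size (Parabolic-T k ϖ≡ g∈))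
          where
          k = proj₁ (u-same j E bits)
          uk : u E ⟨$⟩ʳ inject₁ k ≡ inject₁ j
          uk = proj₁ (proj₂ (u-same j E bits))
          uk⁺ : u E ⟨$⟩ʳ suc k ≡ suc j
          uk⁺ = proj₁ (proj₂ (proj₂ (u-same j E bits)))
          ϖ≡ : ϖ l (inject₁ k) ≡ ϖ l (suc k)
          ϖ≡ = subst (λ l → ϖ l (inject₁ k) ≡ ϖ l (suc k)) size
                 (cong (if_then 1 else 0) (proj₂ (proj₂ (proj₂ (u-same j E bits)))))
          TuT : T[ u E ] * Tᵢ k ≈ Tᵢ j * T[ u E ]
          TuT = begin
            T[ u E ] * Tᵢ k      ≈⟨ B.ascendʳ Tᵢ braided (u E) k (subst₂ _<_ (sym uk) (sym uk⁺) j<) ⟩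
            T[ s k ∘ₚ u E ]      ≈⟨ T-cong (s k ∘ₚ u E) (u E ∘ₚ s j)
                                      (λ x → sym (s-conj (u E ⟨$⟩ʳ_) (w-inj (u E)) k j uk uk⁺ x)) ⟩
            T[ u E ∘ₚ s j ]      ≈⟨ B.ascend Tᵢ braided j (u E)
                                      (subst₂ _<_ (sym (inv-eq (u E) uk)) (sym (inv-eq (u E) uk⁺)) k<) ⟨
            Tᵢ j * T[ u E ]      ∎
            where
            j< : inject₁ j < suc j
            j< = ℕ.s≤s (ℕₚ.≤-reflexive (Finₚ.toℕ-inject₁ j))
            k< : inject₁ k < suc k
            k< = ℕ.s≤s (ℕₚ.≤-reflexive (Finₚ.toℕ-inject₁ k))
          eq : T[ u E ] * (Tᵢ k * g) ≈ Tᵢ j * (T[ u E ] * g)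
          eq = ≈-trans (≈-sym (*-assoc T[ u E ] (Tᵢ k) g))
                 (≈-trans (*-congʳ TuT) (*-assoc (Tᵢ j) T[ u E ] g))

        cases : ∀ b b′ → Vec.lookup E (inject₁ j) ≡ b → Vec.lookup E (suc j) ≡ b′ →
                Decomposition l (Tᵢ j * (T[ u E ] * g))
        cases true  true  p q = same (trans p (sym q))
        cases false false p q = same (trans p (sym q))
        cases true  false p q = D-resp
          (≈-sym (≈-trans (≈-sym (*-assoc (Tᵢ j) T[ u E ] g)) (*-congʳ (up E p q))))
          (D-single (sᶜ j E) g (trans (sᶜ-size j E) size) g∈)
        cases false true  p q = D-resp (≈-sym eq)
          (D-+ (D-scale t-1∈ (D-single E g size g∈))
               (D-scale t∈ (D-single F g (trans (sᶜ-size j E) size) g∈)))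
          where
          F = sᶜ j E
          down : T[ u E ] ≈ Tᵢ j * T[ u F ]
          down = ≈-sym (≈-trans
            (up F (trans (sᶜ-lookup j E (inject₁ j)) (trans (cong (Vec.lookup E) (s-at j)) q))
                  (trans (sᶜ-lookup j E (suc j)) (trans (cong (Vec.lookup E) (s-at⁺ j)) p)))
            (reflexive (cong (λ C → T[ u C ]) (sᶜ-invol j E))))
          down-g : T[ u E ] * g ≈ Tᵢ j * (T[ u F ] * g)
          down-g = ≈-trans (*-congʳ down) (*-assoc (Tᵢ j) T[ u F ] g)
          eq : Tᵢ j * (T[ u E ] * g) ≈ (t - 1#) * (T[ u E ] * g) + t * (T[ u F ] * g)
          eq = begin
            Tᵢ j * (T[ u E ] * g)                                  ≈⟨ *-congˡ down-g ⟩
            Tᵢ j * (Tᵢ j * (T[ u F ] * g))                         ≈⟨ TT-act j (T[ u F ] * g) ⟩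
            (t - 1#) * (Tᵢ j * (T[ u F ] * g)) + t * (T[ u F ] * g) ≈⟨ +-congʳ (*-congˡ down-g) ⟨
            (t - 1#) * (T[ u E ] * g) + t * (T[ u F ] * g)         ∎

      act : ∀ {a b} → Hₙ a → Decomposition l b → Decomposition l (a * b)
      act (gen∈ (scalar s)) d = D-scale (gen∈ s) d
      act (gen∈ (‵T j)) d = D-resp
        (≈-sym (≈-trans (*-congˡ (expansion d)) (∑-* (Tᵢ j) (columns n l) (λ E → T[ u E ] * part d E))))
        (D-∑ (columns n l) (λ E → Tᵢ j * (T[ u E ] * part d E)) λ E E∈ →
          let size = proj₂ (∈ˡₚ.∈-filter⁻ (λ C → ∣ C ∣ ℕ.≟ l) {xs = subsets n} E∈) in
          D-T j E (part d E) size (part∈ d E size))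
      act {b = b} 0∈ d = D-resp (≈-sym (zeroˡ b)) D-0
      act {b = b} 1∈ d = D-resp (≈-sym (*-identityˡ b)) d
      act {b = b} (+∈ {x} {y} p q) d = D-resp (≈-sym (distribʳ b x y)) (D-+ (act p d) (act q d))
      act {b = b} (*∈ {x} {y} p q) d = D-resp (≈-sym (*-assoc x y b)) (act p (act q d))
      act {b = b} (-∈ {x} p) d = D-resp (≈-trans (-1*x≈-x (x * b)) (-‿distribˡ-* x b)) (D-scale -1∈ (act p d))
      act (resp∈ e p) d = D-resp (*-congʳ e) (act p d)

  open DecompositionLemmas

  decompose : ∀ l → l ℕ.≤ n → ∀ {h} → Hₙ h → Decomposition l h
  decompose l l≤n {h} h∈ = D-resp (*-identityʳ h) (act h∈
    (D-resp T1*T1 (D-single (top n l) T[ Perm.id ] (top-size n l l≤n) (basis Perm.id (λ _ → refl)))))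
    where
    T1 : T[ Perm.id ] ≈ 1#
    T1 = reflexive (cong (prod *-monoid Tᵢ) word-id)
    T1*T1 : T[ u (top n l) ] * T[ Perm.id ] ≈ 1#
    T1*T1 = ≈-trans (*-cong (≈-trans (T-cong (u (top n l)) Perm.id (u-top n l l≤n)) T1) T1) (*-identityˡ 1#)

  -- Multiplication by t^{ℓ(u_C)} (T_{u_C⁻¹})⁻¹.
  lead : Column → Carrier → Carrier
  lead C h = t ^ ℓ (u C) * (T[ Perm.flip (u C) ]⁻¹ * h)

  -- Ψ of the tableau with leftmost column C followed by the columns S, together
  -- with the fact that it lies in H_n, which the recursion needs.
  ψ : Column → List Column → ∃ Hₙ
  ψ C []      = lead C (𝟏 (ϖ ∣ C ∣)) , *∈ (^∈ (ℓ (u C))) (*∈ (T⁻¹∈ (Perm.flip (u C))) (𝟏∈ (ϖ ∣ C ∣)))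
  ψ C (D ∷ S) = lead C (part d C) , *∈ (^∈ (ℓ (u C))) (*∈ (T⁻¹∈ (Perm.flip (u C))) (Parabolic⇒Hₙ (part∈ d C refl)))
    where
    d : Decomposition ∣ C ∣ (proj₁ (ψ D S))
    d = decompose ∣ C ∣ (∣p∣≤n C) (proj₂ (ψ D S))

  -- A tableau lists its columns from left to right: C_r first, C_1 last.
  Tableau : Set
  Tableau = List⁺ Column

  Ψ : Tableau → Carrier
  Ψ (C ∷ S) = proj₁ (ψ C S)

  -- C_r ⊗ ⋯ ⊗ C_1 from the family k ↦ C_{k+1}.
  ⨂ : ∀ {r} → (Fin (suc r) → Column) → Tableau
  ⨂ {zero}  C = C zero ∷ []
  ⨂ {suc r} C = C (fromℕ (suc r)) ∷ toList (⨂ (C ∘ inject₁))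

  infixl 5 _⊗_
  _⊗_ : Tableau → List Column → Tableau
  T ⊗ T′ = T ⁺++ T′

  -- Two adjacent columns, the left one at least as long, are weakly increasing
  -- along each row that meets both.
  data _≼_ : List (Fin n) → List (Fin n) → Set where
    []  : ∀ {cs} → cs ≼ []
    _∷_ : ∀ {c d cs ds} → c Fin.≤ d → cs ≼ ds → (c ∷ cs) ≼ (d ∷ ds)

  Semistandard : Tableau → Set
  Semistandard T = Linked (λ C D → entries C ≼ entries D) (toList T)

  HighestWeight : Tableau → Set
  HighestWeight T = All (λ C → C ≡ top n ∣ C ∣) (toList T)

  shape : Tableau → Weight
  shape T i = ListAction.sum (map (λ C → ϖ ∣ C ∣ i) (toList T))

  Dominant : Weight → Set
  Dominant μ = ∀ i j → i Fin.≤ j → μ j ℕ.≤ μ i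

  nonzeroParts : Weight → ℕ
  nonzeroParts μ = length (filter (λ i → 0 ℕ.<? μ i) (List.allFin n))

  -- For dominant μ: column c of the Young diagram of μ meets exactly the rows i
  -- with c < μ i (c counted from 0), and its box in row i is filled with i.
  T⁰ : Weight → List Column
  T⁰ μ = map (λ c → Vec.tabulate (λ i → c ℕ.<ᵇ μ i)) (List.upTo (μ zero))

  σ : Fin m → Column → Sign
  σ j C = if does (inject₁ j ∈? C) ∧ not (does (suc j ∈? C)) then Sign.- else Sign.+

  infixr 8 _·_
  _·_ : Sign → Carrier → Carrier
  Sign.+ · h = h
  Sign.- · h = - h

  -- Ω^j_k, applying s_j to C_1 , … , C_k.
  Ω : ∀ {r} → Fin m → ℕ → (Fin r → Column) → (Fin r → Column)
  Ω j k C i = if toℕ i ℕ.<ᵇ k then sᶜ j (C i) else C i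

{-# OPTIONS --safe #-}
module Submission where

-- The T_w are linearly independent in the affine Hecke algebra: sending X_{i+1} to t⁻¹ T_i X_i T_i
-- and X_1 to 1 (the Jucys–Murphy elements) extends the regular representation of H_n to it.
-- Hence the decomposition h = Σ_E T_{u_E} h_E is unique, and prepending a column C to a tableau is
-- the linear map Φ_C : h ↦ t^{ℓ(u_C)} (T_{u_C⁻¹})⁻¹ h_C.
--
-- (a) If h ∈ H_{n,ϖ_d} with d = |D|, then t^{ℓ(u_D)} (T_{u_D⁻¹})⁻¹ h is a combination of T_w
-- with w{1,…,d} entrywise at most D; for these, w{1,…,l} = C with l ≥ d forces C ≼ D.
-- (b) The part of 𝟏_λ at the highest weight column is 𝟏_{λ+ϖ}, the stabiliser of a sum of
-- dominant weights being the intersection of their stabilisers.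
-- (c) Computing Φ_C (T_j h) and Φ_C (t T_j⁻¹ h) for the four positions of j , j+1 relative to C gives
-- Φ_C (T_j^{±1} h) = T_j^{±1} Φ_{s_j C} h, with the sign read off C on the right, up to ± (1 - t) Φ_C h
-- when the two signs differ; the formula follows by induction on the number of columns.
-- The induction starts because semistandardness makes C_1 contain the first column of T⁰_μ.  Then
-- u_{C_1} and u_{s_j C_1} fix the weight of T⁰_μ, so Ψ_{T⁰_μ} has the same part at C_1 and s_j C_1.

open import Defs
open import Algebra.Bundles using (Monoid; Ring; CommutativeRing)
import Algebra.Solver.Ring.NaturalCoefficients.Default as Solver
open import Data.Bool.Base using (Bool; T; true; false; if_then_else_; _∧_; not)
import Data.Bool.Properties as Boolₚ
open import Data.Fin.Base as Fin using (Fin; zero; suc; toℕ; fromℕ; inject₁)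
open import Data.Fin.Permutation as Perm
  using (Permutation′; _⟨$⟩ʳ_; _⟨$⟩ˡ_; _∘ₚ_; insert; remove; inverseʳ; inverseˡ) renaming (_≈_ to _≗ₚ_)
import Data.Fin.Properties as Finₚ
open import Data.Fin.Subset using (Subset; ∣_∣; _∈_; _∉_)
open import Data.Fin.Subset.Properties using (∣p∣≤n; _∈?_)
open import Data.List.Base as List using (List; []; _∷_; _++_; filter; map; allFin)
import Data.List.Membership.Propositional.Properties as ∈ˡₚ
import Data.List.NonEmpty.Base as List⁺
open import Data.List.NonEmpty.Base using (toList) renaming (_∷_ to _∷⁺_)
import Data.List.Properties as Listₚ
open import Data.List.Relation.Unary.All as All using (All)
import Data.List.Relation.Unary.All.Properties as Allₚ
open import Data.List.Relation.Unary.AllPairs as AllPairs using (AllPairs)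
import Data.List.Relation.Unary.AllPairs.Properties as AllPairsₚ
open import Data.List.Relation.Unary.Linked as Linked using (Linked; []; [-]; _∷_)
import Data.List.Relation.Unary.Unique.Propositional.Properties as Uniqueₚ
open import Data.Nat.Base as ℕ using (ℕ; zero; suc; _≤_)
import Data.Nat.ListAction as ListAction
import Data.Nat.Properties as ℕₚ
open import Data.Product.Base using (∃; _×_; _,_; proj₁; proj₂)
open import Data.Sign as Sign using (Sign)
open import Data.Sum.Base using (_⊎_; inj₁; inj₂; [_,_]′)
open import Data.Vec.Base as Vec using (Vec; []; _∷_)
import Data.Vec.Properties as Vecₚ
open import Function.Base using (_∘_)
open import Level using (0ℓ; _⊔_)
open import Relation.Binary.Definitions using (tri<; tri≈; tri>)
open import Relation.Binary.PropositionalEquality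
  using (_≡_; _≢_; refl; sym; trans; cong; cong₂; subst; subst₂)
open import Relation.Nullary using (¬_; Dec; yes; no; does; contradiction)
open import Relation.Nullary.Decidable using (dec-true; dec-false)

open PermutationLemmas hiding (here; there)
open WordLemmas using (perm-ind; word-id)
open BraidLemmas
open ColumnLemmas

-- The regular representation of the finite Hecke algebra

-- `H` is given only by generators and relations, so it is not known beforehand that the `T[ w ]`
-- are independent, nor that ℤ[t^±1] embeds in `H`. Coefficients therefore live in the image of
-- ℤ[t^±1] inside `H`, where they can multiply the `T[ w ]` directly. The representation acts on
-- functions of words in ℕ, not just of permutations: such words may lose their first letter, so
-- each relation is checked by recursion down to the few leading letters that it touches. The
-- parameter q stands for t - 1: in T² = q T + (q + 1) no subtraction occurs, and the relations
-- become identities over commutative semirings. What makes Φ_C computable is that the permutations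
-- w with w{1,...,l} = C form one coset of the stabiliser of ϖ_l. If exactly one of j , j+1 lies in
-- C, then j is an ascent on all of this coset or on none of it; if both or neither do, then s_j u_C
-- = u_C s_k with s_k in the stabiliser, and T_j passes through T_{u_C} as T_k.

module LinearEndomorphisms {c ℓ} (A : CommutativeRing c ℓ) {x} (X : Set x) where
  open CommutativeRing A renaming (refl to ≈-refl; sym to ≈-sym; trans to ≈-trans)
  open import Algebra.Properties.Ring ring using (-‿distribʳ-*; -‿+-comm)
  open import Algebra.Properties.CommutativeSemigroup +-commutativeSemigroup using (interchange)
  open import Algebra.Properties.CommutativeSemigroup *-commutativeSemigroup using (x∙yz≈y∙xz)

  record End : Set (c ⊔ ℓ ⊔ x) where
    field
      ⟪_⟫     : (X → Carrier) → X → Carrier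
      ⟪⟫-cong : ∀ {f g} → (∀ x → f x ≈ g x) → ∀ x → ⟪_⟫ f x ≈ ⟪_⟫ g x
      ⟪⟫-+    : ∀ f g x → ⟪_⟫ (λ x → f x + g x) x ≈ ⟪_⟫ f x + ⟪_⟫ g x
      ⟪⟫-*    : ∀ a f x → ⟪_⟫ (λ x → a * f x) x ≈ a * ⟪_⟫ f x
  open End public

  endRing : Ring (c ⊔ ℓ ⊔ x) (c ⊔ ℓ ⊔ x)
  endRing = record
    { Carrier = End
    ; _≈_ = λ φ ψ → ∀ f x → ⟪ φ ⟫ f x ≈ ⟪ ψ ⟫ f x
    ; _+_ = λ φ ψ → record
      { ⟪_⟫ = λ f x → ⟪ φ ⟫ f x + ⟪ ψ ⟫ f x
      ; ⟪⟫-cong = λ e x → +-cong (⟪⟫-cong φ e x) (⟪⟫-cong ψ e x)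
      ; ⟪⟫-+ = λ f g x → ≈-trans (+-cong (⟪⟫-+ φ f g x) (⟪⟫-+ ψ f g x)) (interchange _ _ _ _)
      ; ⟪⟫-* = λ a f x → ≈-trans (+-cong (⟪⟫-* φ a f x) (⟪⟫-* ψ a f x)) (≈-sym (distribˡ a _ _)) }
    ; _*_ = λ φ ψ → record
      { ⟪_⟫ = λ f → ⟪ φ ⟫ (⟪ ψ ⟫ f)
      ; ⟪⟫-cong = λ e → ⟪⟫-cong φ (⟪⟫-cong ψ e)
      ; ⟪⟫-+ = λ f g x → ≈-trans (⟪⟫-cong φ (⟪⟫-+ ψ f g) x) (⟪⟫-+ φ _ _ x)
      ; ⟪⟫-* = λ a f x → ≈-trans (⟪⟫-cong φ (⟪⟫-* ψ a f) x) (⟪⟫-* φ a _ x) }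
    ; -_ = λ φ → record
      { ⟪_⟫ = λ f x → - ⟪ φ ⟫ f x
      ; ⟪⟫-cong = λ e x → -‿cong (⟪⟫-cong φ e x)
      ; ⟪⟫-+ = λ f g x → ≈-trans (-‿cong (⟪⟫-+ φ f g x)) (≈-sym (-‿+-comm _ _))
      ; ⟪⟫-* = λ a f x → ≈-trans (-‿cong (⟪⟫-* φ a f x)) (-‿distribʳ-* a _) }
    ; 0# = record
      { ⟪_⟫ = λ _ _ → 0#
      ; ⟪⟫-cong = λ _ _ → ≈-refl
      ; ⟪⟫-+ = λ _ _ _ → ≈-sym (+-identityˡ 0#)
      ; ⟪⟫-* = λ a _ _ → ≈-sym (zeroʳ a) }
    ; 1# = record
      { ⟪_⟫ = λ f → f ; ⟪⟫-cong = λ e → e ; ⟪⟫-+ = λ _ _ _ → ≈-refl ; ⟪⟫-* = λ _ _ _ → ≈-refl }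
    ; isRing = record
      { +-isAbelianGroup = record
        { isGroup = record
          { isMonoid = record
            { isSemigroup = record
              { isMagma = record
                { isEquivalence = record
                  { refl = λ _ _ → ≈-refl
                  ; sym = λ e f x → ≈-sym (e f x)
                  ; trans = λ e e′ f x → ≈-trans (e f x) (e′ f x) }
                ; ∙-cong = λ e e′ f x → +-cong (e f x) (e′ f x) }
              ; assoc = λ _ _ _ _ _ → +-assoc _ _ _ }
            ; identity = (λ _ _ _ → +-identityˡ _) , (λ _ _ _ → +-identityʳ _) }
          ; inverse = (λ _ _ _ → -‿inverseˡ _) , (λ _ _ _ → -‿inverseʳ _)
          ; ⁻¹-cong = λ e f x → -‿cong (e f x) }
        ; comm = λ _ _ _ _ → +-comm _ _ }
      ; *-cong = λ {_} {φ′} {ψ} e e′ f x → ≈-trans (e (⟪ ψ ⟫ f) x) (⟪⟫-cong φ′ (e′ f) x)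
      ; *-assoc = λ _ _ _ _ _ → ≈-refl
      ; *-identity = (λ _ _ _ → ≈-refl) , (λ _ _ _ → ≈-refl)
      ; distrib = (λ φ _ _ _ → ⟪⟫-+ φ _ _) , (λ _ _ _ _ _ → ≈-refl) } }

  scalarEnd : Carrier → End
  scalarEnd a = record
    { ⟪_⟫     = λ f x → a * f x
    ; ⟪⟫-cong = λ e x → *-congˡ (e x)
    ; ⟪⟫-+    = λ f g x → distribˡ a (f x) (g x)
    ; ⟪⟫-*    = λ b f x → x∙yz≈y∙xz a b (f x) }

-- Evaluation of a presented ring in another ring

module Evaluation {G : Set} (_~_ : Expr G → Expr G → Set) {c ℓ} (R : Ring c ℓ) (φ : G → Ring.Carrier R) where
  open Ring R renaming (refl to ≈ᴿ-refl; sym to ≈ᴿ-sym; trans to ≈ᴿ-trans; distribˡ to distrˡ; distribʳ to distrʳ)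
    hiding (_≈_)
  open Ring R using () renaming (_≈_ to _≈ᴿ_)
  open Presentation _~_

  eval : Expr G → Carrier
  eval (gen g) = φ g
  eval 0ᴱ      = 0#
  eval 1ᴱ      = 1#
  eval (a ⊕ b) = eval a + eval b
  eval (a ⊛ b) = eval a * eval b
  eval (⊖ a)   = - eval a

  eval-cong : (∀ {a b} → a ~ b → eval a ≈ᴿ eval b) → ∀ {a b} → a ≈ b → eval a ≈ᴿ eval b
  eval-cong h (rel r)         = h r
  eval-cong h ≈-refl          = ≈ᴿ-refl
  eval-cong h (≈-sym p)       = ≈ᴿ-sym (eval-cong h p)
  eval-cong h (≈-trans p q)   = ≈ᴿ-trans (eval-cong h p) (eval-cong h q)
  eval-cong h (⊕-cong p q)    = +-cong (eval-cong h p) (eval-cong h q)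
  eval-cong h (⊛-cong p q)    = *-cong (eval-cong h p) (eval-cong h q)
  eval-cong h (⊖-cong p)      = -‿cong (eval-cong h p)
  eval-cong h (⊕-assoc a b c) = +-assoc (eval a) (eval b) (eval c)
  eval-cong h (⊕-comm a b)    = +-comm (eval a) (eval b)
  eval-cong h (⊕-zero a)      = +-identityˡ (eval a)
  eval-cong h (⊕-neg a)       = -‿inverseˡ (eval a)
  eval-cong h (⊛-assoc a b c) = *-assoc (eval a) (eval b) (eval c)
  eval-cong h (⊛-oneˡ a)      = *-identityˡ (eval a)
  eval-cong h (⊛-oneʳ a)      = *-identityʳ (eval a)
  eval-cong h (distribˡ a b c) = distrˡ (eval a) (eval b) (eval c)
  eval-cong h (distribʳ a b c) = distrʳ (eval a) (eval b) (eval c)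

-- Jucys-Murphy elements in a monoid

module JucysMurphy {c ℓ} (M : Monoid c ℓ) where
  open Monoid M renaming (refl to ≈-refl; sym to ≈-sym; trans to ≈-trans)
  open Braid M
  open import Relation.Binary.Reasoning.Setoid setoid

  Commute : Carrier → Carrier → Set ℓ
  Commute a b = a ∙ b ≈ b ∙ a

  Central : Carrier → Set (c ⊔ ℓ)
  Central d = ∀ a → Commute d a

  commute-∙ : ∀ {a b b′} → Commute a b → Commute a b′ → Commute a (b ∙ b′)
  commute-∙ {a} {b} {b′} p q = begin
    a ∙ (b ∙ b′)  ≈⟨ assoc a b b′ ⟨
    a ∙ b ∙ b′    ≈⟨ ∙-congʳ p ⟩
    b ∙ a ∙ b′    ≈⟨ assoc b a b′ ⟩
    b ∙ (a ∙ b′)  ≈⟨ ∙-congˡ q ⟩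
    b ∙ (b′ ∙ a)  ≈⟨ assoc b b′ a ⟨
    b ∙ b′ ∙ a    ∎

  -- Solving T_i X_i T_i = t X_{i+1} for X_{i+1} gives the step x ↦ d τ x τ with d = t⁻¹. The
  -- recursion replaces the starting element and shifts τ, so a statement about all these elements
  -- follows once its hypotheses pass to the shifted data.
  jm : ∀ {m} → Carrier → (Fin m → Carrier) → Carrier → Fin (suc m) → Carrier
  jm         d τ x zero    = x
  jm {suc m} d τ x (suc k) = jm d (τ ∘ suc) (d ∙ (τ zero ∙ (x ∙ τ zero))) k

  commute-jm : ∀ {m a d x} (τ : Fin m → Carrier) → Central d → Commute a x → (∀ i → Commute a (τ i)) →
               ∀ k → Commute a (jm d τ x k)
  commute-jm         τ dᶜ ax aτ zero    = ax
  commute-jm {suc m} {a} {d} τ dᶜ ax aτ (suc k) = commute-jm (τ ∘ suc) dᶜ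
    (commute-∙ (≈-sym (dᶜ a)) (commute-∙ (aτ zero) (commute-∙ ax (aτ zero)))) (aτ ∘ suc) k

  -- Up to the central factor, τ x τ reads the same in both directions, so its inverse is built in
  -- the same way from d⁻, τ⁻ and y. This is why X⁻¹ can be sent to the elements built from t and
  -- the T_i⁻¹.
  jm-inverse : ∀ {m d d⁻ x y} {τ τ⁻ : Fin m → Carrier} → Central d⁻ → d ∙ d⁻ ≈ ε → x ∙ y ≈ ε →
               (∀ i → τ i ∙ τ⁻ i ≈ ε) → ∀ k → jm d τ x k ∙ jm d⁻ τ⁻ y k ≈ ε
  jm-inverse dᶜ dd xy ττ zero = xy
  jm-inverse {suc m} {d} {d⁻} {x} {y} {τ} {τ⁻} dᶜ dd xy ττ (suc k) =
    jm-inverse dᶜ dd eq (ττ ∘ suc) k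
    where
    a = τ zero
    b = τ⁻ zero
    cancel : ∀ {p q} r → p ∙ q ≈ ε → p ∙ (q ∙ r) ≈ r
    cancel r e = ≈-trans (≈-sym (assoc _ _ _)) (≈-trans (∙-congʳ e) (identityˡ r))
    eq : (d ∙ (a ∙ (x ∙ a))) ∙ (d⁻ ∙ (b ∙ (y ∙ b))) ≈ ε
    eq = begin
      (d ∙ (a ∙ (x ∙ a))) ∙ (d⁻ ∙ (b ∙ (y ∙ b)))  ≈⟨ assoc _ _ _ ⟩
      d ∙ ((a ∙ (x ∙ a)) ∙ (d⁻ ∙ (b ∙ (y ∙ b))))  ≈⟨ ∙-congˡ (assoc _ _ _) ⟨
      d ∙ ((a ∙ (x ∙ a)) ∙ d⁻ ∙ (b ∙ (y ∙ b)))    ≈⟨ ∙-congˡ (∙-congʳ (dᶜ _)) ⟨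
      d ∙ (d⁻ ∙ (a ∙ (x ∙ a)) ∙ (b ∙ (y ∙ b)))    ≈⟨ ∙-congˡ (assoc _ _ _) ⟩
      d ∙ (d⁻ ∙ ((a ∙ (x ∙ a)) ∙ (b ∙ (y ∙ b))))  ≈⟨ cancel _ dd ⟩
      (a ∙ (x ∙ a)) ∙ (b ∙ (y ∙ b))               ≈⟨ assoc _ _ _ ⟩
      a ∙ ((x ∙ a) ∙ (b ∙ (y ∙ b)))               ≈⟨ ∙-congˡ (assoc _ _ _) ⟩
      a ∙ (x ∙ (a ∙ (b ∙ (y ∙ b))))               ≈⟨ ∙-congˡ (∙-congˡ (cancel _ (ττ zero))) ⟩
      a ∙ (x ∙ (y ∙ b))                           ≈⟨ ∙-congˡ (cancel _ xy) ⟩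
      a ∙ b                                       ≈⟨ ττ zero ⟩
      ε                                           ∎

  module _ {d : Carrier} (dᶜ : Central d) where

    jm-step : ∀ {m d⁻ x} (τ : Fin m → Carrier) → d⁻ ∙ d ≈ ε → ∀ i →
              τ i ∙ (jm d τ x (inject₁ i) ∙ τ i) ≈ d⁻ ∙ jm d τ x (suc i)
    jm-step {d⁻ = d⁻} τ dd zero = ≈-sym (≈-trans (≈-sym (assoc d⁻ d _)) (≈-trans (∙-congʳ dd) (identityˡ _)))
    jm-step τ dd (suc i) = jm-step (τ ∘ suc) dd i

    -- The defining relations of the Artin group of type B, with x as the extra generator.
    record IsReflecting {m} (τ : Fin m → Carrier) (x : Carrier) : Set (c ⊔ ℓ) where
      field
        braided : IsBraided τ
        far     : ∀ i → toℕ i ≢ 0 → Commute x (τ i)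
        reflect : ∀ i → toℕ i ≡ 0 → Commute x (τ i ∙ (x ∙ τ i))
    open IsReflecting
    open IsBraided

    private
      flat : ∀ a x z → (a ∙ (x ∙ a)) ∙ z ≈ a ∙ (x ∙ (a ∙ z))
      flat a x z = ≈-trans (assoc a (x ∙ a) z) (∙-congˡ (assoc x a z))

      tail₂ : ∀ {p q r s} → p ∙ q ≈ r ∙ s → ∀ z → p ∙ (q ∙ z) ≈ r ∙ (s ∙ z)
      tail₂ e z = ≈-trans (≈-sym (assoc _ _ z)) (≈-trans (∙-congʳ e) (assoc _ _ z))

      tail₃ : ∀ {p q p′ r s r′} → p ∙ (q ∙ p′) ≈ r ∙ (s ∙ r′) → ∀ z → p ∙ (q ∙ (p′ ∙ z)) ≈ r ∙ (s ∙ (r′ ∙ z))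
      tail₃ e z = ≈-trans (∙-congˡ (≈-sym (assoc _ _ z))) (≈-trans (tail₂ e z) (∙-congˡ (assoc _ _ z)))

      pull-out : ∀ b y → b ∙ ((d ∙ y) ∙ b) ≈ d ∙ (b ∙ (y ∙ b))
      pull-out b y = ≈-trans (∙-congˡ (assoc d y b)) (tail₂ (≈-sym (dᶜ b)) _)

    -- With y = a x a:  y b y b = a x (b a b) x a b = a b x a x (a b a) = a b (a x a x) b a
    --                          = (b a b) x a x b a = b a x (b a b) x a = b y b y.
    reflect-next : ∀ {a b x} → a ∙ (b ∙ a) ≈ b ∙ (a ∙ b) → Commute x b → Commute x (a ∙ (x ∙ a)) →
                   Commute (a ∙ (x ∙ a)) (b ∙ ((a ∙ (x ∙ a)) ∙ b))
    reflect-next {a} {b} {x} aba xb xaxa = begin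
      y ∙ (b ∙ (y ∙ b))                                ≈⟨ flat a x _ ⟩
      a ∙ (x ∙ (a ∙ (b ∙ (y ∙ b))))                    ≈⟨ ∙-congˡ (∙-congˡ (∙-congˡ (∙-congˡ (flat a x b)))) ⟩
      a ∙ (x ∙ (a ∙ (b ∙ (a ∙ (x ∙ (a ∙ b))))))        ≈⟨ ∙-congˡ (∙-congˡ (tail₃ aba _)) ⟩
      a ∙ (x ∙ (b ∙ (a ∙ (b ∙ (x ∙ (a ∙ b))))))        ≈⟨ ∙-congˡ (tail₂ xb _) ⟩
      a ∙ (b ∙ (x ∙ (a ∙ (b ∙ (x ∙ (a ∙ b))))))        ≈⟨ ∙-congˡ (∙-congˡ (∙-congˡ (∙-congˡ (tail₂ xb _)))) ⟨
      a ∙ (b ∙ (x ∙ (a ∙ (x ∙ (b ∙ (a ∙ b))))))        ≈⟨ ∙-congˡ (∙-congˡ (∙-congˡ (∙-congˡ (∙-congˡ aba)))) ⟨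
      a ∙ (b ∙ (x ∙ (a ∙ (x ∙ (a ∙ (b ∙ a))))))        ≈⟨ ∙-congˡ (∙-congˡ (∙-congˡ (flat a x _))) ⟨
      a ∙ (b ∙ (x ∙ (y ∙ (b ∙ a))))                    ≈⟨ ∙-congˡ (∙-congˡ (tail₂ xaxa _)) ⟩
      a ∙ (b ∙ (y ∙ (x ∙ (b ∙ a))))                    ≈⟨ ∙-congˡ (∙-congˡ (flat a x _)) ⟩
      a ∙ (b ∙ (a ∙ (x ∙ (a ∙ (x ∙ (b ∙ a))))))        ≈⟨ tail₃ aba _ ⟩
      b ∙ (a ∙ (b ∙ (x ∙ (a ∙ (x ∙ (b ∙ a))))))        ≈⟨ ∙-congˡ (∙-congˡ (tail₂ xb _)) ⟨
      b ∙ (a ∙ (x ∙ (b ∙ (a ∙ (x ∙ (b ∙ a))))))        ≈⟨ ∙-congˡ (∙-congˡ (∙-congˡ (∙-congˡ (∙-congˡ (tail₂ xb _))))) ⟩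
      b ∙ (a ∙ (x ∙ (b ∙ (a ∙ (b ∙ (x ∙ a))))))        ≈⟨ ∙-congˡ (∙-congˡ (∙-congˡ (tail₃ aba _))) ⟨
      b ∙ (a ∙ (x ∙ (a ∙ (b ∙ (a ∙ (x ∙ a))))))        ≈⟨ ∙-congˡ (flat a x _) ⟨
      b ∙ (y ∙ (b ∙ y))                                ≈⟨ ∙-congˡ (assoc y b y) ⟨
      b ∙ ((y ∙ b) ∙ y)                                ≈⟨ assoc b (y ∙ b) y ⟨
      (b ∙ (y ∙ b)) ∙ y                                ∎
      where
      y = a ∙ (x ∙ a)

    -- The induction step for both commutation lemmas below: the type B relations survive one step
    -- of `jm`. `reflect-next` speaks of τ x τ without the factor d, which is central and is pulled
    -- out of the products.
    next-reflects : ∀ {m} {τ : Fin (suc m) → Carrier} {x} → IsReflecting τ x →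
                    IsReflecting (τ ∘ suc) (d ∙ (τ zero ∙ (x ∙ τ zero)))
    next-reflects {τ = τ} {x} R = record
      { braided = shift (braided R)
      ; far = λ { zero 0≢0 → contradiction refl 0≢0
                ; (suc i) _ → ≈-sym (commute-∙ (≈-sym (dᶜ _)) (commute-∙ (≈-sym (far-0 (braided R) i))
                    (commute-∙ (≈-sym (far R (suc (suc i)) λ ())) (≈-sym (far-0 (braided R) i))))) }
      ; reflect = λ { zero _ →
          let y   = τ zero ∙ (x ∙ τ zero)
              b   = τ (suc zero)
              yby = reflect-next (braid (braided R) zero (suc zero) refl)
                      (far R (suc zero) λ ()) (reflect R zero refl)
          in ≈-trans (∙-congˡ (pull-out b y)) (≈-trans
               (≈-sym (commute-∙ (≈-sym (dᶜ _)) (≈-sym (commute-∙ (≈-sym (dᶜ y)) yby))))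
               (∙-congʳ (≈-sym (pull-out b y)))) } }

    -- The starting element commutes with its successor by `reflect` and with all later generators
    -- by `far`, hence with everything built from them; other pairs reduce to this one by shifting.
    jm-comm : ∀ {m} {τ : Fin m → Carrier} {x} → IsReflecting τ x →
              ∀ i j → Commute (jm d τ x i) (jm d τ x j)
    jm-comm R zero zero = ≈-refl
    jm-comm {suc m} R zero (suc j) =
      commute-jm _ dᶜ (commute-∙ (≈-sym (dᶜ _)) (reflect R zero refl)) (λ i → far R (suc i) λ ()) j
    jm-comm {suc m} R (suc i) zero =
      ≈-sym (commute-jm _ dᶜ (commute-∙ (≈-sym (dᶜ _)) (reflect R zero refl)) (λ i → far R (suc i) λ ()) i)
    jm-comm {suc m} R (suc i) (suc j) = jm-comm (next-reflects R) i j

    -- Shifting leaves two cases: j = 0 < i, where `far` applies, and i = 0 with j ≥ 2, where τ_0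
    -- commutes with the element of index 2 by the braid relation and with the generators entering
    -- later by distance.
    τ-jm-comm : ∀ {m} {τ : Fin m → Carrier} {x} → IsReflecting τ x →
                ∀ i j → j ≢ inject₁ i → j ≢ suc i → Commute (τ i) (jm d τ x j)
    τ-jm-comm R zero zero p q = contradiction refl p
    τ-jm-comm R zero (suc zero) p q = contradiction refl q
    τ-jm-comm {suc (suc m)} {τ} {x} R zero (suc (suc j)) p q =
      commute-jm (λ i → τ (suc (suc i))) dᶜ (τ₀-x″) (far-0 (braided R)) j
      where
      a = τ zero
      b = τ (suc zero)
      x′ = d ∙ (a ∙ (x ∙ a))
      aba = braid (braided R) zero (suc zero) refl
      xb = far R (suc zero) λ ()
      -- The first braid move turns the leading a into b, which passes x; a second braid move turns
      -- it back into an a at the right end.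
      abaxab : Commute a (b ∙ ((a ∙ (x ∙ a)) ∙ b))
      abaxab = begin
        a ∙ (b ∙ ((a ∙ (x ∙ a)) ∙ b))      ≈⟨ ∙-congˡ (∙-congˡ (flat a x b)) ⟩
        a ∙ (b ∙ (a ∙ (x ∙ (a ∙ b))))      ≈⟨ tail₃ aba _ ⟩
        b ∙ (a ∙ (b ∙ (x ∙ (a ∙ b))))      ≈⟨ ∙-congˡ (∙-congˡ (tail₂ xb _)) ⟨
        b ∙ (a ∙ (x ∙ (b ∙ (a ∙ b))))      ≈⟨ ∙-congˡ (∙-congˡ (∙-congˡ aba)) ⟨
        b ∙ (a ∙ (x ∙ (a ∙ (b ∙ a))))      ≈⟨ ∙-congˡ (flat a x _) ⟨
        b ∙ ((a ∙ (x ∙ a)) ∙ (b ∙ a))      ≈⟨ ∙-congˡ (assoc _ b a) ⟨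
        b ∙ (((a ∙ (x ∙ a)) ∙ b) ∙ a)      ≈⟨ assoc b _ a ⟨
        (b ∙ ((a ∙ (x ∙ a)) ∙ b)) ∙ a      ∎
      τ₀-x″ : Commute a (d ∙ (b ∙ (x′ ∙ b)))
      τ₀-x″ = commute-∙ (≈-sym (dᶜ a)) (≈-trans (∙-congˡ (pull-out b _)) (≈-trans
        (commute-∙ (≈-sym (dᶜ a)) abaxab) (∙-congʳ (≈-sym (pull-out b _)))))
    τ-jm-comm R (suc i) zero p q = ≈-sym (far R (suc i) λ ())
    τ-jm-comm {suc m} R (suc i) (suc j) p q =
      τ-jm-comm (next-reflects R) i j (λ e → p (cong suc e)) (λ e → q (cong suc e))

-- The finite Hecke algebra acting on functions of words

module Regular {c ℓ} (A : CommutativeRing c ℓ) (q : CommutativeRing.Carrier A) where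
  open CommutativeRing A hiding (zero) renaming (refl to ≈-refl; sym to ≈-sym; trans to ≈-trans)
  open Solver commutativeSemiring using (solve; _:=_; _:+_; _:*_; con; Polynomial)

  Fun : ℕ → Set c
  Fun k = Vec ℕ k → Carrier

  infix 4 _≐_
  _≐_ : ∀ {k} → Fun k → Fun k → Set ℓ
  f ≐ g = ∀ v → f v ≈ g v

  -- Let x = w⁻¹(i) and y = w⁻¹(i+1). If y < x, then s_i w is shorter than w, and T_w occurs in T_i
  -- T_{s_i w} with coefficient 1 and in T_i T_w with q. Otherwise it occurs only in T_i T_{s_i w},
  -- with q + 1 = t. Equal letters, which no permutation has, get the eigenvalue q + 1, so that the
  -- relations hold on all words.
  swapCoeff stayCoeff : ℕ → ℕ → Carrier
  swapCoeff   x y = if y ℕ.<ᵇ x then 1# else q + 1#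
  stayCoeff x y = if y ℕ.<ᵇ x then q else 0#

  -- T_i on the regular representation, in coordinates, for a word read at the positions i , i+1.
  op : ∀ {k} → Fin k → Fun (suc k) → Fun (suc k)
  op zero    f (x ∷ y ∷ v) = swapCoeff x y * f (y ∷ x ∷ v) + stayCoeff x y * f (x ∷ y ∷ v)
  op (suc i) f (x ∷ v)     = op i (λ v → f (x ∷ v)) v

  op-cong : ∀ {k} (i : Fin k) {f g} → f ≐ g → op i f ≐ op i g
  op-cong zero    e (x ∷ y ∷ v) = +-cong (*-congˡ (e _)) (*-congˡ (e _))
  op-cong (suc i) e (x ∷ v)     = op-cong i (λ v → e (x ∷ v)) v

  -- A combination of two terms is exactly what `op zero` produces, so `op-far` is this identity
  -- read in one direction or the other.
  op-linear : ∀ {k} (i : Fin k) a b f g v → op i (λ v → a * f v + b * g v) v ≈ a * op i f v + b * op i g v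
  op-linear zero    a b f g (x ∷ y ∷ v) = solve 8
    (λ a b w r f g f′ g′ → w :* (a :* f :+ b :* g) :+ r :* (a :* f′ :+ b :* g′) :=
                           a :* (w :* f :+ r :* f′) :+ b :* (w :* g :+ r :* g′)) ≈-refl
    a b (swapCoeff x y) (stayCoeff x y) (f (y ∷ x ∷ v)) (g (y ∷ x ∷ v)) (f (x ∷ y ∷ v)) (g (x ∷ y ∷ v))
  op-linear (suc i) a b f g (x ∷ v) = op-linear i a b (λ v → f (x ∷ v)) (λ v → g (x ∷ v)) v

  private
    <-true : ∀ {x y} → x ℕ.< y → (x ℕ.<ᵇ y) ≡ true
    <-true {x} {y} lt = dec-true (x ℕₚ.<? y) lt

    ≮-false : ∀ {x y} → ¬ x ℕ.< y → (x ℕ.<ᵇ y) ≡ false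
    ≮-false {x} {y} nlt = dec-false (x ℕₚ.<? y) nlt

  op-quadratic : ∀ {k} (i : Fin k) f v → op i (op i f) v ≈ q * op i f v + (q + 1#) * f v
  op-quadratic zero f (x ∷ y ∷ v) with ℕₚ.<-cmp x y
  ... | tri< p _ ¬p rewrite <-true p | ≮-false ¬p = solve 3
    (λ q f f′ → (q :+ con 1) :* (con 1 :* f :+ q :* f′) :+ con 0 :* ((q :+ con 1) :* f′ :+ con 0 :* f)
        := q :* ((q :+ con 1) :* f′ :+ con 0 :* f) :+ (q :+ con 1) :* f) ≈-refl q (f (x ∷ y ∷ v)) (f (y ∷ x ∷ v))
  ... | tri≈ ¬p refl _ rewrite ≮-false ¬p = solve 2
    (λ q f → (q :+ con 1) :* ((q :+ con 1) :* f :+ con 0 :* f) :+ con 0 :* ((q :+ con 1) :* f :+ con 0 :* f)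
        := q :* ((q :+ con 1) :* f :+ con 0 :* f) :+ (q :+ con 1) :* f) ≈-refl q (f (x ∷ x ∷ v))
  ... | tri> ¬p _ p rewrite <-true p | ≮-false ¬p = solve 3
    (λ q f f′ → con 1 :* ((q :+ con 1) :* f :+ con 0 :* f′) :+ q :* (con 1 :* f′ :+ q :* f)
        := q :* (con 1 :* f′ :+ q :* f) :+ (q :+ con 1) :* f) ≈-refl q (f (x ∷ y ∷ v)) (f (y ∷ x ∷ v))
  op-quadratic (suc i) f (x ∷ v) = op-quadratic i (λ v → f (x ∷ v)) v

  op-far : ∀ {k} (i j : Fin k) → 1 ℕ.< ℕ.∣ toℕ i - toℕ j ∣ → ∀ f v → op i (op j f) v ≈ op j (op i f) v
  op-far zero zero () f v
  op-far zero (suc zero) (ℕ.s≤s ()) f v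
  op-far zero (suc (suc j)) _ f (x ∷ y ∷ v) =
    ≈-sym (op-linear j (swapCoeff x y) (stayCoeff x y) (λ v → f (y ∷ x ∷ v)) (λ v → f (x ∷ y ∷ v)) v)
  op-far (suc zero) zero (ℕ.s≤s ()) f v
  op-far (suc (suc i)) zero _ f (x ∷ y ∷ v) =
    op-linear i (swapCoeff x y) (stayCoeff x y) (λ v → f (y ∷ x ∷ v)) (λ v → f (x ∷ y ∷ v)) v
  op-far (suc i) (suc j) d f (x ∷ v) = op-far i j d (λ v → f (x ∷ v)) v

  private
    -- The two sides of the braid relation at a word x y z; the weights of a pair are its (swapCoeff , stayCoeff).
    Pair : ℕ → Set
    Pair k = Polynomial k × Polynomial k

    swap : ∀ {k} → Pair k → Polynomial k → Polynomial k → Polynomial k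
    swap (w , r) f f′ = w :* f :+ r :* f′

    braidˡ braidʳ : ∀ {k} (xy yx yz zy xz : Pair k) (fxyz fyxz fxzy fyzx fzxy fzyx : Polynomial k) → Polynomial k
    braidˡ xy yx yz zy xz fxyz fyxz fxzy fyzx fzxy fzyx =
      swap xy (swap xz (swap yz fzyx fyzx) (swap yx fxyz fyxz))
              (swap yz (swap xz fzxy fxzy) (swap xy fyxz fxyz))
    braidʳ xy yx yz zy xz fxyz fyxz fxzy fyzx fzxy fzyx =
      swap yz (swap xz (swap xy fzyx fzxy) (swap zy fxyz fxzy))
              (swap xy (swap xz fyzx fyxz) (swap yz fxzy fxyz))

    -- The weights of a weakly increasing and of a strictly decreasing pair; a tie counts as `up`.
    up down : ∀ {k} → Polynomial k → Pair k
    up   q = q :+ con 1 , con 0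
    down q = con 1 , q

    -- The weights depend only on the relative order of the three letters. Of the 27 combinations of
    -- comparisons 13 are consistent, each giving an identity in q and the values of f at the
    -- rearrangements of x y z; ties make some of these values coincide.
    braid₃ : ∀ {k} x y z (f : Fun (suc (suc (suc k)))) v →
             op zero (op (suc zero) (op zero f)) (x ∷ y ∷ z ∷ v) ≈
             op (suc zero) (op zero (op (suc zero) f)) (x ∷ y ∷ z ∷ v)
    braid₃ x y z f v with ℕₚ.<-cmp x y | ℕₚ.<-cmp y z | ℕₚ.<-cmp x z
    ... | tri< a _ a′ | tri< b _ b′ | tri< c _ c′
      rewrite <-true a | ≮-false a′ | <-true b | ≮-false b′ | ≮-false c′ = solve 7
      (λ q fxyz fyxz fxzy fyzx fzxy fzyx → let u = up q ; d = down q in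
        braidˡ u d u d u fxyz fyxz fxzy fyzx fzxy fzyx :=
        braidʳ u d u d u fxyz fyxz fxzy fyzx fzxy fzyx) ≈-refl
      q (f (x ∷ y ∷ z ∷ v)) (f (y ∷ x ∷ z ∷ v)) (f (x ∷ z ∷ y ∷ v)) (f (y ∷ z ∷ x ∷ v))
        (f (z ∷ x ∷ y ∷ v)) (f (z ∷ y ∷ x ∷ v))
    ... | tri< a _ a′ | tri≈ b refl _ | tri< _ _ _
      rewrite <-true a | ≮-false a′ | ≮-false b = solve 4
      (λ q fxyy fyxy fyyx → let u = up q ; d = down q in
        braidˡ u d u u u fxyy fyxy fxyy fyyx fyxy fyyx :=
        braidʳ u d u u u fxyy fyxy fxyy fyyx fyxy fyyx) ≈-refl
      q (f (x ∷ y ∷ y ∷ v)) (f (y ∷ x ∷ y ∷ v)) (f (y ∷ y ∷ x ∷ v))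
    ... | tri< a _ a′ | tri> b′ _ b | tri< c _ c′
      rewrite <-true a | ≮-false a′ | <-true b | ≮-false b′ | ≮-false c′ = solve 7
      (λ q fxyz fyxz fxzy fyzx fzxy fzyx → let u = up q ; d = down q in
        braidˡ u d d u u fxyz fyxz fxzy fyzx fzxy fzyx :=
        braidʳ u d d u u fxyz fyxz fxzy fyzx fzxy fzyx) ≈-refl
      q (f (x ∷ y ∷ z ∷ v)) (f (y ∷ x ∷ z ∷ v)) (f (x ∷ z ∷ y ∷ v)) (f (y ∷ z ∷ x ∷ v))
        (f (z ∷ x ∷ y ∷ v)) (f (z ∷ y ∷ x ∷ v))
    ... | tri< a _ a′ | tri> _ _ _ | tri≈ c refl _
      rewrite <-true a | ≮-false a′ | ≮-false c = solve 4
      (λ q fxyx fyxx fxxy → let u = up q ; d = down q in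
        braidˡ u d d u u fxyx fyxx fxxy fyxx fxxy fxyx :=
        braidʳ u d d u u fxyx fyxx fxxy fyxx fxxy fxyx) ≈-refl
      q (f (x ∷ y ∷ x ∷ v)) (f (y ∷ x ∷ x ∷ v)) (f (x ∷ x ∷ y ∷ v))
    ... | tri< a _ a′ | tri> b′ _ b | tri> c′ _ c
      rewrite <-true a | ≮-false a′ | <-true b | ≮-false b′ | <-true c = solve 7
      (λ q fxyz fyxz fxzy fyzx fzxy fzyx → let u = up q ; d = down q in
        braidˡ u d d u d fxyz fyxz fxzy fyzx fzxy fzyx :=
        braidʳ u d d u d fxyz fyxz fxzy fyzx fzxy fzyx) ≈-refl
      q (f (x ∷ y ∷ z ∷ v)) (f (y ∷ x ∷ z ∷ v)) (f (x ∷ z ∷ y ∷ v)) (f (y ∷ z ∷ x ∷ v))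
        (f (z ∷ x ∷ y ∷ v)) (f (z ∷ y ∷ x ∷ v))
    ... | tri≈ a refl _ | tri< b _ b′ | tri< _ _ _
      rewrite ≮-false a | <-true b | ≮-false b′ = solve 4
      (λ q fxxz fxzx fzxx → let u = up q ; d = down q in
        braidˡ u u u d u fxxz fxxz fxzx fxzx fzxx fzxx :=
        braidʳ u u u d u fxxz fxxz fxzx fxzx fzxx fzxx) ≈-refl
      q (f (x ∷ x ∷ z ∷ v)) (f (x ∷ z ∷ x ∷ v)) (f (z ∷ x ∷ x ∷ v))
    ... | tri≈ a refl _ | tri≈ b refl _ | tri≈ c _ _
      rewrite ≮-false a = solve 2
      (λ q fxxx → let u = up q ; d = down q in
        braidˡ u u u u u fxxx fxxx fxxx fxxx fxxx fxxx :=
        braidʳ u u u u u fxxx fxxx fxxx fxxx fxxx fxxx) ≈-refl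
      q (f (x ∷ x ∷ x ∷ v))
    ... | tri≈ a refl _ | tri> b′ _ b | tri> _ _ _
      rewrite ≮-false a | <-true b | ≮-false b′ = solve 4
      (λ q fxxz fxzx fzxx → let u = up q ; d = down q in
        braidˡ u u d u d fxxz fxxz fxzx fxzx fzxx fzxx :=
        braidʳ u u d u d fxxz fxxz fxzx fxzx fzxx fzxx) ≈-refl
      q (f (x ∷ x ∷ z ∷ v)) (f (x ∷ z ∷ x ∷ v)) (f (z ∷ x ∷ x ∷ v))
    ... | tri> a′ _ a | tri< b _ b′ | tri< c _ c′
      rewrite <-true a | ≮-false a′ | <-true b | ≮-false b′ | ≮-false c′ = solve 7
      (λ q fxyz fyxz fxzy fyzx fzxy fzyx → let u = up q ; d = down q in
        braidˡ d u u d u fxyz fyxz fxzy fyzx fzxy fzyx :=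
        braidʳ d u u d u fxyz fyxz fxzy fyzx fzxy fzyx) ≈-refl
      q (f (x ∷ y ∷ z ∷ v)) (f (y ∷ x ∷ z ∷ v)) (f (x ∷ z ∷ y ∷ v)) (f (y ∷ z ∷ x ∷ v))
        (f (z ∷ x ∷ y ∷ v)) (f (z ∷ y ∷ x ∷ v))
    ... | tri> a′ _ a | tri< _ _ _ | tri≈ c refl _
      rewrite <-true a | ≮-false a′ | ≮-false c = solve 4
      (λ q fxyx fyxx fxxy → let u = up q ; d = down q in
        braidˡ d u u d u fxyx fyxx fxxy fyxx fxxy fxyx :=
        braidʳ d u u d u fxyx fyxx fxxy fyxx fxxy fxyx) ≈-refl
      q (f (x ∷ y ∷ x ∷ v)) (f (y ∷ x ∷ x ∷ v)) (f (x ∷ x ∷ y ∷ v))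
    ... | tri> a′ _ a | tri< b _ b′ | tri> c′ _ c
      rewrite <-true a | ≮-false a′ | <-true b | ≮-false b′ | <-true c = solve 7
      (λ q fxyz fyxz fxzy fyzx fzxy fzyx → let u = up q ; d = down q in
        braidˡ d u u d d fxyz fyxz fxzy fyzx fzxy fzyx :=
        braidʳ d u u d d fxyz fyxz fxzy fyzx fzxy fzyx) ≈-refl
      q (f (x ∷ y ∷ z ∷ v)) (f (y ∷ x ∷ z ∷ v)) (f (x ∷ z ∷ y ∷ v)) (f (y ∷ z ∷ x ∷ v))
        (f (z ∷ x ∷ y ∷ v)) (f (z ∷ y ∷ x ∷ v))
    ... | tri> a′ _ a | tri≈ b refl _ | tri> _ _ _
      rewrite <-true a | ≮-false a′ | ≮-false b = solve 4
      (λ q fxyy fyxy fyyx → let u = up q ; d = down q in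
        braidˡ d u u u d fxyy fyxy fxyy fyyx fyxy fyyx :=
        braidʳ d u u u d fxyy fyxy fxyy fyyx fyxy fyyx) ≈-refl
      q (f (x ∷ y ∷ y ∷ v)) (f (y ∷ x ∷ y ∷ v)) (f (y ∷ y ∷ x ∷ v))
    ... | tri> a′ _ a | tri> b′ _ b | tri> c′ _ c
      rewrite <-true a | ≮-false a′ | <-true b | ≮-false b′ | <-true c = solve 7
      (λ q fxyz fyxz fxzy fyzx fzxy fzyx → let u = up q ; d = down q in
        braidˡ d u d u d fxyz fyxz fxzy fyzx fzxy fzyx :=
        braidʳ d u d u d fxyz fyxz fxzy fyzx fzxy fzyx) ≈-refl
      q (f (x ∷ y ∷ z ∷ v)) (f (y ∷ x ∷ z ∷ v)) (f (x ∷ z ∷ y ∷ v)) (f (y ∷ z ∷ x ∷ v))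
        (f (z ∷ x ∷ y ∷ v)) (f (z ∷ y ∷ x ∷ v))
    ... | tri< a _ _ | tri< b _ _ | tri≈ ¬c _ _ = contradiction (ℕₚ.<-trans a b) ¬c
    ... | tri< a _ _ | tri< b _ _ | tri> ¬c _ _ = contradiction (ℕₚ.<-trans a b) ¬c
    ... | tri< a _ _ | tri≈ _ refl _ | tri≈ ¬c _ _ = contradiction a ¬c
    ... | tri< a _ _ | tri≈ _ refl _ | tri> ¬c _ _ = contradiction a ¬c
    ... | tri≈ _ refl _ | tri< b _ _ | tri≈ ¬c _ _ = contradiction b ¬c
    ... | tri≈ _ refl _ | tri< b _ _ | tri> ¬c _ _ = contradiction b ¬c
    ... | tri≈ _ refl _ | tri≈ _ refl _ | tri< _ ¬c _ = contradiction refl ¬c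
    ... | tri≈ _ refl _ | tri≈ _ refl _ | tri> _ ¬c _ = contradiction refl ¬c
    ... | tri> _ _ a | tri> _ _ b | tri< _ _ ¬c = contradiction (ℕₚ.<-trans b a) ¬c
    ... | tri> _ _ a | tri> _ _ b | tri≈ _ _ ¬c = contradiction (ℕₚ.<-trans b a) ¬c
    ... | tri> _ _ a | tri≈ _ refl _ | tri< _ _ ¬c = contradiction a ¬c
    ... | tri> _ _ a | tri≈ _ refl _ | tri≈ _ _ ¬c = contradiction a ¬c
    ... | tri≈ _ refl _ | tri> _ _ b | tri< _ _ ¬c = contradiction b ¬c
    ... | tri≈ _ refl _ | tri> _ _ b | tri≈ _ _ ¬c = contradiction b ¬c

  op-braid : ∀ {k} (i j : Fin k) → toℕ j ≡ suc (toℕ i) → ∀ f v →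
             op i (op j (op i f)) v ≈ op j (op i (op j f)) v
  op-braid zero    (suc zero) _ f (x ∷ y ∷ z ∷ v) = braid₃ x y z f v
  op-braid (suc i) (suc j)    e f (x ∷ v)         = op-braid i j (ℕₚ.suc-injective e) (λ v → f (x ∷ v)) v

  module _ {k : ℕ} where
    open LinearEndomorphisms A (Vec ℕ (suc k)) public
    private
      module E = Ring endRing
      module J = JucysMurphy E.*-monoid

    Tᴱ : Fin k → End
    Tᴱ i = record
      { ⟪_⟫     = op i
      ; ⟪⟫-cong = op-cong i
      ; ⟪⟫-+    = λ f g v → ≈-trans (op-cong i (λ v → +-cong (≈-sym (*-identityˡ (f v))) (≈-sym (*-identityˡ (g v)))) v)
                    (≈-trans (op-linear i 1# 1# f g v) (+-cong (*-identityˡ _) (*-identityˡ _)))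
      ; ⟪⟫-*    = λ a f v → ≈-trans (op-cong i (λ v → ≈-sym (drop (a * f v) (f v))) v)
                    (≈-trans (op-linear i a 0# f f v) (drop _ _)) }
      where
      drop : ∀ x y → x + 0# * y ≈ x
      drop x y = ≈-trans (+-congˡ (zeroˡ y)) (+-identityʳ x)

    Tᴱ-braided : BraidLemmas.Braid.IsBraided E.*-monoid Tᴱ
    Tᴱ-braided = record { far-comm = op-far ; braid = op-braid }

    module _ {d : Carrier} (d-inverse : d * (q + 1#) ≈ 1#) where

      -- The quadratic relation says T (T - q) = q + 1, and d inverts q + 1.
      Tᴱ⁻¹ : Fin k → End
      Tᴱ⁻¹ i = scalarEnd d E.* (Tᴱ i E.+ scalarEnd (- q))

      Tᴱ-inverseˡ : ∀ i → Tᴱ⁻¹ i E.* Tᴱ i E.≈ E.1#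
      Tᴱ-inverseˡ i f v = begin
        d * (op i (op i f) v + - q * op i f v)
          ≈⟨ *-congˡ (+-congʳ (op-quadratic i f v)) ⟩
        d * ((q * op i f v + (q + 1#) * f v) + - q * op i f v)
          ≈⟨ solve 5 (λ d q q′ a b → d :* ((q :* a :+ (q :+ con 1) :* b) :+ q′ :* a) :=
                       d :* ((q :+ q′) :* a) :+ (d :* (q :+ con 1)) :* b) ≈-refl d q (- q) (op i f v) (f v) ⟩
        d * ((q + - q) * op i f v) + (d * (q + 1#)) * f v
          ≈⟨ +-cong (*-congˡ (*-congʳ (-‿inverseʳ q))) (*-congʳ d-inverse) ⟩
        d * (0# * op i f v) + 1# * f v
          ≈⟨ solve 3 (λ d a b → d :* (con 0 :* a) :+ con 1 :* b := b) ≈-refl d (op i f v) (f v) ⟩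
        f v ∎
        where open import Relation.Binary.Reasoning.Setoid setoid

      Tᴱ-inverseʳ : ∀ i → Tᴱ i E.* Tᴱ⁻¹ i E.≈ E.1#
      Tᴱ-inverseʳ i f v = begin
        op i (λ v → d * (op i f v + - q * f v)) v       ≈⟨ ⟪⟫-* (Tᴱ i) d _ v ⟩
        d * op i (λ v → op i f v + - q * f v) v         ≈⟨ *-congˡ (⟪⟫-+ (Tᴱ i) _ _ v) ⟩
        d * (op i (op i f) v + op i (λ v → - q * f v) v) ≈⟨ *-congˡ (+-congˡ (⟪⟫-* (Tᴱ i) (- q) f v)) ⟩
        d * (op i (op i f) v + - q * op i f v)          ≈⟨ Tᴱ-inverseˡ i f v ⟩
        f v ∎
        where open import Relation.Binary.Reasoning.Setoid setoid

-- Columns and permutations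

infix 4 _≗?_
_≗?_ : ∀ {n} (v w : Permutation′ n) → Dec (v ≗ₚ w)
v ≗? w = Finₚ.all? (λ i → v ⟨$⟩ʳ i Finₚ.≟ w ⟨$⟩ʳ i)

u-top-id : ∀ {n} (C : Subset n) → C ≡ top n ∣ C ∣ → u C ≗ₚ Perm.id
u-top-id {n} C e x = trans (cong (λ D → u D ⟨$⟩ʳ x) e) (u-top n ∣ C ∣ (∣p∣≤n C) x)

module _ {m} (j : Fin m) (C : Subset (suc m)) where

  sᶜ-swaps : ∀ {b b′} → Vec.lookup C (inject₁ j) ≡ b → Vec.lookup C (suc j) ≡ b′ →
             Vec.lookup (sᶜ j C) (inject₁ j) ≡ b′ × Vec.lookup (sᶜ j C) (suc j) ≡ b
  sᶜ-swaps p q = trans (sᶜ-lookup j C (inject₁ j)) (trans (cong (Vec.lookup C) (s-at j)) q)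
               , trans (sᶜ-lookup j C (suc j)) (trans (cong (Vec.lookup C) (s-at⁺ j)) p)

  sᶜ-same : Vec.lookup C (inject₁ j) ≡ Vec.lookup C (suc j) → sᶜ j C ≡ C
  sᶜ-same e = trans (Vecₚ.tabulate-cong (λ i → fix i (s-cases j i))) (Vecₚ.tabulate∘lookup C)
    where
    fix : ∀ i → i ≡ inject₁ j ⊎ i ≡ suc j ⊎ (i ≢ inject₁ j × i ≢ suc j) → Vec.lookup C (s j ⟨$⟩ʳ i) ≡ Vec.lookup C i
    fix i (inj₁ refl)           = trans (cong (Vec.lookup C) (s-at j)) (sym e)
    fix i (inj₂ (inj₁ refl))    = trans (cong (Vec.lookup C) (s-at⁺ j)) e
    fix i (inj₂ (inj₂ (p , q))) = cong (Vec.lookup C) (s-off j p q)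

  u-descend : Vec.lookup C (inject₁ j) ≡ false → Vec.lookup C (suc j) ≡ true → u C ∘ₚ s j ≗ₚ u (sᶜ j C)
  u-descend p q x with p′ , q′ ← sᶜ-swaps p q =
    trans (cong (λ D → s j ⟨$⟩ʳ (u D ⟨$⟩ʳ x)) (sym (sᶜ-invol j C)))
      (trans (cong (s j ⟨$⟩ʳ_) (sym (proj₂ (u-cover j (sᶜ j C) p′ q′) x))) (s-invol j (u (sᶜ j C) ⟨$⟩ʳ x)))

-- Images of initial segments, and induction over columns

image : ∀ {n} → Permutation′ n → ℕ → Subset n
image w l = Vec.tabulate (λ y → toℕ (w ⟨$⟩ˡ y) ℕ.<ᵇ l)

image-lookup : ∀ {n} (w : Permutation′ n) l y → Vec.lookup (image w l) y ≡ (toℕ (w ⟨$⟩ˡ y) ℕ.<ᵇ l)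
image-lookup w l y = Vecₚ.lookup∘tabulate (λ y → toℕ (w ⟨$⟩ˡ y) ℕ.<ᵇ l) y

private
  <ᵇ-true⁻ : ∀ a b → (a ℕ.<ᵇ b) ≡ true → a ℕ.< b
  <ᵇ-true⁻ a b e = ℕₚ.<ᵇ⇒< a b (subst T (sym e) _)

  <ᵇ-false⁻ : ∀ a b → (a ℕ.<ᵇ b) ≡ false → b ℕ.≤ a
  <ᵇ-false⁻ a b e = ℕₚ.≮⇒≥ (λ lt → false≢true (trans (sym e) (dec-true (a ℕₚ.<? b) lt)))
    where
    false≢true : false ≢ true
    false≢true ()

-- Positions below l precede those from l on. So when exactly one of j , j+1 lies in the image of
-- {1,...,l}, that set alone decides whether j is an ascent.
image-asc : ∀ {m} j (w : Permutation′ (suc m)) l → Vec.lookup (image w l) (inject₁ j) ≡ true →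
            Vec.lookup (image w l) (suc j) ≡ false → Asc j w
image-asc j w l p q = ℕₚ.<-≤-trans
  (<ᵇ-true⁻ _ l (trans (sym (image-lookup w l (inject₁ j))) p))
  (<ᵇ-false⁻ _ l (trans (sym (image-lookup w l (suc j))) q))

image-desc : ∀ {m} j (w : Permutation′ (suc m)) l → Vec.lookup (image w l) (inject₁ j) ≡ false →
             Vec.lookup (image w l) (suc j) ≡ true → ¬ Asc j w
image-desc j w l p q = ℕₚ.<-asym (ℕₚ.<-≤-trans
  (<ᵇ-true⁻ _ l (trans (sym (image-lookup w l (suc j))) q))
  (<ᵇ-false⁻ _ l (trans (sym (image-lookup w l (inject₁ j))) p)))

image-s : ∀ {m} j (w : Permutation′ (suc m)) l → image (w ∘ₚ s j) l ≡ sᶜ j (image w l)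
image-s j w l = Vecₚ.tabulate-cong (λ y → trans
  (cong (λ x → toℕ (w ⟨$⟩ˡ x) ℕ.<ᵇ l) (s-inv j y)) (sym (image-lookup w l (s j ⟨$⟩ʳ y))))

image-cong : ∀ {n} {v w : Permutation′ n} l → v ≗ₚ w → image v l ≡ image w l
image-cong {v = v} {w} l e = Vecₚ.tabulate-cong (λ y → cong (λ x → toℕ x ℕ.<ᵇ l) (inv-cong {v = v} {w} e y))

top? : ∀ {n} (C : Subset (suc n)) → C ≡ top (suc n) ∣ C ∣ ⊎
       ∃ λ j → Vec.lookup C (inject₁ j) ≡ false × Vec.lookup C (suc j) ≡ true
top? {zero} (true  ∷ [])        = inj₁ refl
top? {zero} (false ∷ [])        = inj₁ refl
top? {suc n} (true ∷ C) with top? C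
... | inj₁ e           = inj₁ (cong (true ∷_) e)
... | inj₂ (j , p , q) = inj₂ (suc j , p , q)
top? {suc n} (false ∷ true ∷ C)  = inj₂ (zero , refl , refl)
top? {suc n} (false ∷ false ∷ C) with top? (false ∷ C)
... | inj₂ (j , p , q) = inj₂ (suc j , p , q)
-- A highest weight column that lacks its first entry is empty, so the size of C decides.
... | inj₁ e with ∣ C ∣
...   | zero = inj₁ (cong (false ∷_) e)
top? {suc n} (false ∷ false ∷ C) | inj₁ () | suc k

-- A column that is not highest weight has some j+1 without j; exchanging them lowers ℓ(u_C) by one.
-- The induction runs on this length.
column-induction : ∀ {m} (P : Subset (suc m) → Set) → (∀ C → C ≡ top (suc m) ∣ C ∣ → P C) →
                   (∀ j C → Vec.lookup C (inject₁ j) ≡ true → Vec.lookup C (suc j) ≡ false → P C → P (sᶜ j C)) →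
                   ∀ C → P C
column-induction {m} P base step C = go (suc (ℓ (u C))) C ℕₚ.≤-refl
  where
  go : ∀ k C → ℓ (u C) ℕ.< k → P C
  go (suc k) C lt with top? C
  ... | inj₁ e = base C e
  ... | inj₂ (j , p , q) = subst P (sᶜ-invol j C) (step j D p′ q′ (go k D (ℕₚ.≤-pred (subst (ℕ._< suc k) ℓ≡ lt))))
    where
    D = sᶜ j C
    p′ = proj₁ (sᶜ-swaps j C p q)
    q′ = proj₂ (sᶜ-swaps j C p q)
    ℓ≡ : ℓ (u C) ≡ suc (ℓ (u D))
    ℓ≡ = trans (cong (ℓ ∘ u) (sym (sᶜ-invol j C)))
      (trans (cong List.length (word-cong (u (sᶜ j D)) (u D ∘ₚ s j) (λ x → sym (proj₂ (u-cover j D p′ q′) x))))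
        (ℓ-step j (u D) (proj₁ (u-cover j D p′ q′))))

-- Entrywise comparison of columns, by counting the entries below each threshold

below : ∀ {n} → Subset n → ℕ → ℕ
below []      i       = 0
below (b ∷ C) zero    = 0
below (b ∷ C) (suc i) = (if b then 1 else 0) ℕ.+ below C i

below-0 : ∀ {n} (C : Subset n) → below C 0 ≡ 0
below-0 []      = refl
below-0 (b ∷ C) = refl

-- For columns of the same length, F ⊑ D says that F is entrywise at most D.
_⊑_ : ∀ {n} → Subset n → Subset n → Set
F ⊑ D = ∀ i → below D i ℕ.≤ below F i

below-mono : ∀ {n} (F C : Subset n) → (∀ y → Vec.lookup F y ≡ true → Vec.lookup C y ≡ true) →
             ∀ i → below F i ℕ.≤ below C i
below-mono []          []          h i       = ℕ.z≤n
below-mono (b ∷ F)     (c ∷ C)     h zero    = ℕ.z≤n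
below-mono (false ∷ F) (c ∷ C)     h (suc i) =
  ℕₚ.m≤n⇒m≤o+n (if c then 1 else 0) (below-mono F C (h ∘ suc) i)
below-mono (true ∷ F)  (true ∷ C)  h (suc i) = ℕ.s≤s (below-mono F C (h ∘ suc) i)
below-mono (true ∷ F)  (false ∷ C) h (suc i) with () ← h zero refl

module _ where
  private
    bit : Bool → ℕ
    bit b = if b then 1 else 0

    -- Deleting a common first coordinate shifts the two counts by different amounts a and c.
    Dominates : ∀ {n} → ℕ → Subset n → ℕ → Subset n → Set
    Dominates a D c F = ∀ i → a ℕ.+ below D i ℕ.≤ c ℕ.+ below F i

    tail-dominates : ∀ {n a c b b′} {D F : Subset n} → Dominates a (b ∷ D) c (b′ ∷ F) →
                     Dominates (a ℕ.+ bit b) D (c ℕ.+ bit b′) F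
    tail-dominates {a = a} {c} {b} {b′} h i =
      subst₂ ℕ._≤_ (sym (ℕₚ.+-assoc a (bit b) _)) (sym (ℕₚ.+-assoc c (bit b′) _)) (h (suc i))

    cons-dominates : ∀ {n a c b b′} {D F : Subset n} → a ℕ.+ 0 ℕ.≤ c ℕ.+ 0 →
                     Dominates (a ℕ.+ bit b) D (c ℕ.+ bit b′) F → Dominates a (b ∷ D) c (b′ ∷ F)
    cons-dominates h₀ h zero = h₀
    cons-dominates {a = a} {c} {b} {b′} h₀ h (suc i) =
      subst₂ ℕ._≤_ (ℕₚ.+-assoc a (bit b) _) (ℕₚ.+-assoc c (bit b′) _) (h i)

    -- s_j affects only the count at threshold j+1. There the count of s_j D equals that of D at j,
    -- which is bounded by the count at j on the side of F, hence by the one at j+1 whether or not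
    -- s_j is applied to F.
    dominates-s : ∀ {m} (j : Fin m) D F a c → Vec.lookup D (inject₁ j) ≡ true → Vec.lookup D (suc j) ≡ false →
                  Dominates a D c F → Dominates a (sᶜ j D) c (sᶜ j F) × Dominates a (sᶜ j D) c F
    dominates-s zero (true ∷ false ∷ D) (b ∷ b′ ∷ F) a c refl refl h
      rewrite sᶜ-zero true false D | sᶜ-zero b b′ F =
        (λ { zero → h 0
           ; (suc zero) → ℕₚ.≤-trans (h 0) (ℕₚ.+-monoʳ-≤ c ℕ.z≤n)
           ; (suc (suc i)) → subst (λ k → a ℕ.+ suc (below D i) ℕ.≤ c ℕ.+ k) (swap i) (h (suc (suc i))) })
      , (λ { zero → h 0
           ; (suc zero) → ℕₚ.≤-trans (h 0) (ℕₚ.+-monoʳ-≤ c ℕ.z≤n)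
           ; (suc (suc i)) → h (suc (suc i)) })
      where
      swap : ∀ i → bit b ℕ.+ (bit b′ ℕ.+ below F i) ≡ bit b′ ℕ.+ (bit b ℕ.+ below F i)
      swap i = trans (sym (ℕₚ.+-assoc (bit b) (bit b′) _))
        (trans (cong (ℕ._+ below F i) (ℕₚ.+-comm (bit b) (bit b′))) (ℕₚ.+-assoc (bit b′) (bit b) _))
    dominates-s (suc j) (d ∷ D) (b ∷ F) a c p q h
      rewrite sᶜ-suc j d D | sᶜ-suc j b F =
        let l , r = dominates-s j D F (a ℕ.+ bit d) (c ℕ.+ bit b) p q (tail-dominates {a = a} {c} {d} {b} {D} {F} h)
        in cons-dominates {a = a} {c} {d} {b} {sᶜ j D} {sᶜ j F} (h 0) l
         , cons-dominates {a = a} {c} {d} {b} {sᶜ j D} {F} (h 0) r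

  -- T_j T_w involves T_w and T_{s_j w}. This and `⊑-up` keep the columns of both below s_j D when
  -- that of w is below D.
  ⊑-s : ∀ {m} j (D F : Subset (suc m)) → Vec.lookup D (inject₁ j) ≡ true → Vec.lookup D (suc j) ≡ false →
        F ⊑ D → sᶜ j F ⊑ sᶜ j D
  ⊑-s j D F p q h = proj₁ (dominates-s j D F 0 0 p q h)

  ⊑-up : ∀ {m} j (D F : Subset (suc m)) → Vec.lookup D (inject₁ j) ≡ true → Vec.lookup D (suc j) ≡ false →
         F ⊑ D → F ⊑ sᶜ j D
  ⊑-up j D F p q h = proj₂ (dominates-s j D F 0 0 p q h)

image-mono : ∀ {n} (w : Permutation′ n) {k l} → k ℕ.≤ l → ∀ y →
             Vec.lookup (image w k) y ≡ true → Vec.lookup (image w l) y ≡ true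
image-mono w {k} {l} k≤l y e = trans (image-lookup w l y)
  (dec-true (toℕ (w ⟨$⟩ˡ y) ℕₚ.<? l) (ℕₚ.<-≤-trans (ℕₚ.<ᵇ⇒< _ k (subst T (trans (sym e) (image-lookup w k y)) _)) k≤l))

u-fixes : ∀ {n} (C : Subset n) p → (∀ i → toℕ i ℕ.< p → Vec.lookup C i ≡ true) →
          ∀ i → toℕ i ℕ.< p → u C ⟨$⟩ʳ i ≡ i
u-fixes (true  ∷ C) (suc p) h zero    lt = refl
u-fixes (true  ∷ C) (suc p) h (suc i) lt =
  cong suc (u-fixes C p (λ i lt → h (suc i) (ℕ.s≤s lt)) i (ℕₚ.≤-pred lt))
u-fixes (false ∷ C) (suc p) h i       lt with () ← h zero ℕ.z<s

module HeckeTableaux (m : ℕ) where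
  open AffineHecke m
  open HeckeLemmas
  open DecompositionLemmas
  open Ring H using (+-cong; +-congˡ; +-congʳ; *-cong; *-congˡ; *-congʳ; -‿cong; zeroˡ; zeroʳ; reflexive
    ; +-assoc; +-comm; *-assoc; distribˡ; distribʳ; +-identityˡ; +-identityʳ; *-identityˡ; *-identityʳ
    ; -‿inverseˡ; -‿inverseʳ)
    renaming (refl to ≈-refl; sym to ≈-sym; trans to ≈-trans)
  open import Algebra.Properties.Ring H using (-‿distribˡ-*; -1*x≈-x; +-inverseˡ-unique)
  open import Relation.Binary.Reasoning.Setoid (Ring.setoid H)

  -- The representation of the affine Hecke algebra

  scalars : CommutativeRing 0ℓ 0ℓ
  scalars = record
    { Carrier = ∃ Scalar
    ; _≈_ = λ a b → proj₁ a ≈ proj₁ b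
    ; _+_ = λ (a , p) (b , q) → a + b , +∈ p q
    ; _*_ = λ (a , p) (b , q) → a * b , *∈ p q
    ; -_ = λ (a , p) → - a , -∈ p
    ; 0# = 0# , 0∈
    ; 1# = 1# , 1∈
    ; isCommutativeRing = record
      { isRing = record
        { +-isAbelianGroup = record
          { isGroup = record
            { isMonoid = record
              { isSemigroup = record
                { isMagma = record
                  { isEquivalence = record { refl = ≈-refl ; sym = ≈-sym ; trans = ≈-trans }
                  ; ∙-cong = +-cong }
                ; assoc = λ a b c → +-assoc (proj₁ a) (proj₁ b) (proj₁ c) }
              ; identity = (λ a → +-identityˡ (proj₁ a)) , (λ a → +-identityʳ (proj₁ a)) }
            ; inverse = (λ a → -‿inverseˡ (proj₁ a)) , (λ a → -‿inverseʳ (proj₁ a))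
            ; ⁻¹-cong = -‿cong }
          ; comm = λ a b → +-comm (proj₁ a) (proj₁ b) }
        ; *-cong = *-cong
        ; *-assoc = λ a b c → *-assoc (proj₁ a) (proj₁ b) (proj₁ c)
        ; *-identity = (λ a → *-identityˡ (proj₁ a)) , (λ a → *-identityʳ (proj₁ a))
        ; distrib = (λ a b c → distribˡ (proj₁ a) (proj₁ b) (proj₁ c))
                  , (λ a b c → distribʳ (proj₁ a) (proj₁ b) (proj₁ c)) }
      ; *-comm = λ (a , p) (b , _) → central p b } }

  private module A = CommutativeRing scalars

  open Regular scalars (t - 1# , t-1∈)

  private
    module E = Ring (endRing {m})
    module J = JucysMurphy E.*-monoid

  t-1+1 : (t - 1#) + 1# ≈ t
  t-1+1 = ≈-trans (+-assoc t (- 1#) 1#) (≈-trans (+-congˡ (-‿inverseˡ 1#)) (+-identityʳ t))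

  tᴱ t⁻¹ᴱ : End {m}
  tᴱ   = scalarEnd (t , t∈)
  t⁻¹ᴱ = scalarEnd (t⁻¹ , t⁻¹∈)

  t⁻¹-inverse : t⁻¹ * ((t - 1#) + 1#) ≈ 1#
  t⁻¹-inverse = ≈-trans (*-congˡ t-1+1) t⁻¹t

  T⁻¹ᴱ : Fin m → End
  T⁻¹ᴱ = Tᴱ⁻¹ {d = t⁻¹ , t⁻¹∈} t⁻¹-inverse

  ⟦_⟧ᵍ : Gen → End {m}
  ⟦ ‵t ⟧ᵍ     = tᴱ
  ⟦ ‵t⁻¹ ⟧ᵍ   = t⁻¹ᴱ
  ⟦ ‵T i ⟧ᵍ   = Tᴱ i
  ⟦ ‵X i ⟧ᵍ   = J.jm t⁻¹ᴱ Tᴱ E.1# i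
  ⟦ ‵X⁻¹ i ⟧ᵍ = J.jm tᴱ T⁻¹ᴱ E.1# i

  open Evaluation _~_ endRing ⟦_⟧ᵍ

  scalar-central : ∀ a → J.Central (scalarEnd a)
  scalar-central a φ f v = ≈-sym (⟪⟫-* φ a f v)

  tt⁻¹ : tᴱ E.* t⁻¹ᴱ E.≈ E.1#
  tt⁻¹ f v = ≈-trans (≈-sym (*-assoc t t⁻¹ _)) (≈-trans (*-congʳ (≈-trans (central t∈ t⁻¹) t⁻¹t)) (*-identityˡ _))

  t⁻¹tᴱ : t⁻¹ᴱ E.* tᴱ E.≈ E.1#
  t⁻¹tᴱ f v = ≈-trans (≈-sym (*-assoc t⁻¹ t _)) (≈-trans (*-congʳ t⁻¹t) (*-identityˡ _))

  1-reflecting : J.IsReflecting {d = t⁻¹ᴱ} (scalar-central (t⁻¹ , t⁻¹∈)) Tᴱ E.1#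
  1-reflecting = record
    { braided = Tᴱ-braided
    ; far     = λ _ _ _ _ → ≈-refl
    ; reflect = λ _ _ _ _ → ≈-refl }

  eval-rel : ∀ {a b} → a ~ b → eval a E.≈ eval b
  eval-rel (t-central g)   = scalar-central (t , t∈) ⟦ g ⟧ᵍ
  eval-rel (t⁻¹-central g) = scalar-central (t⁻¹ , t⁻¹∈) ⟦ g ⟧ᵍ
  eval-rel t-inverse       = tt⁻¹
  eval-rel (X-inverseʳ i)  = J.jm-inverse {d = t⁻¹ᴱ} {tᴱ} {E.1#} {E.1#} {Tᴱ} {T⁻¹ᴱ}
    (scalar-central (t , t∈)) t⁻¹tᴱ (E.*-identityˡ E.1#)
    (Tᴱ-inverseʳ {d = t⁻¹ , t⁻¹∈} t⁻¹-inverse) i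
  eval-rel (X-inverseˡ i)  = J.jm-inverse {d = tᴱ} {t⁻¹ᴱ} {E.1#} {E.1#} {T⁻¹ᴱ} {Tᴱ}
    (scalar-central (t⁻¹ , t⁻¹∈)) tt⁻¹ (E.*-identityˡ E.1#)
    (Tᴱ-inverseˡ {d = t⁻¹ , t⁻¹∈} t⁻¹-inverse) i
  eval-rel (quadratic i) f v = begin
    proj₁ (op i (op i f) v)                            ≈⟨ op-quadratic i f v ⟩
    (t - 1#) * a + ((t - 1#) + 1#) * b                 ≈⟨ +-cong (distribʳ a t (- 1#)) (*-congʳ t-1+1) ⟩
    (t * a + - 1# * a) + t * b                         ≈⟨ +-congʳ (+-congˡ (-1*x≈-x a)) ⟩
    (t * a - a) + t * b                                ∎
    where
    a = proj₁ (op i f v)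
    b = proj₁ (f v)
  eval-rel (braid i j e)    = op-braid i j e
  eval-rel (far-comm i j d) = op-far i j d
  eval-rel (XX-comm i j)    = J.jm-comm {d = t⁻¹ᴱ} (scalar-central (t⁻¹ , t⁻¹∈)) 1-reflecting i j
  eval-rel (TXT i)          = J.jm-step {d = t⁻¹ᴱ} (scalar-central (t⁻¹ , t⁻¹∈)) {d⁻ = tᴱ} {E.1#} Tᴱ tt⁻¹ i
  eval-rel (TX-comm i j p q) = J.τ-jm-comm {d = t⁻¹ᴱ} (scalar-central (t⁻¹ , t⁻¹∈)) 1-reflecting i j p q

  -- Coefficients in the basis T_w

  -- Removes the recursion of `op`: on a word given as a function of positions, only the letters at
  -- j , j+1 and the swapped word matter.
  op-tabulate : ∀ {k} (j : Fin k) f (g : Fin (suc k) → ℕ) → op j f (Vec.tabulate g) ≡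
    swapCoeff (g (inject₁ j)) (g (suc j)) A.* f (Vec.tabulate (λ x → g (s j ⟨$⟩ʳ x)))
      A.+ stayCoeff (g (inject₁ j)) (g (suc j)) A.* f (Vec.tabulate g)
  op-tabulate zero    f g = refl
  op-tabulate (suc j) f g = trans (op-tabulate j (λ v → f (g zero ∷ v)) (g ∘ suc))
    (cong (λ v → swapCoeff (g (inject₁ (suc j))) (g (suc (suc j))) A.* f (g zero ∷ v)
             A.+ stayCoeff (g (inject₁ (suc j))) (g (suc (suc j))) A.* f (Vec.tabulate g))
      (Vecₚ.tabulate-cong (λ x → cong g (sym (Perm.lift₀-transpose (inject₁ j) (suc j) (suc x))))))

  -- The word of w⁻¹, not of w: multiplying w by s_j on the left then exchanges the letters at two
  -- adjacent positions, which is how `op` acts.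
  oneLine : Permutation′ n → Vec ℕ n
  oneLine w = Vec.tabulate (λ y → toℕ (w ⟨$⟩ˡ y))

  ≡1? : ∀ v → Dec (v ≡ oneLine Perm.id)
  ≡1? v = Vecₚ.≡-dec ℕₚ._≟_ v (oneLine Perm.id)

  δ₁ : Vec ℕ n → A.Carrier
  δ₁ v = if does (≡1? v) then A.1# else A.0#

  oneLine-cong : ∀ {v w} → v ≗ₚ w → oneLine v ≡ oneLine w
  oneLine-cong {v} {w} e = Vecₚ.tabulate-cong (λ y → cong toℕ (inv-cong {v = v} {w} e y))

  eval-scalar : ∀ {c} → Scalar c → ∀ f v → proj₁ (⟪ eval c ⟫ f v) ≈ c * proj₁ (f v)
  eval-scalar (gen∈ ‵t)   f v = ≈-refl
  eval-scalar (gen∈ ‵t⁻¹) f v = ≈-refl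
  eval-scalar 0∈          f v = ≈-sym (zeroˡ _)
  eval-scalar 1∈          f v = ≈-sym (*-identityˡ _)
  eval-scalar (+∈ p q)    f v = ≈-trans (+-cong (eval-scalar p f v) (eval-scalar q f v)) (≈-sym (distribʳ _ _ _))
  eval-scalar (*∈ {a} {b} p q) f v = ≈-trans (eval-scalar p (⟪ eval b ⟫ f) v)
    (≈-trans (*-congˡ (eval-scalar q f v)) (≈-sym (*-assoc _ _ _)))
  eval-scalar (-∈ p)      f v = ≈-trans (-‿cong (eval-scalar p f v)) (-‿distribˡ-* _ _)
  eval-scalar (resp∈ e p) f v =
    ≈-trans (≈-sym (eval-cong eval-rel e f v)) (≈-trans (eval-scalar p f v) (*-congʳ e))

  oneLine-s : ∀ j (w : Permutation′ n) → Vec.tabulate (λ x → toℕ (w ⟨$⟩ˡ (s j ⟨$⟩ʳ x))) ≡ oneLine (w ∘ₚ s j)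
  oneLine-s j w = Vecₚ.tabulate-cong (λ x → cong (λ y → toℕ (w ⟨$⟩ˡ y)) (sym (s-inv j x)))

  [_] : ∀ {P : Set} → Dec P → Carrier
  [ p? ] = if does p? then 1# else 0#

  []-yes : ∀ {P : Set} (p? : Dec P) → P → [ p? ] ≈ 1#
  []-yes p? p = reflexive (cong (if_then 1# else 0#) (dec-true p? p))

  []-no : ∀ {P : Set} (p? : Dec P) → ¬ P → [ p? ] ≈ 0#
  []-no p? ¬p = reflexive (cong (if_then 1# else 0#) (dec-false p? ¬p))

  []-⇔ : ∀ {P Q : Set} (p? : Dec P) (q? : Dec Q) → (P → Q) → (Q → P) → [ p? ] ≈ [ q? ]
  []-⇔ (yes p) q? f g = ≈-sym ([]-yes q? (f p))
  []-⇔ (no ¬p) q? f g = ≈-sym ([]-no q? (¬p ∘ g))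

  T-id : T[ Perm.id ] ≡ 1#
  T-id = cong (prod (Ring.*-monoid H) Tᵢ) word-id

  abstract

    -- h δ₁ lists the coefficients of h in the basis T_w, since T_w δ₁ is the indicator function of w.
    coeffˢ : Carrier → Permutation′ n → ∃ Scalar
    coeffˢ h w = ⟪ eval h ⟫ δ₁ (oneLine w)

    coeff : Carrier → Permutation′ n → Carrier
    coeff h w = proj₁ (coeffˢ h w)

    coeff-resp : ∀ h {v w} → v ≗ₚ w → coeff h v ≡ coeff h w
    coeff-resp h {v} {w} e = cong (λ x → proj₁ (⟪ eval h ⟫ δ₁ x)) (oneLine-cong {v} {w} e)

    coeff-cong : ∀ {a b} w → a ≈ b → coeff a w ≈ coeff b w
    coeff-cong w e = eval-cong eval-rel e δ₁ (oneLine w)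

    coeff-scale : ∀ {c} → Scalar c → ∀ h w → coeff (c * h) w ≈ c * coeff h w
    coeff-scale c∈ h w = eval-scalar c∈ (⟪ eval h ⟫ δ₁) (oneLine w)

    coeff∈ : ∀ h w → Scalar (coeff h w)
    coeff∈ h w = proj₂ (coeffˢ h w)

    coeff-0 : ∀ w → coeff 0# w ≈ 0#
    coeff-0 w = ≈-refl

    coeff-+ : ∀ a b w → coeff (a + b) w ≈ coeff a w + coeff b w
    coeff-+ a b w = ≈-refl

    coeff-T : ∀ j h w → coeff (Tᵢ j * h) w ≈
      proj₁ (swapCoeff (toℕ (w ⟨$⟩ˡ inject₁ j)) (toℕ (w ⟨$⟩ˡ suc j))) * coeff h (w ∘ₚ s j)
        + proj₁ (stayCoeff (toℕ (w ⟨$⟩ˡ inject₁ j)) (toℕ (w ⟨$⟩ˡ suc j))) * coeff h w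
    coeff-T j h w = reflexive (trans (cong proj₁ (op-tabulate j (⟪ eval h ⟫ δ₁) (λ y → toℕ (w ⟨$⟩ˡ y))))
      (cong (λ v → proj₁ (swapCoeff (toℕ (w ⟨$⟩ˡ inject₁ j)) (toℕ (w ⟨$⟩ˡ suc j))) * proj₁ (⟪ eval h ⟫ δ₁ v)
        + proj₁ (stayCoeff (toℕ (w ⟨$⟩ˡ inject₁ j)) (toℕ (w ⟨$⟩ˡ suc j))) * coeff h w) (oneLine-s j w)))

    coeff-1 : ∀ w → coeff 1# w ≈ [ Perm.id ≗? w ]
    coeff-1 w = go (≡1? (oneLine w))
      where
      at : ∀ {x} → oneLine w ≡ oneLine Perm.id → w ⟨$⟩ˡ x ≡ x
      at {x} e = Finₚ.toℕ-injective (trans (sym (Vecₚ.lookup∘tabulate (λ y → toℕ (w ⟨$⟩ˡ y)) x))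
        (trans (cong (λ v → Vec.lookup v x) e) (Vecₚ.lookup∘tabulate toℕ x)))
      go : Dec (oneLine w ≡ oneLine Perm.id) → coeff 1# w ≈ [ Perm.id ≗? w ]
      go (yes e) = ≈-trans
        (reflexive (cong (λ b → proj₁ (if b then A.1# else A.0#)) (dec-true (≡1? (oneLine w)) e)))
        (≈-sym ([]-yes (Perm.id ≗? w) (λ x → trans (sym (inverseʳ w)) (cong (w ⟨$⟩ʳ_) (at e)))))
      go (no ≢) = ≈-trans
        (reflexive (cong (λ b → proj₁ (if b then A.1# else A.0#)) (dec-false (≡1? (oneLine w)) ≢)))
        (≈-sym ([]-no (Perm.id ≗? w) (λ e → ≢ (oneLine-cong {w} {Perm.id} (λ x → sym (e x))))))

  coeff-∑ : ∀ {a} {X : Set a} (xs : List X) f w → coeff (∑ xs f) w ≈ ∑ xs (λ x → coeff (f x) w)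
  coeff-∑ []       f w = coeff-0 w
  coeff-∑ (x ∷ xs) f w = ≈-trans (coeff-+ (f x) (∑ xs f) w) (+-congˡ (coeff-∑ xs f w))

  coeff-asc : ∀ j h w → Asc j w → coeff (Tᵢ j * h) w ≈ t * coeff h (w ∘ₚ s j)
  coeff-asc j h w a = ≈-trans (coeff-T j h w) (≈-trans
    (+-cong (*-congʳ (≈-trans (reflexive (cong (λ b → proj₁ (if b then A.1# else (t - 1# , t-1∈) A.+ A.1#)) ≮)) t-1+1))
            (≈-trans (*-congʳ (reflexive (cong (λ b → proj₁ (if b then (t - 1# , t-1∈) else A.0#)) ≮))) (zeroˡ _)))
    (+-identityʳ _))
    where
    ≮ : (toℕ (w ⟨$⟩ˡ suc j) ℕ.<ᵇ toℕ (w ⟨$⟩ˡ inject₁ j)) ≡ false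
    ≮ = dec-false (toℕ (w ⟨$⟩ˡ suc j) ℕₚ.<? toℕ (w ⟨$⟩ˡ inject₁ j)) (ℕₚ.<⇒≯ a)

  coeff-desc : ∀ j h w → ¬ Asc j w → coeff (Tᵢ j * h) w ≈ coeff h (w ∘ₚ s j) + (t - 1#) * coeff h w
  coeff-desc j h w ¬a = ≈-trans (coeff-T j h w) (+-cong
    (≈-trans (*-congʳ (reflexive (cong (λ b → proj₁ (if b then A.1# else (t - 1# , t-1∈) A.+ A.1#)) lt))) (*-identityˡ _))
    (*-congʳ (reflexive (cong (λ b → proj₁ (if b then (t - 1# , t-1∈) else A.0#)) lt))))
    where
    lt : (toℕ (w ⟨$⟩ˡ suc j) ℕ.<ᵇ toℕ (w ⟨$⟩ˡ inject₁ j)) ≡ true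
    lt = dec-true (toℕ (w ⟨$⟩ˡ suc j) ℕₚ.<? toℕ (w ⟨$⟩ˡ inject₁ j))
      (ℕₚ.≤∧≢⇒< (ℕₚ.≮⇒≥ ¬a) (λ e → inject₁≢suc j (sym (w-inj (Perm.flip w) (Finₚ.toℕ-injective e)))))

  -- Linear independence of the T_w, by induction along ascents of v. If i is an ascent of w, then w
  -- differs from s_i v, which has a descent there; if not, w differs from v. Either way the
  -- unwanted term drops out.
  coeff-T[] : ∀ v w → coeff T[ v ] w ≈ [ v ≗? w ]
  coeff-T[] = perm-ind (λ v → ∀ w → coeff T[ v ] w ≈ [ v ≗? w ])
    (λ {v} {v′} e h w → ≈-trans (coeff-cong w (T-cong v′ v (λ x → sym (e x)))) (≈-trans (h w)
      ([]-⇔ (v ≗? w) (v′ ≗? w) (λ p x → trans (sym (e x)) (p x)) (λ p x → trans (e x) (p x)))))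
    (λ w → ≈-trans (reflexive (cong (λ h → coeff h w) T-id)) (coeff-1 w))
    step
    where
    step : ∀ i v → Asc i v → (∀ w → coeff T[ v ] w ≈ [ v ≗? w ]) → ∀ w → coeff T[ v ∘ₚ s i ] w ≈ [ (v ∘ₚ s i) ≗? w ]
    step i v a h w = ≈-trans (coeff-cong w (≈-sym (B.ascend Tᵢ braided i v a))) (cases (asc? i w))
      where
      there : v ≗ₚ w ∘ₚ s i → v ∘ₚ s i ≗ₚ w
      there p x = trans (cong (s i ⟨$⟩ʳ_) (p x)) (s-invol i _)
      back : v ∘ₚ s i ≗ₚ w → v ≗ₚ w ∘ₚ s i
      back p x = trans (sym (s-invol i _)) (cong (s i ⟨$⟩ʳ_) (p x))
      cases : Dec (Asc i w) → coeff (Tᵢ i * T[ v ]) w ≈ [ (v ∘ₚ s i) ≗? w ]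
      cases (yes b) = begin
        coeff (Tᵢ i * T[ v ]) w      ≈⟨ coeff-asc i T[ v ] w b ⟩
        t * coeff T[ v ] (w ∘ₚ s i)  ≈⟨ *-congˡ (≈-trans (h (w ∘ₚ s i)) ([]-no (v ≗? (w ∘ₚ s i)) (≢ ∘ there))) ⟩
        t * 0#                       ≈⟨ zeroʳ t ⟩
        0#                           ≈⟨ []-no ((v ∘ₚ s i) ≗? w) ≢ ⟨
        [ (v ∘ₚ s i) ≗? w ]          ∎
        where
        ≢ : ¬ (v ∘ₚ s i ≗ₚ w)
        ≢ p = ℕₚ.<-asym a (subst₂ Fin._<_ (eq (inject₁ i) (suc i) (s-at i)) (eq (suc i) (inject₁ i) (s-at⁺ i)) b)
          where
          eq : ∀ x y → s i ⟨$⟩ʳ x ≡ y → w ⟨$⟩ˡ x ≡ v ⟨$⟩ˡ y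
          eq x y e = trans (sym (inv-cong {v = v ∘ₚ s i} {w} p x)) (cong (v ⟨$⟩ˡ_) (trans (s-inv i x) e))
      cases (no ¬b) = begin
        coeff (Tᵢ i * T[ v ]) w
          ≈⟨ coeff-desc i T[ v ] w ¬b ⟩
        coeff T[ v ] (w ∘ₚ s i) + (t - 1#) * coeff T[ v ] w
          ≈⟨ +-cong (≈-trans (h (w ∘ₚ s i)) ([]-⇔ (v ≗? (w ∘ₚ s i)) ((v ∘ₚ s i) ≗? w) there back))
                    (≈-trans (*-congˡ (≈-trans (h w) ([]-no (v ≗? w) ≢))) (zeroʳ _)) ⟩
        [ (v ∘ₚ s i) ≗? w ] + 0#
          ≈⟨ +-identityʳ _ ⟩
        [ (v ∘ₚ s i) ≗? w ] ∎
        where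
        ≢ : ¬ (v ≗ₚ w)
        ≢ p = ¬b (subst₂ Fin._<_ (inv-cong {v = v} {w} p (inject₁ i)) (inv-cong {v = v} {w} p (suc i)) a)

  -- Sums over permutations and combinations of the T_w

  ∑-++ : ∀ {a} {X : Set a} (xs ys : List X) f → ∑ (xs ++ ys) f ≈ ∑ xs f + ∑ ys f
  ∑-++ []       ys f = ≈-sym (+-identityˡ _)
  ∑-++ (x ∷ xs) ys f = ≈-trans (+-congˡ (∑-++ xs ys f)) (≈-sym (+-assoc _ _ _))

  ∑-map : ∀ {a b} {X : Set a} {Y : Set b} (g : X → Y) (xs : List X) f → ∑ (map g xs) f ≡ ∑ xs (f ∘ g)
  ∑-map g []       f = refl
  ∑-map g (x ∷ xs) f = cong (f (g x) +_) (∑-map g xs f)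

  ∑-product : ∀ {a b c} {X : Set a} {Y : Set b} {Z : Set c} (g : X → Y → Z) xs ys f →
              ∑ (List.cartesianProductWith g xs ys) f ≈ ∑[ x ∈ xs ] ∑[ y ∈ ys ] f (g x y)
  ∑-product g []       ys f = ≈-refl
  ∑-product g (x ∷ xs) ys f = ≈-trans (∑-++ (map (g x) ys) _ f)
    (+-cong (reflexive (∑-map (g x) ys f)) (∑-product g xs ys f))

  ∑-filter : ∀ {a} {X : Set a} {P : X → Set} (P? : ∀ x → Dec (P x)) xs f →
             ∑ (filter P? xs) f ≈ ∑ xs (λ x → if does (P? x) then f x else 0#)
  ∑-filter P? []       f = ≈-refl
  ∑-filter P? (x ∷ xs) f with does (P? x)
  ... | true  = +-congˡ (∑-filter P? xs f)
  ... | false = ≈-trans (∑-filter P? xs f) (≈-sym (+-identityˡ _))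

  -- Permutations are compared pointwise, so `∑-δ` does not apply to them directly. As `perms`
  -- enumerates by the value at `zero`, the sum collapses first to the value w(0) and then, by
  -- induction, to `remove zero w`.
  ∑-perms : ∀ {k} (F : Permutation′ k → Carrier) w → (∀ v → v ≗ₚ w → F v ≈ F w) →
            (∀ v → ¬ v ≗ₚ w → F v ≈ 0#) → ∑ (perms k) F ≈ F w
  ∑-perms {zero}  F w resp off = ≈-trans (+-identityʳ _) (resp Perm.id λ ())
  ∑-perms {suc k} F w resp off = begin
    ∑ (perms (suc k)) F
      ≈⟨ ∑-product (insert zero) (List.allFin (suc k)) (perms k) F ⟩
    (∑[ x ∈ List.allFin (suc k) ] ∑[ v ∈ perms k ] F (insert zero x v))
      ≈⟨ ∑-δ (λ x → ∑[ v ∈ perms k ] F (insert zero x v)) (w ⟨$⟩ʳ zero)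
           (Uniqueₚ.allFin⁺ (suc k)) (∈ˡₚ.∈-allFin (w ⟨$⟩ʳ zero))
           (λ x x≢ → ∑-0 (perms k) (All.universal (λ v → off (insert zero x v) (λ e → x≢ (e zero))) (perms k))) ⟩
    (∑[ v ∈ perms k ] F (insert zero (w ⟨$⟩ʳ zero) v))
      ≈⟨ ∑-perms (λ v → F (insert zero (w ⟨$⟩ʳ zero) v)) (remove zero w)
           (λ v e → ≈-trans (resp _ (glue v e)) (≈-sym (resp _ (glue (remove zero w) (λ _ → refl)))))
           (λ v ≢ → off _ (λ e → ≢ (λ x → sym (rem-unique w (v ⟨$⟩ʳ_)
              (λ j → trans (sym (Perm.insert-punchIn zero (w ⟨$⟩ʳ zero) v j)) (e (suc j))) x)))) ⟩
    F (insert zero (w ⟨$⟩ʳ zero) (remove zero w))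
      ≈⟨ resp _ (glue (remove zero w) (λ _ → refl)) ⟩
    F w ∎
    where
    glue : ∀ v → v ≗ₚ remove zero w → insert zero (w ⟨$⟩ʳ zero) v ≗ₚ w
    glue v e zero    = refl
    glue v e (suc x) = trans (Perm.insert-punchIn zero (w ⟨$⟩ʳ zero) v x)
      (trans (cong (Fin.punchIn (w ⟨$⟩ʳ zero)) (e x)) (sym (Perm.punchIn-permute w zero x)))

  module _ {P : Permutation′ n → Set} (P? : ∀ v → Dec (P v)) (P-resp : ∀ {v w} → v ≗ₚ w → P v → P w)
           (c : Permutation′ n → Carrier) (c∈ : ∀ v → Scalar (c v)) (c-resp : ∀ {v w} → v ≗ₚ w → c v ≈ c w) where

    private
      f : Permutation′ n → Carrier
      f v = c v * T[ v ]

      term : Permutation′ n → Permutation′ n → Carrier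
      term w v = if does (P? v) then coeff (f v) w else 0#

      term-yes : ∀ w v → P v → term w v ≈ coeff (f v) w
      term-yes w v p = reflexive (cong (if_then coeff (f v) w else 0#) (dec-true (P? v) p))

      term-no : ∀ w v → ¬ P v → term w v ≈ 0#
      term-no w v ¬p = reflexive (cong (if_then coeff (f v) w else 0#) (dec-false (P? v) ¬p))

      coeff-f : ∀ v w → coeff (f v) w ≈ c v * [ v ≗? w ]
      coeff-f v w = ≈-trans (coeff-scale (c∈ v) T[ v ] w) (*-congˡ (coeff-T[] v w))

      coeff-sum : ∀ w → coeff (∑ (filter P? (perms n)) f) w ≈ term w w
      coeff-sum w = begin
        coeff (∑ (filter P? (perms n)) f) w            ≈⟨ coeff-∑ (filter P? (perms n)) f w ⟩
        ∑ (filter P? (perms n)) (λ v → coeff (f v) w)  ≈⟨ ∑-filter P? (perms n) (λ v → coeff (f v) w) ⟩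
        ∑ (perms n) (term w)                           ≈⟨ ∑-perms (term w) w resp off ⟩
        term w w                                       ∎
        where
        off : ∀ v → ¬ v ≗ₚ w → term w v ≈ 0#
        off v ≢ = go (P? v)
          where
          go : Dec (P v) → term w v ≈ 0#
          go (yes p) = ≈-trans (term-yes w v p) (≈-trans (coeff-f v w) (≈-trans (*-congˡ ([]-no (v ≗? w) ≢)) (zeroʳ _)))
          go (no ¬p) = term-no w v ¬p
        resp : ∀ v → v ≗ₚ w → term w v ≈ term w w
        resp v e = go (P? v)
          where
          go : Dec (P v) → term w v ≈ term w w
          go (yes p) = ≈-trans (term-yes w v p) (≈-trans (coeff-cong w (*-cong (c-resp e) (T-cong v w e)))
            (≈-sym (term-yes w w (P-resp e p))))
          go (no ¬p) = ≈-trans (term-no w v ¬p) (≈-sym (term-no w w (λ q → ¬p (P-resp (λ x → sym (e x)) q))))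

    coeff-combination : ∀ w → P w → coeff (∑[ v ∈ filter P? (perms n) ] c v * T[ v ]) w ≈ c w
    coeff-combination w p = ≈-trans (coeff-sum w) (≈-trans (term-yes w w p)
      (≈-trans (coeff-f w w) (≈-trans (*-congˡ ([]-yes (w ≗? w) (λ _ → refl))) (*-identityʳ _))))

    coeff-combination-0 : ∀ w → ¬ P w → coeff (∑[ v ∈ filter P? (perms n) ] c v * T[ v ]) w ≈ 0#
    coeff-combination-0 w ¬p = ≈-trans (coeff-sum w) (term-no w w ¬p)

  stabilises-resp : ∀ {λ′ v w} → v ≗ₚ w → Stabilises v λ′ → Stabilises w λ′
  stabilises-resp {λ′} {v} {w} e st i = trans (cong λ′ (sym (inv-cong {v = v} {w} e i))) (st i)

  coeff-𝟏 : ∀ λ′ w → coeff (𝟏 λ′) w ≈ [ stabilises? λ′ w ]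
  coeff-𝟏 λ′ w = ≈-trans (coeff-cong w (∑-cong (filter (stabilises? λ′) (perms n)) (λ v → ≈-sym (*-identityˡ T[ v ]))))
    (go (stabilises? λ′ w))
    where
    resp : ∀ {v w} → v ≗ₚ w → Stabilises v λ′ → Stabilises w λ′
    resp {v} {w} = stabilises-resp {λ′} {v} {w}
    go : Dec (Stabilises w λ′) → coeff (∑[ v ∈ filter (stabilises? λ′) (perms n) ] 1# * T[ v ]) w ≈ [ stabilises? λ′ w ]
    go (yes p) = ≈-trans (coeff-combination (stabilises? λ′) (λ {v} {w} → resp {v} {w}) (λ _ → 1#) (λ _ → 1∈) (λ _ → ≈-refl) w p)
                   (≈-sym ([]-yes (stabilises? λ′ w) p))
    go (no ¬p) = ≈-trans (coeff-combination-0 (stabilises? λ′) (λ {v} {w} → resp {v} {w}) (λ _ → 1#) (λ _ → 1∈) (λ _ → ≈-refl) w ¬p)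
                   (≈-sym ([]-no (stabilises? λ′ w) ¬p))

  coeff-parabolic : ∀ {λ′ a} → Parabolic λ′ a → ∀ w → ¬ Stabilises w λ′ → coeff a w ≈ 0#
  coeff-parabolic {λ′} (basis v st) w ¬st = ≈-trans (coeff-T[] v w)
    ([]-no (v ≗? w) (λ e → ¬st (stabilises-resp {λ′} {v} {w} e st)))
  coeff-parabolic 0∈          w ¬st = coeff-0 w
  coeff-parabolic (+∈ {a} {b} p q) w ¬st = ≈-trans (coeff-+ a b w)
    (≈-trans (+-cong (coeff-parabolic p w ¬st) (coeff-parabolic q w ¬st)) (+-identityˡ 0#))
  coeff-parabolic (scale {a = a} c∈ p) w ¬st =
    ≈-trans (coeff-scale c∈ a w) (≈-trans (*-congˡ (coeff-parabolic p w ¬st)) (zeroʳ _))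
  coeff-parabolic (resp∈ e p) w ¬st = ≈-trans (coeff-cong w (≈-sym e)) (coeff-parabolic p w ¬st)

  -- Every permutation stabilises the zero weight, so this is the span of all the T_w.
  Span : Carrier → Set
  Span = Parabolic (λ _ → 0)

  Span-* : ∀ {a b} → Hₙ a → Span b → Span (a * b)
  Span-* (gen∈ (scalar s)) q = scale (gen∈ s) q
  Span-* (gen∈ (‵T i))     q = Parabolic-T i refl q
  Span-* {b = b} 0∈        q = resp∈ (≈-sym (zeroˡ b)) 0∈
  Span-* {b = b} 1∈        q = resp∈ (≈-sym (*-identityˡ b)) q
  Span-* {b = b} (+∈ {x} {y} p p′) q = resp∈ (≈-sym (distribʳ b x y)) (+∈ (Span-* p q) (Span-* p′ q))
  Span-* {b = b} (*∈ {x} {y} p p′) q = resp∈ (≈-sym (*-assoc x y b)) (Span-* p (Span-* p′ q))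
  Span-* {b = b} (-∈ {x} p) q =
    resp∈ (≈-trans (-1*x≈-x (x * b)) (-‿distribˡ-* x b)) (scale -1∈ (Span-* p q))
  Span-* (resp∈ e p)       q = resp∈ (*-congʳ e) (Span-* p q)

  Hₙ⇒Span : ∀ {a} → Hₙ a → Span a
  Hₙ⇒Span {a} a∈ = resp∈ (≈-trans (*-congˡ (reflexive T-id)) (*-identityʳ a)) (Span-* a∈ (basis Perm.id (λ _ → refl)))

  expand : ∀ {a} → Span a → a ≈ ∑[ w ∈ perms n ] coeff a w * T[ w ]
  expand (basis v _) = ≈-sym (≈-trans
    (∑-perms (λ w → coeff T[ v ] w * T[ w ]) v
      (λ w e → *-cong (reflexive (coeff-resp T[ v ] {w} {v} e)) (T-cong w v e))
      (λ w ≢ → ≈-trans (*-congʳ (≈-trans (coeff-T[] v w) ([]-no (v ≗? w) (λ e → ≢ (λ x → sym (e x)))))) (zeroˡ _)))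
    (≈-trans (*-congʳ (≈-trans (coeff-T[] v v) ([]-yes (v ≗? v) (λ _ → refl)))) (*-identityˡ _)))
  expand 0∈ = ≈-sym (∑-0 (perms n) (All.universal (λ w → ≈-trans (*-congʳ (coeff-0 w)) (zeroˡ T[ w ])) (perms n)))
  expand (+∈ {a} {b} p q) = ≈-trans (+-cong (expand p) (expand q)) (≈-trans (≈-sym (∑-+ (perms n) _ _))
    (∑-cong (perms n) (λ w → ≈-sym (≈-trans (*-congʳ (coeff-+ a b w)) (distribʳ T[ w ] (coeff a w) (coeff b w))))))
  expand (scale {c} {a} c∈ p) = ≈-trans (*-congˡ (expand p)) (≈-trans (∑-* c (perms n) _)
    (∑-cong (perms n) (λ w → ≈-trans (≈-sym (*-assoc c (coeff a w) T[ w ])) (*-congʳ (≈-sym (coeff-scale c∈ a w))))))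
  expand (resp∈ e p) = ≈-trans (≈-sym e) (≈-trans (expand p) (∑-cong (perms n) (λ w → *-congʳ (coeff-cong w e))))

  -- `expand` recovers an element of H_n from its coefficients, so identities in H_n may be checked
  -- one permutation at a time.
  coeff-injective : ∀ {a b} → Hₙ a → Hₙ b → (∀ w → coeff a w ≈ coeff b w) → a ≈ b
  coeff-injective a∈ b∈ h = ≈-trans (expand (Hₙ⇒Span a∈))
    (≈-trans (∑-cong (perms n) (λ w → *-congʳ (h w))) (≈-sym (expand (Hₙ⇒Span b∈))))

  -- The right H_{n,ϖ_l}-module structure of H_n

  ϖ-stab : ∀ {l v} → Stabilises v (ϖ l) → ∀ i → (toℕ (v ⟨$⟩ˡ i) ℕ.<ᵇ l) ≡ (toℕ i ℕ.<ᵇ l)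
  ϖ-stab st i = bit _ _ (st i)
    where
    bit : ∀ b b′ → (if b then 1 else 0) ≡ (if b′ then 1 else 0) → b ≡ b′
    bit true  true  _ = refl
    bit false false _ = refl

  image-u : ∀ C v → Stabilises v (ϖ ∣ C ∣) → image (v ∘ₚ u C) ∣ C ∣ ≡ C
  image-u C v st = trans (Vecₚ.tabulate-cong λ y →
    trans (ϖ-stab {∣ C ∣} {v} st (u C ⟨$⟩ˡ y)) (trans (sym (u-bit C (u C ⟨$⟩ˡ y))) (cong (Vec.lookup C) (inverseʳ (u C)))))
    (Vecₚ.tabulate∘lookup C)

  -- u_C has minimal length in its coset. By `image-u` the column of u_C v is again C, so every
  -- ascent used in building up u_C is also an ascent for u_C v.
  T-u-* : ∀ C v → Stabilises v (ϖ ∣ C ∣) → T[ u C ] * T[ v ] ≈ T[ v ∘ₚ u C ]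
  T-u-* = column-induction (λ C → ∀ v → Stabilises v (ϖ ∣ C ∣) → T[ u C ] * T[ v ] ≈ T[ v ∘ₚ u C ])
    (λ C e v st → ≈-trans (*-congʳ (≈-trans (T-cong (u C) Perm.id (u-top-id C e)) (reflexive T-id)))
      (≈-trans (*-identityˡ T[ v ]) (T-cong v (v ∘ₚ u C) (λ x → sym (u-top-id C e (v ⟨$⟩ʳ x))))))
    λ j C p q h v st →
      let st′ = subst (λ l → Stabilises v (ϖ l)) (sᶜ-size j C) st
          img = image-u C v st′
          asc = image-asc j (v ∘ₚ u C) ∣ C ∣ (trans (cong (λ D → Vec.lookup D (inject₁ j)) img) p)
                                              (trans (cong (λ D → Vec.lookup D (suc j)) img) q)
      in begin
      T[ u (sᶜ j C) ] * T[ v ]      ≈⟨ *-congʳ (T-cong (u C ∘ₚ s j) (u (sᶜ j C)) (proj₂ (u-cover j C p q))) ⟨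
      T[ u C ∘ₚ s j ] * T[ v ]      ≈⟨ *-congʳ (B.ascend Tᵢ braided j (u C) (proj₁ (u-cover j C p q))) ⟨
      (Tᵢ j * T[ u C ]) * T[ v ]    ≈⟨ *-assoc (Tᵢ j) T[ u C ] T[ v ] ⟩
      Tᵢ j * (T[ u C ] * T[ v ])    ≈⟨ *-congˡ (h v st′) ⟩
      Tᵢ j * T[ v ∘ₚ u C ]          ≈⟨ B.ascend Tᵢ braided j (v ∘ₚ u C) asc ⟩
      T[ (v ∘ₚ u C) ∘ₚ s j ]        ≈⟨ T-cong ((v ∘ₚ u C) ∘ₚ s j) (v ∘ₚ u (sᶜ j C)) (λ x → proj₂ (u-cover j C p q) (v ⟨$⟩ʳ x)) ⟩
      T[ v ∘ₚ u (sᶜ j C) ]          ∎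

  coeff-T-u : ∀ C {g} → Parabolic (ϖ ∣ C ∣) g → ∀ v → coeff (T[ u C ] * g) (v ∘ₚ u C) ≈ coeff g v
  coeff-T-u C (basis x st) v = ≈-trans (coeff-cong (v ∘ₚ u C) (T-u-* C x st))
    (≈-trans (coeff-T[] (x ∘ₚ u C) (v ∘ₚ u C)) (≈-trans
      ([]-⇔ ((x ∘ₚ u C) ≗? (v ∘ₚ u C)) (x ≗? v) (λ e i → w-inj (u C) (e i)) (λ e i → cong (u C ⟨$⟩ʳ_) (e i)))
      (≈-sym (coeff-T[] x v))))
  coeff-T-u C 0∈ v = ≈-trans (coeff-cong (v ∘ₚ u C) (zeroʳ T[ u C ])) (≈-trans (coeff-0 (v ∘ₚ u C)) (≈-sym (coeff-0 v)))
  coeff-T-u C (+∈ {a} {b} p q) v = ≈-trans (coeff-cong (v ∘ₚ u C) (distribˡ T[ u C ] a b))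
    (≈-trans (coeff-+ (T[ u C ] * a) (T[ u C ] * b) (v ∘ₚ u C))
      (≈-trans (+-cong (coeff-T-u C p v) (coeff-T-u C q v)) (≈-sym (coeff-+ a b v))))
  coeff-T-u C (scale {c} {a} c∈ p) v = ≈-trans (coeff-cong (v ∘ₚ u C) (pull c∈ T[ u C ] a))
    (≈-trans (coeff-scale c∈ (T[ u C ] * a) (v ∘ₚ u C))
      (≈-trans (*-congˡ (coeff-T-u C p v)) (≈-sym (coeff-scale c∈ a v))))
  coeff-T-u C (resp∈ e p) v = ≈-trans (coeff-cong (v ∘ₚ u C) (*-congˡ (≈-sym e)))
    (≈-trans (coeff-T-u C p v) (coeff-cong v e))

  -- Writing w = u_E v, the column of w is E as soon as v stabilises ϖ_l; otherwise v lies outside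
  -- the support of g.
  coeff-T-u-0 : ∀ E {g} → Parabolic (ϖ ∣ E ∣) g → ∀ w → image w ∣ E ∣ ≢ E → coeff (T[ u E ] * g) w ≈ 0#
  coeff-T-u-0 E {g} g∈ w ≢ = begin
    coeff (T[ u E ] * g) w           ≡⟨ coeff-resp (T[ u E ] * g) {w} {v ∘ₚ u E} w≗ ⟩
    coeff (T[ u E ] * g) (v ∘ₚ u E)  ≈⟨ coeff-T-u E g∈ v ⟩
    coeff g v                        ≈⟨ coeff-parabolic g∈ v (λ st → ≢ (trans (image-cong {v = w} {v ∘ₚ u E} ∣ E ∣ w≗)
                                                                       (image-u E v st))) ⟩
    0#                               ∎
    where
    v = w ∘ₚ Perm.flip (u E)
    w≗ : w ≗ₚ v ∘ₚ u E
    w≗ x = sym (inverseʳ (u E))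

  -- The coefficient of T_{u_C} in the right H_{n,ϖ_l}-module H_n, for C of length l.
  project : ℕ → Column → Carrier → Carrier
  project l C x = ∑[ v ∈ filter (stabilises? (ϖ l)) (perms n) ] coeff x (v ∘ₚ u C) * T[ v ]

  coeff-project : ∀ l C x w → Stabilises w (ϖ l) → coeff (project l C x) w ≈ coeff x (w ∘ₚ u C)
  coeff-project l C x = coeff-combination (stabilises? (ϖ l)) (λ {v} {w} → stabilises-resp {ϖ l} {v} {w})
    (λ v → coeff x (v ∘ₚ u C)) (λ v → coeff∈ x (v ∘ₚ u C))
    (λ {v} {w} e → reflexive (coeff-resp x {v ∘ₚ u C} {w ∘ₚ u C} (λ i → cong (u C ⟨$⟩ʳ_) (e i))))

  coeff-project-0 : ∀ l C x w → ¬ Stabilises w (ϖ l) → coeff (project l C x) w ≈ 0#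
  coeff-project-0 l C x = coeff-combination-0 (stabilises? (ϖ l)) (λ {v} {w} → stabilises-resp {ϖ l} {v} {w})
    (λ v → coeff x (v ∘ₚ u C)) (λ v → coeff∈ x (v ∘ₚ u C))
    (λ {v} {w} e → reflexive (coeff-resp x {v ∘ₚ u C} {w ∘ₚ u C} (λ i → cong (u C ⟨$⟩ʳ_) (e i))))

  project∈ : ∀ l C x → Hₙ (project l C x)
  project∈ l C x = ∑-∈ (filter (stabilises? (ϖ l)) (perms n)) _
    (λ v → *∈ (weaken (coeff∈ x (v ∘ₚ u C))) (T∈ v))

  -- `ψ` uses the particular decomposition found by `decompose`; this replaces it by an expression
  -- in coefficients, visibly linear in h. The column w{1,...,l} sorts permutations into disjoint
  -- cosets, and only the summand for C reaches the coset of u_C.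
  part≈project : ∀ C {h} (d : Decomposition ∣ C ∣ h) → part d C ≈ project ∣ C ∣ C h
  part≈project C {h} d = coeff-injective (Parabolic⇒Hₙ (part∈ d C refl)) (project∈ ∣ C ∣ C h)
    (λ w → go w (stabilises? (ϖ ∣ C ∣) w))
    where
    l = ∣ C ∣
    term : Permutation′ n → Column → Carrier
    term w E = if does (∣ E ∣ ℕₚ.≟ l) then coeff (T[ u E ] * part d E) w else 0#
    term-yes : ∀ w E → ∣ E ∣ ≡ l → term w E ≈ coeff (T[ u E ] * part d E) w
    term-yes w E e = reflexive (cong (if_then coeff (T[ u E ] * part d E) w else 0#) (dec-true (∣ E ∣ ℕₚ.≟ l) e))
    coeff-h : ∀ w → coeff h w ≈ ∑ (subsets n) (term w)
    coeff-h w = ≈-trans (coeff-cong w (expansion d)) (≈-trans (coeff-∑ (columns n l) (λ E → T[ u E ] * part d E) w)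
      (∑-filter (λ E → ∣ E ∣ ℕₚ.≟ l) (subsets n) (λ E → coeff (T[ u E ] * part d E) w)))
    off : ∀ w → image w l ≡ C → ∀ E → E ≢ C → term w E ≈ 0#
    off w img E E≢C = at (∣ E ∣ ℕₚ.≟ l)
      where
      at : Dec (∣ E ∣ ≡ l) → term w E ≈ 0#
      at (no ≢)  = reflexive (cong (if_then coeff (T[ u E ] * part d E) w else 0#) (dec-false (∣ E ∣ ℕₚ.≟ l) ≢))
      at (yes e) = ≈-trans (term-yes w E e)
        (coeff-T-u-0 E (subst (λ k → Parabolic (ϖ k) (part d E)) (sym e) (part∈ d E e)) w
          (λ img′ → E≢C (trans (sym img′) (trans (cong (image w) e) img))))
    go : ∀ w → Dec (Stabilises w (ϖ l)) → coeff (part d C) w ≈ coeff (project l C h) w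
    go w (no ¬st) = ≈-trans (coeff-parabolic (part∈ d C refl) w ¬st) (≈-sym (coeff-project-0 l C h w ¬st))
    go w (yes st) = ≈-sym (begin
      coeff (project l C h) w                     ≈⟨ coeff-project l C h w st ⟩
      coeff h (w ∘ₚ u C)                          ≈⟨ coeff-h (w ∘ₚ u C) ⟩
      ∑ (subsets n) (term (w ∘ₚ u C))             ≈⟨ ∑-δ (term (w ∘ₚ u C)) C (subsets-unique n) (subsets-complete C)
                                                       (off (w ∘ₚ u C) (image-u C w st)) ⟩
      term (w ∘ₚ u C) C                           ≈⟨ term-yes (w ∘ₚ u C) C refl ⟩
      coeff (T[ u C ] * part d C) (w ∘ₚ u C)      ≈⟨ coeff-T-u C (part∈ d C refl) w ⟩
      coeff (part d C) w                          ∎)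

  -- How the parts change under multiplication by T_j

  t^∈ : ∀ k → Scalar (t ^ k)
  t^∈ zero    = 1∈
  t^∈ (suc k) = *∈ t∈ (t^∈ k)

  ∑-filter-cong : ∀ {a} {X : Set a} {P : X → Set} (P? : ∀ x → Dec (P x)) xs {f g : X → Carrier} →
                  (∀ x → P x → f x ≈ g x) → ∑ (filter P? xs) f ≈ ∑ (filter P? xs) g
  ∑-filter-cong P? []       h = ≈-refl
  ∑-filter-cong P? (x ∷ xs) h with P? x
  ... | yes p = +-cong (h x p) (∑-filter-cong P? xs h)
  ... | no _  = ∑-filter-cong P? xs h

  project-cong : ∀ l C {x y} → x ≈ y → project l C x ≈ project l C y
  project-cong l C e = ∑-cong (filter (stabilises? (ϖ l)) (perms n)) (λ v → *-congʳ (coeff-cong (v ∘ₚ u C) e))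

  project-0 : ∀ l C {x} → (∀ v → Stabilises v (ϖ l) → coeff x (v ∘ₚ u C) ≈ 0#) → project l C x ≈ 0#
  project-0 l C h = ≈-trans
    (∑-filter-cong (stabilises? (ϖ l)) (perms n) (λ v st → ≈-trans (*-congʳ (h v st)) (zeroˡ T[ v ])))
    (∑-0 (filter (stabilises? (ϖ l)) (perms n)) (All.universal (λ _ → ≈-refl) _))

  project-+ : ∀ l C x y → project l C (x + y) ≈ project l C x + project l C y
  project-+ l C x y = ≈-trans
    (∑-cong stab (λ v → ≈-trans (*-congʳ (coeff-+ x y (v ∘ₚ u C))) (distribʳ T[ v ] _ _)))
    (∑-+ stab (λ v → coeff x (v ∘ₚ u C) * T[ v ]) (λ v → coeff y (v ∘ₚ u C) * T[ v ]))
    where stab = filter (stabilises? (ϖ l)) (perms n)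

  project-scale : ∀ l C {c} → Scalar c → ∀ x → project l C (c * x) ≈ c * project l C x
  project-scale l C {c} c∈ x = ≈-trans
    (∑-cong stab (λ v → ≈-trans (*-congʳ (coeff-scale c∈ x (v ∘ₚ u C))) (*-assoc c _ T[ v ])))
    (≈-sym (∑-* c stab (λ v → coeff x (v ∘ₚ u C) * T[ v ])))
    where stab = filter (stabilises? (ϖ l)) (perms n)

  -- The whole coset of C has j as an ascent, so a single coefficient formula covers every term of
  -- the part.
  project-up : ∀ j C x → Vec.lookup C (inject₁ j) ≡ true → Vec.lookup C (suc j) ≡ false →
               project (∣ C ∣) C (Tᵢ j * x) ≈ t * project (∣ C ∣) (sᶜ j C) x
  project-up j C x p q = ≈-trans
    (∑-filter-cong (stabilises? (ϖ l)) (perms n) {g = λ v → t * (coeff x (v ∘ₚ u (sᶜ j C)) * T[ v ])}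
      λ v st → ≈-trans (*-congʳ (≈-trans (coeff-asc j x (v ∘ₚ u C) (asc v st))
        (*-congˡ (reflexive (coeff-resp x {(v ∘ₚ u C) ∘ₚ s j} {v ∘ₚ u (sᶜ j C)}
          (λ i → proj₂ (u-cover j C p q) (v ⟨$⟩ʳ i)))))))
        (*-assoc t _ T[ v ]))
    (≈-sym (∑-* t (filter (stabilises? (ϖ l)) (perms n)) (λ v → coeff x (v ∘ₚ u (sᶜ j C)) * T[ v ])))
    where
    l = ∣ C ∣
    asc : ∀ v → Stabilises v (ϖ l) → Asc j (v ∘ₚ u C)
    asc v st = image-asc j (v ∘ₚ u C) l (trans (cong (λ D → Vec.lookup D (inject₁ j)) (image-u C v st)) p)
                                        (trans (cong (λ D → Vec.lookup D (suc j)) (image-u C v st)) q)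

  project-down : ∀ j C x → Vec.lookup C (inject₁ j) ≡ false → Vec.lookup C (suc j) ≡ true →
                 project (∣ C ∣) C (Tᵢ j * x) ≈ project (∣ C ∣) (sᶜ j C) x + (t - 1#) * project (∣ C ∣) C x
  project-down j C x p q = ≈-trans (∑-filter-cong (stabilises? (ϖ l)) (perms n) {g = λ v → f v + (t - 1#) * g v}
      λ v st → ≈-trans (*-congʳ (≈-trans (coeff-desc j x (v ∘ₚ u C) (desc v st))
        (+-congʳ (reflexive (coeff-resp x {(v ∘ₚ u C) ∘ₚ s j} {v ∘ₚ u (sᶜ j C)} (λ i → u-descend j C p q (v ⟨$⟩ʳ i)))))))
        (≈-trans (distribʳ T[ v ] _ _) (+-congˡ (*-assoc (t - 1#) _ T[ v ]))))
    (≈-trans (∑-+ (filter (stabilises? (ϖ l)) (perms n)) f (λ v → (t - 1#) * g v))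
      (+-congˡ (≈-sym (∑-* (t - 1#) (filter (stabilises? (ϖ l)) (perms n)) g))))
    where
    l = ∣ C ∣
    f = λ v → coeff x (v ∘ₚ u (sᶜ j C)) * T[ v ]
    g = λ v → coeff x (v ∘ₚ u C) * T[ v ]
    desc : ∀ v → Stabilises v (ϖ l) → ¬ Asc j (v ∘ₚ u C)
    desc v st = image-desc j (v ∘ₚ u C) l (trans (cong (λ D → Vec.lookup D (inject₁ j)) (image-u C v st)) p)
                                          (trans (cong (λ D → Vec.lookup D (suc j)) (image-u C v st)) q)

  module _ (j k : Fin m) (C : Column) (uk : u C ⟨$⟩ʳ inject₁ k ≡ inject₁ j) (uk⁺ : u C ⟨$⟩ʳ suc k ≡ suc j)
           (side : (toℕ (inject₁ k) ℕ.<ᵇ ∣ C ∣) ≡ (toℕ (suc k) ℕ.<ᵇ ∣ C ∣)) where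

    private
      l = ∣ C ∣
      ϖ≡ : ϖ l (inject₁ k) ≡ ϖ l (suc k)
      ϖ≡ = cong (if_then 1 else 0) side

      su≗us : s k ∘ₚ u C ≗ₚ u C ∘ₚ s j
      su≗us x = sym (s-conj (u C ⟨$⟩ʳ_) (w-inj (u C)) k j uk uk⁺ x)

      inject< : ∀ {k} (i : Fin k) → inject₁ i Fin.< suc i
      inject< i = ℕ.s≤s (ℕₚ.≤-reflexive (Finₚ.toℕ-inject₁ i))

    -- Here s_j u_C = u_C s_k, and j is an ascent of u_C v exactly when k is one of v, so the
    -- coefficient formulas for T_j and T_k correspond term by term.
    project-same : ∀ x → project l C (Tᵢ j * x) ≈ Tᵢ k * project l C x
    project-same x = coeff-injective (project∈ l C (Tᵢ j * x)) (*∈ (gen∈ (‵T k)) (project∈ l C x))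
      (λ v → go v (stabilises? (ϖ l) v) (asc? k v))
      where
      stab-s⁻ : ∀ {v} → Stabilises (v ∘ₚ s k) (ϖ l) → Stabilises v (ϖ l)
      stab-s⁻ {v} st = stabilises-resp {ϖ l} {(v ∘ₚ s k) ∘ₚ s k} {v} (s-s k v) (stab-s k ϖ≡ (v ∘ₚ s k) st)

      moved : ∀ v → coeff x ((v ∘ₚ u C) ∘ₚ s j) ≈ coeff x ((v ∘ₚ s k) ∘ₚ u C)
      moved v = reflexive (coeff-resp x {(v ∘ₚ u C) ∘ₚ s j} {(v ∘ₚ s k) ∘ₚ u C} (λ i → sym (su≗us (v ⟨$⟩ʳ i))))

      Asc-u⁺ : ∀ {v} → Asc k v → Asc j (v ∘ₚ u C)
      Asc-u⁺ {v} = subst₂ Fin._<_ (cong (v ⟨$⟩ˡ_) (sym (inv-eq (u C) uk))) (cong (v ⟨$⟩ˡ_) (sym (inv-eq (u C) uk⁺)))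

      Asc-u⁻ : ∀ {v} → Asc j (v ∘ₚ u C) → Asc k v
      Asc-u⁻ {v} = subst₂ Fin._<_ (cong (v ⟨$⟩ˡ_) (inv-eq (u C) uk)) (cong (v ⟨$⟩ˡ_) (inv-eq (u C) uk⁺))

      go : ∀ v → Dec (Stabilises v (ϖ l)) → Dec (Asc k v) →
           coeff (project l C (Tᵢ j * x)) v ≈ coeff (Tᵢ k * project l C x) v
      go v (yes st) (yes a) = begin
        coeff (project l C (Tᵢ j * x)) v           ≈⟨ coeff-project l C (Tᵢ j * x) v st ⟩
        coeff (Tᵢ j * x) (v ∘ₚ u C)                ≈⟨ coeff-asc j x (v ∘ₚ u C) (Asc-u⁺ {v} a) ⟩
        t * coeff x ((v ∘ₚ u C) ∘ₚ s j)            ≈⟨ *-congˡ (moved v) ⟩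
        t * coeff x ((v ∘ₚ s k) ∘ₚ u C)            ≈⟨ *-congˡ (coeff-project l C x (v ∘ₚ s k) (stab-s k ϖ≡ v st)) ⟨
        t * coeff (project l C x) (v ∘ₚ s k)       ≈⟨ coeff-asc k (project l C x) v a ⟨
        coeff (Tᵢ k * project l C x) v             ∎
      go v (yes st) (no ¬a) = begin
        coeff (project l C (Tᵢ j * x)) v           ≈⟨ coeff-project l C (Tᵢ j * x) v st ⟩
        coeff (Tᵢ j * x) (v ∘ₚ u C)                ≈⟨ coeff-desc j x (v ∘ₚ u C) (¬a ∘ Asc-u⁻ {v}) ⟩
        coeff x ((v ∘ₚ u C) ∘ₚ s j) + (t - 1#) * coeff x (v ∘ₚ u C)
          ≈⟨ +-cong (≈-trans (moved v) (≈-sym (coeff-project l C x (v ∘ₚ s k) (stab-s k ϖ≡ v st))))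
                    (*-congˡ (≈-sym (coeff-project l C x v st))) ⟩
        coeff (project l C x) (v ∘ₚ s k) + (t - 1#) * coeff (project l C x) v
          ≈⟨ coeff-desc k (project l C x) v ¬a ⟨
        coeff (Tᵢ k * project l C x) v             ∎
      -- s_k stabilises ϖ_l, so v and s_k v are outside the stabiliser together and nothing survives
      -- on either side.
      go v (no ¬st) asc = ≈-trans (coeff-project-0 l C (Tᵢ j * x) v ¬st) (≈-sym (vanish asc))
        where
        vanish : Dec (Asc k v) → coeff (Tᵢ k * project l C x) v ≈ 0#
        vanish (yes a) = ≈-trans (coeff-asc k (project l C x) v a)
          (≈-trans (*-congˡ (coeff-project-0 l C x (v ∘ₚ s k) (¬st ∘ stab-s⁻ {v}))) (zeroʳ t))
        vanish (no ¬a) = ≈-trans (coeff-desc k (project l C x) v ¬a)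
          (≈-trans (+-cong (coeff-project-0 l C x (v ∘ₚ s k) (¬st ∘ stab-s⁻ {v}))
                           (≈-trans (*-congˡ (coeff-project-0 l C x v ¬st)) (zeroʳ _))) (+-identityˡ 0#))

    -- With v = u_C⁻¹, both T_v T_j and T_k T_v are length-additive products for the same
    -- permutation v s_j = s_k v. Inverting T_v on both sides moves T_k out on the left as T_j.
    lead-same : ∀ h → lead C (Tᵢ k * h) ≈ Tᵢ j * lead C h
    lead-same h = begin
      t ^ ℓ (u C) * (a⁻¹ * (Tᵢ k * h))    ≈⟨ *-congˡ (*-assoc a⁻¹ (Tᵢ k) h) ⟨
      t ^ ℓ (u C) * ((a⁻¹ * Tᵢ k) * h)    ≈⟨ *-congˡ (*-congʳ a⁻¹T) ⟩
      t ^ ℓ (u C) * ((Tᵢ j * a⁻¹) * h)    ≈⟨ *-congˡ (*-assoc (Tᵢ j) a⁻¹ h) ⟩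
      t ^ ℓ (u C) * (Tᵢ j * (a⁻¹ * h))    ≈⟨ pull (t^∈ (ℓ (u C))) (Tᵢ j) (a⁻¹ * h) ⟨
      Tᵢ j * (t ^ ℓ (u C) * (a⁻¹ * h))    ∎
      where
      v = Perm.flip (u C)
      a = T[ v ]
      a⁻¹ = T[ v ]⁻¹
      aT : a * Tᵢ j ≈ Tᵢ k * a
      aT = begin
        a * Tᵢ j       ≈⟨ B.ascendʳ Tᵢ braided v j
                            (subst₂ Fin._<_ (sym (inv-eq (u C) uk)) (sym (inv-eq (u C) uk⁺)) (inject< k)) ⟩
        T[ s j ∘ₚ v ]  ≈⟨ T-cong (s j ∘ₚ v) (v ∘ₚ s k) (λ x →
                            sym (s-conj (v ⟨$⟩ʳ_) (w-inj v) j k (inv-eq (u C) uk) (inv-eq (u C) uk⁺) x)) ⟩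
        T[ v ∘ₚ s k ]  ≈⟨ B.ascend Tᵢ braided k v (subst₂ Fin._<_ (sym uk) (sym uk⁺) (inject< j)) ⟨
        Tᵢ k * a       ∎
      a⁻¹T : a⁻¹ * Tᵢ k ≈ Tᵢ j * a⁻¹
      a⁻¹T = begin
        a⁻¹ * Tᵢ k                    ≈⟨ *-identityʳ _ ⟨
        (a⁻¹ * Tᵢ k) * 1#             ≈⟨ *-congˡ (T-inverseʳ v) ⟨
        (a⁻¹ * Tᵢ k) * (a * a⁻¹)      ≈⟨ *-assoc _ a a⁻¹ ⟨
        ((a⁻¹ * Tᵢ k) * a) * a⁻¹      ≈⟨ *-congʳ (*-assoc a⁻¹ (Tᵢ k) a) ⟩
        (a⁻¹ * (Tᵢ k * a)) * a⁻¹      ≈⟨ *-congʳ (*-congˡ aT) ⟨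
        (a⁻¹ * (a * Tᵢ j)) * a⁻¹      ≈⟨ *-congʳ (*-assoc a⁻¹ a (Tᵢ j)) ⟨
        ((a⁻¹ * a) * Tᵢ j) * a⁻¹      ≈⟨ *-congʳ (*-congʳ (T-inverseˡ v)) ⟩
        (1# * Tᵢ j) * a⁻¹             ≈⟨ *-congʳ (*-identityˡ (Tᵢ j)) ⟩
        Tᵢ j * a⁻¹                    ∎

  -- The leading factor of a column

  lead-cong : ∀ C {g h} → g ≈ h → lead C g ≈ lead C h
  lead-cong C e = *-congˡ (*-congˡ e)

  lead-+ : ∀ C g h → lead C (g + h) ≈ lead C g + lead C h
  lead-+ C g h = ≈-trans (*-congˡ (distribˡ _ g h)) (distribˡ _ _ _)

  lead-scale : ∀ C {c} → Scalar c → ∀ h → lead C (c * h) ≈ c * lead C h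
  lead-scale C c∈ h = ≈-trans (*-congˡ (pull c∈ _ h)) (pull c∈ _ _)

  lead-top : ∀ C → C ≡ top n ∣ C ∣ → ∀ h → lead C h ≈ h
  lead-top C e h = begin
    t ^ ℓ (u C) * (T[ v ]⁻¹ * h)
      ≡⟨ cong₂ (λ is js → t ^ List.length is * (prod (Ring.*-monoid H) Tᵢ⁻¹ (List.reverse js) * h))
           (word≡ (u C) (u-top-id C e)) (word≡ v (inv-cong {v = u C} {Perm.id} (u-top-id C e))) ⟩
    1# * (1# * h)
      ≈⟨ ≈-trans (*-identityˡ _) (*-identityˡ h) ⟩
    h ∎
    where
    v = Perm.flip (u C)
    word≡ : ∀ w → w ≗ₚ Perm.id → word w ≡ []
    word≡ w e = trans (word-cong w Perm.id e) word-id

  tT⁻¹ : ∀ j h → t * (Tᵢ⁻¹ j * h) ≈ Tᵢ j * h + (1# - t) * h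
  tT⁻¹ j h = begin
    t * ((t⁻¹ * (Tᵢ j + (1# - t))) * h)   ≈⟨ *-congˡ (*-assoc t⁻¹ _ h) ⟩
    t * (t⁻¹ * ((Tᵢ j + (1# - t)) * h))   ≈⟨ *-assoc t t⁻¹ _ ⟨
    (t * t⁻¹) * ((Tᵢ j + (1# - t)) * h)   ≈⟨ *-congʳ (≈-trans (central t∈ t⁻¹) t⁻¹t) ⟩
    1# * ((Tᵢ j + (1# - t)) * h)          ≈⟨ *-identityˡ _ ⟩
    (Tᵢ j + (1# - t)) * h                 ≈⟨ distribʳ h (Tᵢ j) (1# - t) ⟩
    Tᵢ j * h + (1# - t) * h               ∎

  T-tT⁻¹ : ∀ j h → Tᵢ j * (t * (Tᵢ⁻¹ j * h)) ≈ t * h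
  T-tT⁻¹ j h = ≈-trans (pull t∈ (Tᵢ j) _) (*-congˡ (≈-trans (≈-sym (*-assoc (Tᵢ j) (Tᵢ⁻¹ j) h))
    (≈-trans (*-congʳ (Tᵢ-Tᵢ⁻¹ j)) (*-identityˡ h))))

  -- From u_{s_j C} = s_j u_C the length grows by one and T_{u⁻¹} gains T_j on the right. Inversion
  -- puts T_j⁻¹ on the left, and the exponent ℓ(u_C) supplies the t that accompanies it.
  lead-up : ∀ j C h → Vec.lookup C (inject₁ j) ≡ true → Vec.lookup C (suc j) ≡ false →
            lead (sᶜ j C) h ≈ t * (Tᵢ⁻¹ j * lead C h)
  lead-up j C h p q = begin
    t ^ ℓ (u D) * (T[ w ]⁻¹ * h)                    ≡⟨ cong (λ k → t ^ k * (T[ w ]⁻¹ * h)) ℓ≡ ⟩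
    (t * t ^ ℓ (u C)) * (T[ w ]⁻¹ * h)              ≈⟨ *-congˡ (*-congʳ inverse) ⟩
    (t * t ^ ℓ (u C)) * ((Tᵢ⁻¹ j * T[ v ]⁻¹) * h)   ≈⟨ *-assoc t _ _ ⟩
    t * (t ^ ℓ (u C) * ((Tᵢ⁻¹ j * T[ v ]⁻¹) * h))   ≈⟨ *-congˡ (*-congˡ (*-assoc (Tᵢ⁻¹ j) T[ v ]⁻¹ h)) ⟩
    t * (t ^ ℓ (u C) * (Tᵢ⁻¹ j * (T[ v ]⁻¹ * h)))   ≈⟨ *-congˡ (pull (t^∈ (ℓ (u C))) (Tᵢ⁻¹ j) _) ⟨
    t * (Tᵢ⁻¹ j * (t ^ ℓ (u C) * (T[ v ]⁻¹ * h)))   ∎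
    where
    D = sᶜ j C
    v = Perm.flip (u C)
    w = Perm.flip (u D)
    asc = proj₁ (u-cover j C p q)
    us = proj₂ (u-cover j C p q)
    ℓ≡ : ℓ (u D) ≡ suc (ℓ (u C))
    ℓ≡ = trans (cong List.length (word-cong (u D) (u C ∘ₚ s j) (λ x → sym (us x)))) (ℓ-step j (u C) asc)
    Tw : T[ w ] ≈ T[ v ] * Tᵢ j
    Tw = ≈-sym (≈-trans (B.ascendʳ Tᵢ braided v j asc) (T-cong (s j ∘ₚ v) w
      (λ x → trans (cong (v ⟨$⟩ʳ_) (sym (s-inv j x))) (inv-cong {v = u C ∘ₚ s j} {u D} us x))))
    inverse : T[ w ]⁻¹ ≈ Tᵢ⁻¹ j * T[ v ]⁻¹
    inverse = begin
      T[ w ]⁻¹                                              ≈⟨ *-identityʳ _ ⟨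
      T[ w ]⁻¹ * 1#                                         ≈⟨ *-congˡ (≈-trans (inner (Tᵢ-Tᵢ⁻¹ j)) (T-inverseʳ v)) ⟨
      T[ w ]⁻¹ * ((T[ v ] * Tᵢ j) * (Tᵢ⁻¹ j * T[ v ]⁻¹))    ≈⟨ *-congˡ (*-congʳ Tw) ⟨
      T[ w ]⁻¹ * (T[ w ] * (Tᵢ⁻¹ j * T[ v ]⁻¹))             ≈⟨ *-assoc _ _ _ ⟨
      (T[ w ]⁻¹ * T[ w ]) * (Tᵢ⁻¹ j * T[ v ]⁻¹)             ≈⟨ *-congʳ (T-inverseˡ w) ⟩
      1# * (Tᵢ⁻¹ j * T[ v ]⁻¹)                              ≈⟨ *-identityˡ _ ⟩
      Tᵢ⁻¹ j * T[ v ]⁻¹                                     ∎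

  lead-down : ∀ j C h → Vec.lookup C (inject₁ j) ≡ false → Vec.lookup C (suc j) ≡ true →
              lead C h ≈ t * (Tᵢ⁻¹ j * lead (sᶜ j C) h)
  lead-down j C h p q = ≈-trans (reflexive (cong (λ D → lead D h) (sym (sᶜ-invol j C))))
    (lead-up j (sᶜ j C) h (proj₁ (sᶜ-swaps j C p q)) (proj₂ (sᶜ-swaps j C p q)))

  -- Adding a column on the left

  Φ : Column → Carrier → Carrier
  Φ C x = lead C (project (∣ C ∣) C x)

  Ψ-∷ : ∀ C D S → Ψ (C ∷⁺ (D ∷ S)) ≈ Φ C (Ψ (D ∷⁺ S))
  Ψ-∷ C D S = lead-cong C (part≈project C (decompose ∣ C ∣ (∣p∣≤n C) (proj₂ (ψ D S))))

  Φ-cong : ∀ C {x y} → x ≈ y → Φ C x ≈ Φ C y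
  Φ-cong C e = lead-cong C (project-cong (∣ C ∣) C e)

  Φ-+ : ∀ C x y → Φ C (x + y) ≈ Φ C x + Φ C y
  Φ-+ C x y = ≈-trans (lead-cong C (project-+ (∣ C ∣) C x y)) (lead-+ C _ _)

  Φ-scale : ∀ C {c} → Scalar c → ∀ x → Φ C (c * x) ≈ c * Φ C x
  Φ-scale C c∈ x = ≈-trans (lead-cong C (project-scale (∣ C ∣) C c∈ x)) (lead-scale C c∈ _)

  Φ-0 : ∀ C → Φ C 0# ≈ 0#
  Φ-0 C = ≈-trans (Φ-cong C (≈-sym (zeroˡ 0#))) (≈-trans (Φ-scale C 0∈ 0#) (zeroˡ _))

  Φ-neg : ∀ C x → Φ C (- x) ≈ - Φ C x
  Φ-neg C x = ≈-trans (Φ-cong C (≈-sym (-1*x≈-x x))) (≈-trans (Φ-scale C -1∈ x) (-1*x≈-x _))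

  Φ-· : ∀ C ς x → Φ C (ς · x) ≈ ς · Φ C x
  Φ-· C Sign.+ x = ≈-refl
  Φ-· C Sign.- x = Φ-neg C x

  Φ-∑ : ∀ {a} {X : Set a} C (xs : List X) f → Φ C (∑ xs f) ≈ ∑ xs (λ x → Φ C (f x))
  Φ-∑ C []       f = Φ-0 C
  Φ-∑ C (x ∷ xs) f = ≈-trans (Φ-+ C (f x) (∑ xs f)) (+-congˡ (Φ-∑ C xs f))

  1-t∈ : Scalar (1# - t)
  1-t∈ = +∈ 1∈ (-∈ t∈)

  -- T_j^{±1}, normalised as T_j and t T_j⁻¹.
  τ : Fin m → Sign → Carrier → Carrier
  τ j Sign.- x = Tᵢ j * x
  τ j Sign.+ x = t * (Tᵢ⁻¹ j * x)

  τ-cong : ∀ j ς {x y} → x ≈ y → τ j ς x ≈ τ j ς y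
  τ-cong j Sign.- e = *-congˡ e
  τ-cong j Sign.+ e = *-congˡ (*-congˡ e)

  t-1+1-t : ∀ x → (t - 1#) * x + (1# - t) * x ≈ 0#
  t-1+1-t x = ≈-trans (≈-sym (distribʳ x _ _)) (≈-trans (*-congʳ cancel) (zeroˡ x))

  t-1≈-[1-t] : ∀ x → (t - 1#) * x ≈ - ((1# - t) * x)
  t-1≈-[1-t] x = +-inverseˡ-unique _ _ (t-1+1-t x)

  T≈ : ∀ j y → Tᵢ j * y ≈ t * (Tᵢ⁻¹ j * y) + - ((1# - t) * y)
  T≈ j y = begin
    Tᵢ j * y                                            ≈⟨ +-identityʳ _ ⟨
    Tᵢ j * y + 0#                                       ≈⟨ +-congˡ (-‿inverseʳ _) ⟨
    Tᵢ j * y + ((1# - t) * y + - ((1# - t) * y))        ≈⟨ +-assoc _ _ _ ⟨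
    (Tᵢ j * y + (1# - t) * y) + - ((1# - t) * y)        ≈⟨ +-congʳ (tT⁻¹ j y) ⟨
    t * (Tᵢ⁻¹ j * y) + - ((1# - t) * y)                 ∎

  σ≡ : ∀ j C {b b′} → Vec.lookup C (inject₁ j) ≡ b → Vec.lookup C (suc j) ≡ b′ →
       σ j C ≡ (if b ∧ not b′ then Sign.- else Sign.+)
  σ≡ j C {b} {b′} p q = cong₂ (λ b b′ → if b ∧ not b′ then Sign.- else Sign.+) (bit (inject₁ j) p) (bit (suc j) q)
    where
    bit : ∀ i {b} → Vec.lookup C i ≡ b → does (i ∈? C) ≡ b
    bit i {true}  e = dec-true (i ∈? C) (Vecₚ.lookup⇒[]= i C e)
    bit i {false} e = dec-false (i ∈? C) (λ i∈ → contradiction (trans (sym e) (Vecₚ.[]=⇒lookup i∈)) λ ())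

  -- The part at C of T_j x is t times the part of x at s_j C. That t equals T_j (t T_j⁻¹), whose
  -- second factor turns the leading factor of C into that of s_j C.
  Φ-T-neg : ∀ j C x → Vec.lookup C (inject₁ j) ≡ true → Vec.lookup C (suc j) ≡ false →
            Φ C (Tᵢ j * x) ≈ Tᵢ j * Φ (sᶜ j C) x
  Φ-T-neg j C x p q = begin
    lead C (project (∣ C ∣) C (Tᵢ j * x))          ≈⟨ lead-cong C (project-up j C x p q) ⟩
    lead C (t * y)                                 ≈⟨ lead-scale C t∈ y ⟩
    t * lead C y                                   ≈⟨ T-tT⁻¹ j (lead C y) ⟨
    Tᵢ j * (t * (Tᵢ⁻¹ j * lead C y))               ≈⟨ *-congˡ (lead-up j C y p q) ⟨
    Tᵢ j * lead (sᶜ j C) y                         ≡⟨ cong (λ l → Tᵢ j * lead (sᶜ j C) (project l (sᶜ j C) x)) (sym (sᶜ-size j C)) ⟩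
    Tᵢ j * Φ (sᶜ j C) x                            ∎
    where y = project (∣ C ∣) (sᶜ j C) x

  -- One formula serves the three remaining positions. If s_j C = C, it is T_j Φ_C x rewritten by
  -- T_j = t T_j⁻¹ - (1 - t); if j ∉ C and j+1 ∈ C, the two terms come from s_j C and from C.
  Φ-T-pos : ∀ j C x → ¬ (Vec.lookup C (inject₁ j) ≡ true × Vec.lookup C (suc j) ≡ false) →
            Φ C (Tᵢ j * x) ≈ t * (Tᵢ⁻¹ j * Φ (sᶜ j C) x) + - ((1# - t) * Φ C x)
  Φ-T-pos j C x ¬neg = cases _ _ refl refl
    where
    same : Vec.lookup C (inject₁ j) ≡ Vec.lookup C (suc j) →
           Φ C (Tᵢ j * x) ≈ t * (Tᵢ⁻¹ j * Φ (sᶜ j C) x) + - ((1# - t) * Φ C x)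
    same e with k , uk , uk⁺ , side ← u-same j C e = begin
      lead C (project (∣ C ∣) C (Tᵢ j * x))   ≈⟨ lead-cong C (project-same j k C uk uk⁺ side x) ⟩
      lead C (Tᵢ k * project (∣ C ∣) C x)     ≈⟨ lead-same j k C uk uk⁺ side (project (∣ C ∣) C x) ⟩
      Tᵢ j * Φ C x                            ≈⟨ T≈ j (Φ C x) ⟩
      t * (Tᵢ⁻¹ j * Φ C x) + - ((1# - t) * Φ C x)
        ≡⟨ cong (λ D → t * (Tᵢ⁻¹ j * Φ D x) + - ((1# - t) * Φ C x)) (sym (sᶜ-same j C e)) ⟩
      t * (Tᵢ⁻¹ j * Φ (sᶜ j C) x) + - ((1# - t) * Φ C x) ∎
    cases : ∀ b b′ → Vec.lookup C (inject₁ j) ≡ b → Vec.lookup C (suc j) ≡ b′ →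
            Φ C (Tᵢ j * x) ≈ t * (Tᵢ⁻¹ j * Φ (sᶜ j C) x) + - ((1# - t) * Φ C x)
    cases true  true  p q = same (trans p (sym q))
    cases false false p q = same (trans p (sym q))
    cases true  false p q = contradiction (p , q) ¬neg
    cases false true  p q = begin
      lead C (project (∣ C ∣) C (Tᵢ j * x))          ≈⟨ lead-cong C (project-down j C x p q) ⟩
      lead C (y + (t - 1#) * project (∣ C ∣) C x)    ≈⟨ ≈-trans (lead-+ C y _) (+-congˡ (lead-scale C t-1∈ _)) ⟩
      lead C y + (t - 1#) * Φ C x                    ≈⟨ +-cong lower (t-1≈-[1-t] (Φ C x)) ⟩
      t * (Tᵢ⁻¹ j * Φ D x) + - ((1# - t) * Φ C x)    ∎
      where
      D = sᶜ j C
      y = project (∣ C ∣) D x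
      lower : lead C y ≈ t * (Tᵢ⁻¹ j * Φ D x)
      lower = ≈-trans (lead-down j C y p q)
        (reflexive (cong (λ l → t * (Tᵢ⁻¹ j * lead D (project l D x))) (sym (sᶜ-size j C))))

  Φ-tT⁻¹ : ∀ j C x {a} → Φ C (Tᵢ j * x) ≈ a → Φ C (t * (Tᵢ⁻¹ j * x)) ≈ a + (1# - t) * Φ C x
  Φ-tT⁻¹ j C x {a} e = begin
    Φ C (t * (Tᵢ⁻¹ j * x))               ≈⟨ Φ-cong C (tT⁻¹ j x) ⟩
    Φ C (Tᵢ j * x + (1# - t) * x)        ≈⟨ Φ-+ C _ _ ⟩
    Φ C (Tᵢ j * x) + Φ C ((1# - t) * x)  ≈⟨ +-cong e (Φ-scale C 1-t∈ x) ⟩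
    a + (1# - t) * Φ C x                 ∎

  -- Since t T_j⁻¹ - T_j = 1 - t, the formulas for Φ_C (T_j x) settle both values of ς. Multiples of
  -- 1 - t cancel or are absent when ς is the sign of C; otherwise one remains, carrying the sign ς
  -- of the operator that entered.
  Φ-τ : ∀ j C ς x → Φ C (τ j ς x) ≈ τ j (σ j C) (Φ (sᶜ j C) x)
          + (if does ((ς Sign.* σ j C) Sign.≟ Sign.-) then ς · ((1# - t) * Φ C x) else 0#)
  Φ-τ j C ς x = cases _ _ refl refl
    where
    rhs : Sign → Carrier
    rhs ς′ = τ j ς′ (Φ (sᶜ j C) x) + (if does ((ς Sign.* ς′) Sign.≟ Sign.-) then ς · ((1# - t) * Φ C x) else 0#)
    at- : ∀ ς → Φ C (Tᵢ j * x) ≈ Tᵢ j * Φ (sᶜ j C) x → Φ C (τ j ς x) ≈ τ j Sign.- (Φ (sᶜ j C) x)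
          + (if does ((ς Sign.* Sign.-) Sign.≟ Sign.-) then ς · ((1# - t) * Φ C x) else 0#)
    at- Sign.- e = ≈-trans e (≈-sym (+-identityʳ _))
    at- Sign.+ e = Φ-tT⁻¹ j C x e
    at+ : ∀ ς → Φ C (Tᵢ j * x) ≈ t * (Tᵢ⁻¹ j * Φ (sᶜ j C) x) + - ((1# - t) * Φ C x) →
          Φ C (τ j ς x) ≈ τ j Sign.+ (Φ (sᶜ j C) x)
          + (if does ((ς Sign.* Sign.+) Sign.≟ Sign.-) then ς · ((1# - t) * Φ C x) else 0#)
    at+ Sign.- e = e
    at+ Sign.+ e = ≈-trans (Φ-tT⁻¹ j C x e) (≈-trans (+-assoc _ _ _) (+-congˡ (-‿inverseˡ _)))
    result : ∀ {ς′} → σ j C ≡ ς′ → Φ C (τ j ς x) ≈ rhs ς′ → Φ C (τ j ς x) ≈ rhs (σ j C)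
    result refl e = e
    cases : ∀ b b′ → Vec.lookup C (inject₁ j) ≡ b → Vec.lookup C (suc j) ≡ b′ → Φ C (τ j ς x) ≈ rhs (σ j C)
    cases true  false p q = result (σ≡ j C p q) (at- ς (Φ-T-neg j C x p q))
    cases true  true  p q = result (σ≡ j C p q) (at+ ς (Φ-T-pos j C x (λ (_ , r) → contradiction (trans (sym q) r) λ ())))
    cases false true  p q = result (σ≡ j C p q) (at+ ς (Φ-T-pos j C x (λ (r , _) → contradiction (trans (sym p) r) λ ())))
    cases false false p q = result (σ≡ j C p q) (at+ ς (Φ-T-pos j C x (λ (r , _) → contradiction (trans (sym p) r) λ ())))

  -- Semistandardness

  ≼-dec : ∀ cs ds → Dec (cs ≼ ds)
  ≼-dec cs       []       = yes []
  ≼-dec []       (d ∷ ds) = no λ ()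
  ≼-dec (c ∷ cs) (d ∷ ds) with c Finₚ.≤? d | ≼-dec cs ds
  ... | yes p | yes q = yes (p ∷ q)
  ... | no ¬p | _     = no λ { (p ∷ _) → ¬p p }
  ... | yes _ | no ¬q = no λ { (_ ∷ q) → ¬q q }

  -- ps collects the entries already read from C and not yet matched with entries of D.
  ⊑⇒≼′ : ∀ {k} (C D : Subset k) (f : Fin k → Fin n) → (∀ i i′ → i Fin.≤ i′ → f i Fin.≤ f i′) →
         ∀ ps → All (λ p → ∀ i → p Fin.≤ f i) ps → (∀ i → below D i ℕ.≤ List.length ps ℕ.+ below C i) →
         (ps ++ map f (entries C)) ≼ map f (entries D)
  ⊑⇒≼′ []      []      f f-mono ps ps≤ h = []
  ⊑⇒≼′ (c ∷ C) (d ∷ D) f f-mono ps ps≤ h = go c d ps ps≤ h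
    where
    f-mono⁺ : ∀ i i′ → i Fin.≤ i′ → f (suc i) Fin.≤ f (suc i′)
    f-mono⁺ i i′ le = f-mono (suc i) (suc i′) (ℕ.s≤s le)
    rest : ∀ ps → All (λ p → ∀ i → p Fin.≤ f i) ps → (∀ i → below D i ℕ.≤ List.length ps ℕ.+ below C i) →
           (ps ++ map f (map suc (entries C))) ≼ map f (map suc (entries D))
    rest ps ps≤ h = subst₂ (λ xs ys → (ps ++ xs) ≼ ys) (Listₚ.map-∘ (entries C)) (Listₚ.map-∘ (entries D))
      (⊑⇒≼′ C D (f ∘ suc) f-mono⁺ ps (All.map (λ g i → g (suc i)) ps≤) h)
    -- Pending entries form an increasing queue: rows pair the k-th entry of C with the k-th of D,
    -- so the oldest pending entry is matched first and a new one joins at the end.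
    snoc : ∀ ps → All (λ p → ∀ i → p Fin.≤ f i) ps → (∀ i → below D i ℕ.≤ List.length ps ℕ.+ suc (below C i)) →
           (ps ++ f zero ∷ map f (map suc (entries C))) ≼ map f (map suc (entries D))
    snoc ps ps≤ h = subst (_≼ _) (Listₚ.++-assoc ps (f zero ∷ []) _) (rest (ps ++ f zero ∷ [])
      (Allₚ.++⁺ ps≤ ((λ i → f-mono zero i ℕ.z≤n) All.∷ All.[]))
      (λ i → subst (below D i ℕ.≤_) (trans (sym (ℕₚ.+-assoc (List.length ps) 1 (below C i)))
        (cong (ℕ._+ below C i) (sym (Listₚ.length-++ ps)))) (h i)))
    go : ∀ c d ps → All (λ p → ∀ i → p Fin.≤ f i) ps →
         (∀ i → below (d ∷ D) i ℕ.≤ List.length ps ℕ.+ below (c ∷ C) i) →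
         (ps ++ map f (entries (c ∷ C))) ≼ map f (entries (d ∷ D))
    go false false ps       ps≤         h = rest ps ps≤ (λ i → h (suc i))
    go true  false ps       ps≤         h = snoc ps ps≤ (λ i → h (suc i))
    go true  true  []       ps≤         h = ℕₚ.≤-refl ∷ rest [] All.[] (λ i → ℕₚ.≤-pred (h (suc i)))
    go true  true  (p ∷ ps) (p≤ All.∷ ps≤) h = p≤ zero ∷ snoc ps ps≤ (λ i → ℕₚ.≤-pred (h (suc i)))
    go false true  (p ∷ ps) (p≤ All.∷ ps≤) h = p≤ zero ∷ rest ps ps≤ (λ i → ℕₚ.≤-pred (h (suc i)))
    -- An entry of D with no entry of C at or before it left to match contradicts the count at
    -- threshold 1.
    go false true  []       ps≤         h with () ← subst (1 ℕ.≤_) (below-0 C) (ℕₚ.≤-trans (ℕ.s≤s ℕ.z≤n) (h 1))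

  ⊑⇒≼ : ∀ (C D : Column) → C ⊑ D → entries C ≼ entries D
  ⊑⇒≼ C D h = subst₂ _≼_ (Listₚ.map-id (entries C)) (Listₚ.map-id (entries D))
    (⊑⇒≼′ C D (λ i → i) (λ _ _ le → le) [] All.[] h)

  Supported : Column → Carrier → Set
  Supported D x = ∀ w → ¬ (image w ∣ D ∣ ⊑ D) → coeff x w ≈ 0#

  -- Passing from D to s_j D multiplies by t T_j⁻¹ = T_j + (1 - t), so the coefficient at w involves
  -- only those of `lead D g` at w and s_j w, both zero by `⊑-up` and `⊑-s`. For highest weight D
  -- the leading factor is 1, and only w with w{1,...,d} = D occur.
  lead-supported : ∀ D g → Parabolic (ϖ ∣ D ∣) g → Supported D (lead D g)
  lead-supported = column-induction (λ D → ∀ g → Parabolic (ϖ ∣ D ∣) g → Supported D (lead D g))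
    (λ D e g g∈ w ⋢ → ≈-trans (coeff-cong w (lead-top D e g)) (coeff-parabolic g∈ w (λ st → ⋢ (λ i →
      ℕₚ.≤-reflexive (cong (λ F → below F i) (sym (trans
        (image-cong {v = w} {w ∘ₚ u D} ∣ D ∣ (λ x → sym (u-top-id D e (w ⟨$⟩ʳ x))))
        (image-u D w st))))))))
    step
    where
    coeff-T-0 : ∀ j x w → coeff x w ≈ 0# → coeff x (w ∘ₚ s j) ≈ 0# → coeff (Tᵢ j * x) w ≈ 0#
    coeff-T-0 j x w x₀ x₁ with asc? j w
    ... | yes a = ≈-trans (coeff-asc j x w a) (≈-trans (*-congˡ x₁) (zeroʳ t))
    ... | no ¬a = ≈-trans (coeff-desc j x w ¬a)
      (≈-trans (+-cong x₁ (≈-trans (*-congˡ x₀) (zeroʳ _))) (+-identityˡ 0#))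

    step : ∀ j D → Vec.lookup D (inject₁ j) ≡ true → Vec.lookup D (suc j) ≡ false →
           (∀ g → Parabolic (ϖ ∣ D ∣) g → Supported D (lead D g)) →
           ∀ g → Parabolic (ϖ ∣ sᶜ j D ∣) g → Supported (sᶜ j D) (lead (sᶜ j D) g)
    step j D p q h g g∈ w ⋢ = begin
      coeff (lead (sᶜ j D) g) w                      ≈⟨ coeff-cong w (≈-trans (lead-up j D g p q) (tT⁻¹ j x)) ⟩
      coeff (Tᵢ j * x + (1# - t) * x) w              ≈⟨ coeff-+ _ _ w ⟩
      coeff (Tᵢ j * x) w + coeff ((1# - t) * x) w    ≈⟨ +-cong (coeff-T-0 j x w x₀ x₁)
                                                          (≈-trans (coeff-scale 1-t∈ x w) (≈-trans (*-congˡ x₀) (zeroʳ _))) ⟩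
      0# + 0#                                        ≈⟨ +-identityˡ 0# ⟩
      0#                                             ∎
      where
      x = lead D g
      l = ∣ D ∣
      g∈′ : Parabolic (ϖ l) g
      g∈′ = subst (λ l → Parabolic (ϖ l) g) (sᶜ-size j D) g∈
      ⋢′ : ¬ (image w l ⊑ sᶜ j D)
      ⋢′ = subst (λ l → ¬ (image w l ⊑ sᶜ j D)) (sᶜ-size j D) ⋢
      x₀ : coeff x w ≈ 0#
      x₀ = h g g∈′ w (λ ⊑ → ⋢′ (⊑-up j D (image w l) p q ⊑))
      x₁ : coeff x (w ∘ₚ s j) ≈ 0#
      x₁ = h g g∈′ (w ∘ₚ s j) (λ ⊑ → ⋢′ (subst (_⊑ sᶜ j D)
        (trans (cong (sᶜ j) (image-s j w l)) (sᶜ-invol j (image w l))) (⊑-s j D (image (w ∘ₚ s j) l) p q ⊑)))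

  ∑-parabolic : ∀ {a λ′} {X : Set a} {f : X → Carrier} {xs} → All (λ x → Parabolic λ′ (f x)) xs → Parabolic λ′ (∑ xs f)
  ∑-parabolic All.[]       = 0∈
  ∑-parabolic (p All.∷ ps) = +∈ p (∑-parabolic ps)

  Ψ-supported : ∀ D S → Supported D (Ψ (D ∷⁺ S))
  Ψ-supported D []      = lead-supported D (𝟏 (ϖ ∣ D ∣)) (∑-parabolic (All.map (λ {w} → basis w)
    (Allₚ.all-filter (stabilises? (ϖ ∣ D ∣)) (perms n))))
  Ψ-supported D (E ∷ S) = lead-supported D _ (part∈ (decompose ∣ D ∣ (∣p∣≤n D) (proj₂ (ψ E S))) D refl)

  Φ-supported-0 : ∀ C D {x} → ∣ D ∣ ℕ.≤ ∣ C ∣ → ¬ (entries C ≼ entries D) → Supported D x → Φ C x ≈ 0#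
  Φ-supported-0 C D le ⋠ x-supp = ≈-trans (lead-cong C (project-0 (∣ C ∣) C λ v st → x-supp (v ∘ₚ u C) λ ⊑ →
    -- Counts below i increase from D to w{1,...,d} by assumption, and from there to w{1,...,l} = C
    -- by inclusion.
    ⋠ (⊑⇒≼ C D λ i → ℕₚ.≤-trans (⊑ i) (subst (λ F → below (image (v ∘ₚ u C) ∣ D ∣) i ℕ.≤ below F i) (image-u C v st)
      (below-mono (image (v ∘ₚ u C) ∣ D ∣) (image (v ∘ₚ u C) ∣ C ∣) (image-mono (v ∘ₚ u C) le) i)))))
    (≈-trans (*-congˡ (zeroʳ _)) (zeroʳ _))

  -- A failure further to the right already makes the remaining tableau vanish, and Φ_C is linear;
  -- the support argument is for a failure between the two leftmost columns.
  Ψ-non-semistandard : ∀ C S → Linked (λ C D → ∣ D ∣ ℕ.≤ ∣ C ∣) (C ∷ S) →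
                       ¬ Semistandard (C ∷⁺ S) → Ψ (C ∷⁺ S) ≈ 0#
  Ψ-non-semistandard C []      _          ¬ss = contradiction [-] ¬ss
  Ψ-non-semistandard C (D ∷ S) (le ∷ les) ¬ss with ≼-dec (entries C) (entries D)
  ... | yes p = ≈-trans (Ψ-∷ C D S) (≈-trans (Φ-cong C (Ψ-non-semistandard D S les (λ ss → ¬ss (p ∷ ss)))) (Φ-0 C))
  ... | no ¬p = ≈-trans (Ψ-∷ C D S) (Φ-supported-0 C D le ¬p (Ψ-supported D S))

  -- Highest weight tableaux

  ϖ-dominant : ∀ l → Dominant (ϖ l)
  ϖ-dominant l i j i≤j with toℕ j ℕₚ.<? l
  ... | no ≮  = subst (ℕ._≤ ϖ l i) (sym (cong (if_then 1 else 0) (dec-false (toℕ j ℕₚ.<? l) ≮))) ℕ.z≤n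
  ... | yes lt = ℕₚ.≤-reflexive (cong (if_then 1 else 0)
    (trans (dec-true (toℕ j ℕₚ.<? l) lt) (sym (dec-true (toℕ i ℕₚ.<? l) (ℕₚ.≤-<-trans i≤j lt)))))

  shape-dominant : ∀ T → Dominant (shape T)
  shape-dominant (C ∷⁺ S) i j i≤j = go (C ∷ S)
    where
    go : ∀ S → ListAction.sum (map (λ C → ϖ ∣ C ∣ j) S) ℕ.≤ ListAction.sum (map (λ C → ϖ ∣ C ∣ i) S)
    go []      = ℕ.z≤n
    go (C ∷ S) = ℕₚ.+-mono-≤ (ϖ-dominant ∣ C ∣ i j i≤j) (go S)

  -- Two dominant weights change in the same direction from x to y, so their changes cannot
  -- compensate in the sum.
  dominant-sum : ∀ {κ μ} → Dominant κ → Dominant μ → ∀ x y → κ x ℕ.+ μ x ≡ κ y ℕ.+ μ y → κ x ≡ κ y × μ x ≡ μ y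
  dominant-sum {κ} {μ} κ-dom μ-dom x y e =
    [ (λ x≤y → let p , q = squeeze (κ-dom x y x≤y) (μ-dom x y x≤y) (sym e) in sym p , sym q)
    , (λ y≤x → squeeze (κ-dom y x y≤x) (μ-dom y x y≤x) e) ]′ (ℕₚ.≤-total (toℕ x) (toℕ y))
    where
    squeeze : ∀ {a b c d} → a ℕ.≤ c → b ℕ.≤ d → a ℕ.+ b ≡ c ℕ.+ d → a ≡ c × b ≡ d
    squeeze {a} {b} {c} {d} a≤c b≤d e = a≡c , ℕₚ.+-cancelˡ-≡ a b d (trans e (cong (ℕ._+ d) (sym a≡c)))
      where
      a≡c : a ≡ c
      a≡c = ℕₚ.≤-antisym a≤c (ℕₚ.+-cancelʳ-≤ d c a (subst (ℕ._≤ a ℕ.+ d) e (ℕₚ.+-monoʳ-≤ a b≤d)))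

  𝟏-cong : ∀ κ μ → (∀ v → Stabilises v κ → Stabilises v μ) → (∀ v → Stabilises v μ → Stabilises v κ) → 𝟏 κ ≈ 𝟏 μ
  𝟏-cong κ μ f g = coeff-injective (𝟏∈ κ) (𝟏∈ μ) λ v → ≈-trans (coeff-𝟏 κ v)
    (≈-trans ([]-⇔ (stabilises? κ v) (stabilises? μ v) (f v) (g v)) (≈-sym (coeff-𝟏 μ v)))

  stab-∘⁺ : ∀ κ v w → Stabilises w κ → Stabilises v κ → Stabilises (v ∘ₚ w) κ
  stab-∘⁺ κ v w w-st v-st i = trans (v-st (w ⟨$⟩ˡ i)) (w-st i)

  stab-∘⁻ : ∀ κ v w → Stabilises w κ → Stabilises (v ∘ₚ w) κ → Stabilises v κ
  stab-∘⁻ κ v w w-st vw-st i = trans (cong (λ x → κ (v ⟨$⟩ˡ x)) (sym (inverseˡ w)))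
    (trans (vw-st (w ⟨$⟩ʳ i)) (trans (sym (w-st (w ⟨$⟩ʳ i))) (cong κ (inverseˡ w))))

  Ψ-highest : ∀ C S → All (λ C → C ≡ top n ∣ C ∣) (C ∷ S) → Ψ (C ∷⁺ S) ≈ 𝟏 (shape (C ∷⁺ S))
  Ψ-highest C [] (e All.∷ All.[]) = ≈-trans (lead-top C e (𝟏 (ϖ ∣ C ∣))) (𝟏-cong (ϖ ∣ C ∣) (shape (C ∷⁺ []))
    (λ v st i → cong (ℕ._+ 0) (st i)) (λ v st i → ℕₚ.+-cancelʳ-≡ 0 _ _ (st i)))
  Ψ-highest C (D ∷ S) (e All.∷ es) = begin
    Ψ (C ∷⁺ (D ∷ S))        ≈⟨ Ψ-∷ C D S ⟩
    Φ C (Ψ (D ∷⁺ S))        ≈⟨ Φ-cong C (Ψ-highest D S es) ⟩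
    Φ C (𝟏 κ)               ≈⟨ lead-top C e _ ⟩
    project l C (𝟏 κ)       ≈⟨ coeff-injective (project∈ l C (𝟏 κ)) (𝟏∈ κ⁺) (λ v → go v (stabilises? (ϖ l) v)) ⟩
    𝟏 κ⁺                    ∎
    where
    l = ∣ C ∣
    κ = shape (D ∷⁺ S)
    κ⁺ = shape (C ∷⁺ (D ∷ S))
    split : ∀ v → Stabilises v κ⁺ → Stabilises v (ϖ l) × Stabilises v κ
    split v st = (λ i → proj₁ (parts i)) , (λ i → proj₂ (parts i))
      where
      parts : ∀ i → ϖ l (v ⟨$⟩ˡ i) ≡ ϖ l i × κ (v ⟨$⟩ˡ i) ≡ κ i
      parts i = dominant-sum {ϖ l} {κ} (ϖ-dominant l) (shape-dominant (D ∷⁺ S)) (v ⟨$⟩ˡ i) i (st i)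
    u-stab : Stabilises (u C) κ
    u-stab i = cong κ (inv-eq (u C) (u-top-id C e i))
    go : ∀ v → Dec (Stabilises v (ϖ l)) → coeff (project l C (𝟏 κ)) v ≈ coeff (𝟏 κ⁺) v
    go v (yes st) = begin
      coeff (project l C (𝟏 κ)) v       ≈⟨ coeff-project l C (𝟏 κ) v st ⟩
      coeff (𝟏 κ) (v ∘ₚ u C)            ≈⟨ coeff-𝟏 κ (v ∘ₚ u C) ⟩
      [ stabilises? κ (v ∘ₚ u C) ]      ≈⟨ []-⇔ (stabilises? κ (v ∘ₚ u C)) (stabilises? κ⁺ v)
                                             (λ p i → cong₂ ℕ._+_ (st i) (stab-∘⁻ κ v (u C) u-stab p i))
                                             (λ p → stab-∘⁺ κ v (u C) u-stab (proj₂ (split v p))) ⟩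
      [ stabilises? κ⁺ v ]              ≈⟨ coeff-𝟏 κ⁺ v ⟨
      coeff (𝟏 κ⁺) v                    ∎
    go v (no ¬st) = ≈-trans (coeff-project-0 l C (𝟏 κ) v ¬st)
      (≈-sym (≈-trans (coeff-𝟏 κ⁺ v) ([]-no (stabilises? κ⁺ v) (¬st ∘ proj₁ ∘ split v))))

  -- When u_C stabilises κ, the product u_C v does so exactly when v does; hence the coefficients of
  -- 𝟏_κ along the coset do not depend on C.
  project-𝟏 : ∀ l C D κ → Stabilises (u C) κ → Stabilises (u D) κ → project l C (𝟏 κ) ≈ project l D (𝟏 κ)
  project-𝟏 l C D κ C-st D-st = ∑-cong (filter (stabilises? (ϖ l)) (perms n)) λ v → *-congʳ
    (≈-trans (coeff-𝟏 κ (v ∘ₚ u C)) (≈-trans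
      ([]-⇔ (stabilises? κ (v ∘ₚ u C)) (stabilises? κ (v ∘ₚ u D))
        (λ p → stab-∘⁺ κ v (u D) D-st (stab-∘⁻ κ v (u C) C-st p))
        (λ p → stab-∘⁺ κ v (u C) C-st (stab-∘⁻ κ v (u D) D-st p)))
      (≈-sym (coeff-𝟏 κ (v ∘ₚ u D)))))

  -- Row i of a highest weight column holds i, while a strictly increasing column has at least i
  -- there. If i is the first index missing from C, its row already exceeds the bound.
  ≼-top′ : ∀ {k} (C : Subset k) p (f : Fin k → Fin n) → (∀ i i′ → i Fin.< i′ → f i Fin.< f i′) →
           map f (entries C) ≼ map f (entries (top k p)) → ∀ i → toℕ i ℕ.< p → Vec.lookup C i ≡ true
  ≼-top′ (true  ∷ C) (suc p) f f-mono h       zero    lt = refl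
  ≼-top′ (true  ∷ C) (suc p) f f-mono (_ ∷ h) (suc i) lt =
    ≼-top′ C p (f ∘ suc) (λ i i′ l → f-mono (suc i) (suc i′) (ℕ.s≤s l))
      (subst₂ _≼_ (sym (Listₚ.map-∘ (entries C))) (sym (Listₚ.map-∘ (entries (top _ p)))) h) i (ℕₚ.≤-pred lt)
  ≼-top′ (false ∷ C) (suc p) f f-mono h       i       lt = absurd (entries C) h
    where
    absurd : ∀ {A : Set} {ds} es → map f (map suc es) ≼ (f zero ∷ ds) → A
    absurd []       ()
    absurd (e ∷ es) (le ∷ _) = contradiction le (ℕₚ.<⇒≱ (f-mono zero (suc e) ℕ.z<s))

  ≼-top : ∀ C D → D ≡ top n ∣ D ∣ → entries C ≼ entries D → ∀ i → toℕ i ℕ.< ∣ D ∣ → Vec.lookup C i ≡ true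
  ≼-top C D e h = ≼-top′ C ∣ D ∣ (λ i → i) (λ _ _ lt → lt)
    (subst₂ _≼_ (sym (Listₚ.map-id (entries C))) (trans (cong entries e) (sym (Listₚ.map-id (entries (top n ∣ D ∣))))) h)

  _⊇_ : Column → Column → Set
  D ⊇ E = ∀ i → Vec.lookup E i ≡ true → Vec.lookup D i ≡ true

  top-lookup : ∀ {D} → D ≡ top n ∣ D ∣ → ∀ i → Vec.lookup D i ≡ (toℕ i ℕ.<ᵇ ∣ D ∣)
  top-lookup {D} e i = trans (cong (λ E → Vec.lookup E i) e) (Vecₚ.lookup∘tabulate (λ i → toℕ i ℕ.<ᵇ ∣ D ∣) i)

  shape-support : ∀ D S → All (λ E → E ≡ top n ∣ E ∣) (D ∷ S) → All (D ⊇_) S →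
                  ∀ i → ¬ toℕ i ℕ.< ∣ D ∣ → shape (D ∷⁺ S) i ≡ 0
  shape-support D S (D-top All.∷ S-top) S⊆ i i≥ = go (D ∷ S) (D-top All.∷ S-top) ((λ _ e → e) All.∷ S⊆)
    where
    D∌i : Vec.lookup D i ≡ false
    D∌i = trans (top-lookup D-top i) (dec-false (toℕ i ℕₚ.<? ∣ D ∣) i≥)
    go : ∀ S → All (λ E → E ≡ top n ∣ E ∣) S → All (D ⊇_) S → ListAction.sum (map (λ E → ϖ ∣ E ∣ i) S) ≡ 0
    go []      _              _            = refl
    go (E ∷ S) (e All.∷ es) (E⊆ All.∷ S⊆) =
      cong₂ ℕ._+_ (cong (if_then 1 else 0) (trans (sym (top-lookup e i)) E∌i)) (go S es S⊆)
      where
      E∌i : Vec.lookup E i ≡ false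
      E∌i = Boolₚ.¬-not (λ E∋i → contradiction (trans (sym D∌i) (E⊆ i E∋i)) λ ())

  -- u_C fixes the first p indices, so it permutes the others among themselves, and κ vanishes on
  -- all of those.
  u-stab : ∀ C p κ → (∀ i → toℕ i ℕ.< p → Vec.lookup C i ≡ true) → (∀ i → ¬ toℕ i ℕ.< p → κ i ≡ 0) →
           Stabilises (u C) κ
  u-stab C p κ C⊇ κ-supp i with toℕ i ℕₚ.<? p
  ... | yes lt = cong κ (inv-eq (u C) (u-fixes C p C⊇ i lt))
  ... | no ≮ = trans (κ-supp (u C ⟨$⟩ˡ i) (λ lt → ≮ (subst (λ x → toℕ x ℕ.< p)
                 (trans (sym (u-fixes C p C⊇ (u C ⟨$⟩ˡ i) lt)) (inverseʳ (u C))) lt))) (sym (κ-supp i ≮))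

  Ψ-base : ∀ j C S → Vec.lookup C (inject₁ j) ≡ false → Vec.lookup C (suc j) ≡ true →
           All (λ E → E ≡ top n ∣ E ∣) S → AllPairs _⊇_ S → Semistandard (C ∷⁺ S) →
           Ψ (C ∷⁺ S) ≈ t * (Tᵢ⁻¹ j * Ψ (sᶜ j C ∷⁺ S))
  Ψ-base j C [] p q _ _ _ = ≈-trans (lead-down j C (𝟏 (ϖ ∣ C ∣)) p q)
    (reflexive (cong (λ l → t * (Tᵢ⁻¹ j * lead (sᶜ j C) (𝟏 (ϖ l)))) (sym (sᶜ-size j C))))
  Ψ-base j C (D ∷ S) p q tops (S⊆ AllPairs.∷ _) (C≼D ∷ _) = begin
    Ψ (C ∷⁺ (D ∷ S))
      ≈⟨ ≈-trans (Ψ-∷ C D S) (Φ-cong C (Ψ-highest D S tops)) ⟩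
    lead C (project (∣ C ∣) C (𝟏 κ))
      ≈⟨ lead-cong C (project-𝟏 (∣ C ∣) C C′ κ (u-stab C ∣ D ∣ κ C⊇ supp) (u-stab C′ ∣ D ∣ κ C′⊇ supp)) ⟩
    lead C (project (∣ C ∣) C′ (𝟏 κ))
      ≈⟨ lead-down j C _ p q ⟩
    t * (Tᵢ⁻¹ j * lead C′ (project (∣ C ∣) C′ (𝟏 κ)))
      ≡⟨ cong (λ l → t * (Tᵢ⁻¹ j * lead C′ (project l C′ (𝟏 κ)))) (sym (sᶜ-size j C)) ⟩
    t * (Tᵢ⁻¹ j * Φ C′ (𝟏 κ))
      ≈⟨ *-congˡ (*-congˡ (≈-trans (Ψ-∷ C′ D S) (Φ-cong C′ (Ψ-highest D S tops)))) ⟨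
    t * (Tᵢ⁻¹ j * Ψ (C′ ∷⁺ (D ∷ S))) ∎
    where
    C′ = sᶜ j C
    κ = shape (D ∷⁺ S)
    supp = shape-support D S tops S⊆
    C⊇ : ∀ i → toℕ i ℕ.< ∣ D ∣ → Vec.lookup C i ≡ true
    C⊇ = ≼-top C D (All.head tops) C≼D
    C′⊇ : ∀ i → toℕ i ℕ.< ∣ D ∣ → Vec.lookup C′ i ≡ true
    C′⊇ i lt = trans (sᶜ-lookup j C i) (trans (cong (Vec.lookup C) (s-off j i≢j i≢j⁺)) (C⊇ i lt))
      where
      -- j is missing from C, so it lies beyond the initial segment contained in C, and s_j moves
      -- nothing in that segment.
      j≮ : ¬ toℕ (inject₁ j) ℕ.< ∣ D ∣
      j≮ lt = contradiction (trans (sym p) (C⊇ (inject₁ j) lt)) λ ()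
      i≢j : i ≢ inject₁ j
      i≢j e = j≮ (subst (λ x → toℕ x ℕ.< ∣ D ∣) e lt)
      i≢j⁺ : i ≢ suc j
      i≢j⁺ e = j≮ (ℕₚ.<-trans (ℕₚ.≤-reflexive (cong suc (Finₚ.toℕ-inject₁ j))) (subst (λ x → toℕ x ℕ.< ∣ D ∣) e lt))

  T⁰-top : ∀ μ → Dominant μ → All (λ E → E ≡ top n ∣ E ∣) (T⁰ μ)
  T⁰-top μ μ-dom = Allₚ.map⁺ (All.universal column (List.upTo (μ zero)))
    where
    column : ∀ c → Vec.tabulate (λ i → c ℕ.<ᵇ μ i) ≡ top n ∣ Vec.tabulate (λ i → c ℕ.<ᵇ μ i) ∣
    column c with top? (Vec.tabulate (λ i → c ℕ.<ᵇ μ i))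
    ... | inj₁ e = e
    ... | inj₂ (j , p , q) = contradiction
      (trans (sym (trans (sym (Vecₚ.lookup∘tabulate (λ i → c ℕ.<ᵇ μ i) (inject₁ j))) p)) (dec-true (c ℕₚ.<? μ (inject₁ j))
        (ℕₚ.<-≤-trans (ℕₚ.<ᵇ⇒< c _ (subst T (trans (sym q) (Vecₚ.lookup∘tabulate (λ i → c ℕ.<ᵇ μ i) (suc j))) _))
          (μ-dom (inject₁ j) (suc j) (ℕₚ.≤-trans (ℕₚ.≤-reflexive (Finₚ.toℕ-inject₁ j)) (ℕₚ.n≤1+n _)))))) λ ()

  T⁰-nested : ∀ μ → AllPairs _⊇_ (T⁰ μ)
  T⁰-nested μ = subst (AllPairs _⊇_) (sym (Listₚ.map-upTo g (μ zero)))
    (AllPairsₚ.applyUpTo⁺₁ g (μ zero) (λ {c} {d} c<d _ i e → trans (Vecₚ.lookup∘tabulate (λ i → c ℕ.<ᵇ μ i) i)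
      (dec-true (c ℕₚ.<? μ i) (ℕₚ.<-trans c<d (ℕₚ.<ᵇ⇒< d _
        (subst T (trans (sym e) (Vecₚ.lookup∘tabulate (λ i → d ℕ.<ᵇ μ i) i)) _))))))
    where
    g : ℕ → Column
    g c = Vec.tabulate (λ i → c ℕ.<ᵇ μ i)

  -- The recursion in the number of columns

  ⨂-cong : ∀ {r} {C D : Fin (suc r) → Column} → (∀ i → C i ≡ D i) → ⨂ C ≡ ⨂ D
  ⨂-cong {zero}  e = cong (_∷⁺ []) (e zero)
  ⨂-cong {suc r} e = cong₂ (λ C T → C ∷⁺ toList T) (e (fromℕ (suc r))) (⨂-cong (e ∘ inject₁))

  ⨂-linked : ∀ {r} (C : Fin (suc r) → Column) → (∀ i k → i Fin.≤ k → ∣ C i ∣ ℕ.≤ ∣ C k ∣) →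
             Linked (λ C D → ∣ D ∣ ℕ.≤ ∣ C ∣) (toList (⨂ C))
  ⨂-linked {zero}        C h = [-]
  ⨂-linked {suc zero}    C h = h zero (suc zero) ℕ.z≤n ∷ [-]
  ⨂-linked {suc (suc r)} C h = h (inject₁ (fromℕ (suc r))) (fromℕ (suc (suc r)))
      (ℕₚ.≤-trans (ℕₚ.≤-reflexive (Finₚ.toℕ-inject₁ (fromℕ (suc r)))) (ℕₚ.n≤1+n _))
    ∷ ⨂-linked (C ∘ inject₁) (λ i k le → h (inject₁ i) (inject₁ k)
        (subst₂ ℕ._≤_ (sym (Finₚ.toℕ-inject₁ i)) (sym (Finₚ.toℕ-inject₁ k)) le))

  ⨂-semistandard : ∀ {r} (C : Fin (suc r) → Column) S → Semistandard (⨂ C ⊗ S) → Semistandard (C zero ∷⁺ S)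
  ⨂-semistandard {zero}  C S ss = ss
  ⨂-semistandard {suc r} C S ss = ⨂-semistandard (C ∘ inject₁) S (Linked.tail ss)

  module _ (j : Fin m) where

    Ω-inject₁ : ∀ {r} k (C : Fin (suc r) → Column) i → Ω j k C (inject₁ i) ≡ Ω j k (C ∘ inject₁) i
    Ω-inject₁ k C i = cong (λ x → if x ℕ.<ᵇ k then sᶜ j (C (inject₁ i)) else C (inject₁ i)) (Finₚ.toℕ-inject₁ i)

    Ω-< : ∀ {r} k (C : Fin r → Column) i → toℕ i ℕ.< k → Ω j k C i ≡ sᶜ j (C i)
    Ω-< k C i lt = cong (if_then sᶜ j (C i) else C i) (dec-true (toℕ i ℕₚ.<? k) lt)

    Ω-≥ : ∀ {r} k (C : Fin r → Column) i → k ℕ.≤ toℕ i → Ω j k C i ≡ C i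
    Ω-≥ k C i ge = cong (if_then sᶜ j (C i) else C i) (dec-false (toℕ i ℕₚ.<? k) (ℕₚ.≤⇒≯ ge))

    module _ (S : List Column) where

      Θ : ∀ {r} → (Fin (suc r) → Column) → Carrier
      Θ C = Ψ (⨂ C ⊗ S)

      Θ-cong : ∀ {r} {C D : Fin (suc r) → Column} → (∀ i → C i ≡ D i) → Θ C ≡ Θ D
      Θ-cong e = cong (λ T → Ψ (T ⊗ S)) (⨂-cong e)

      Θ-suc : ∀ {r} (C : Fin (suc (suc r)) → Column) → Θ C ≈ Φ (C (fromℕ (suc r))) (Θ (C ∘ inject₁))
      Θ-suc {r} C = Ψ-∷ (C (fromℕ (suc r))) (List⁺.head (⨂ (C ∘ inject₁))) (List⁺.tail (⨂ (C ∘ inject₁)) ++ S)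

      Θ-Ω : ∀ {r} k (C : Fin (suc (suc r)) → Column) → k ℕ.≤ suc r →
            Φ (C (fromℕ (suc r))) (Θ (Ω j k (C ∘ inject₁))) ≈ Θ (Ω j k C)
      Θ-Ω {r} k C k≤ = ≈-trans (reflexive (cong₂ Φ
        (sym (Ω-≥ k C (fromℕ (suc r)) (subst (k ℕ.≤_) (sym (Finₚ.toℕ-fromℕ (suc r))) k≤)))
        (Θ-cong (λ i → sym (Ω-inject₁ k C i))))) (≈-sym (Θ-suc (Ω j k C)))

      Θ-Ω-full : ∀ {r} (C : Fin (suc (suc r)) → Column) →
                 Φ (sᶜ j (C (fromℕ (suc r)))) (Θ (Ω j (suc r) (C ∘ inject₁))) ≈ Θ (Ω j (suc (suc r)) C)
      Θ-Ω-full {r} C = ≈-trans (reflexive (cong₂ Φ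
          (sym (Ω-< (suc (suc r)) C (fromℕ (suc r)) (ℕ.s≤s (ℕₚ.≤-reflexive (Finₚ.toℕ-fromℕ (suc r))))))
          (Θ-cong (λ i → trans (Ω-< (suc r) (C ∘ inject₁) i (Finₚ.toℕ<n i)) (sym (Ω-< (suc (suc r)) C (inject₁ i)
            (ℕₚ.m<n⇒m<1+n (subst (ℕ._< suc r) (sym (Finₚ.toℕ-inject₁ i)) (Finₚ.toℕ<n i)))))))))
        (≈-sym (Θ-suc (Ω j (suc (suc r)) C)))

      signChange? : ∀ {r} (C : Fin (suc r) → Column) (k : Fin r) →
                    Dec (σ j (C (inject₁ k)) Sign.* σ j (C (suc k)) ≡ Sign.-)
      signChange? C k = (σ j (C (inject₁ k)) Sign.* σ j (C (suc k))) Sign.≟ Sign.-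

      summand : ∀ {r} → (Fin (suc r) → Column) → Fin r → Carrier
      summand C k = σ j (C (inject₁ k)) · ((1# - t) * Θ (Ω j (suc (toℕ k)) C))

      correction : ∀ {r} → (Fin (suc r) → Column) → Carrier
      correction {r} C = ∑ (filter (signChange? C) (allFin r)) (summand C)

      -- Every Ω_k occurring here leaves D alone, so Φ_D carries each old summand to the one of the
      -- same index. The extra term belongs to the new adjacent pair, D and its right neighbour.
      correction-suc : ∀ {r} (C : Fin (suc (suc r)) → Column) → let D = C (fromℕ (suc r)) in
        Φ D (correction (C ∘ inject₁))
          + (if does (signChange? C (fromℕ r))
             then σ j (C (inject₁ (fromℕ r))) · ((1# - t) * Φ D (Θ (Ω j (suc r) (C ∘ inject₁)))) else 0#)
        ≈ correction C
      correction-suc {r} C = begin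
        Φ D (correction C′) + (if b then σ j (C (inject₁ (fromℕ r))) · ((1# - t) * Φ D (Θ (Ω j (suc r) C′))) else 0#)
          ≈⟨ +-cong (≈-trans (Φ-cong D (∑-filter (signChange? C′) (allFin r) (summand C′)))
                       (≈-trans (Φ-∑ D (allFin r) (term C′)) (∑-cong (allFin r) lift)))
                    (if-cong b (·-cong (σ j (C (inject₁ (fromℕ r)))) (*-congˡ (≈-trans (Θ-Ω (suc r) C ℕₚ.≤-refl)
                      (reflexive (cong (λ k → Θ (Ω j (suc k) C)) (sym (Finₚ.toℕ-fromℕ r)))))))) ⟩
        ∑ (allFin r) (term C ∘ inject₁) + term C (fromℕ r)
          ≈⟨ ∑-snoc (term C) ⟨
        ∑ (allFin (suc r)) (term C)
          ≈⟨ ∑-filter (signChange? C) (allFin (suc r)) (summand C) ⟨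
        correction C ∎
        where
        C′ = C ∘ inject₁
        D = C (fromℕ (suc r))
        b = does (signChange? C (fromℕ r))
        term : ∀ {r} → (Fin (suc r) → Column) → Fin r → Carrier
        term C k = if does (signChange? C k) then summand C k else 0#
        if-cong : ∀ b {x y} → x ≈ y → (if b then x else 0#) ≈ (if b then y else 0#)
        if-cong true  e = e
        if-cong false e = ≈-refl
        Φ-if : ∀ b {x y} → Φ D x ≈ y → Φ D (if b then x else 0#) ≈ (if b then y else 0#)
        Φ-if true  e = e
        Φ-if false e = Φ-0 D
        ·-cong : ∀ ς {x y} → x ≈ y → ς · x ≈ ς · y
        ·-cong Sign.+ e = e
        ·-cong Sign.- e = -‿cong e
        lift : ∀ k → Φ D (term C′ k) ≈ term C (inject₁ k)
        lift k = Φ-if (does (signChange? C′ k)) (≈-trans (Φ-· D (σ j (C (inject₁ (inject₁ k)))) _)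
          (·-cong (σ j (C (inject₁ (inject₁ k)))) (≈-trans (Φ-scale D 1-t∈ _) (*-congˡ (≈-trans
            (Θ-Ω (suc (toℕ k)) C (ℕₚ.m≤n⇒m≤1+n (Finₚ.toℕ<n k)))
            (reflexive (cong (λ i → Θ (Ω j (suc i) C)) (sym (Finₚ.toℕ-inject₁ k)))))))))
        -- `allFin` is built from its first index, whereas a new column contributes the last
        -- summand.
        ∑-snoc : ∀ {r} (f : Fin (suc r) → Carrier) → ∑ (allFin (suc r)) f ≈ ∑ (allFin r) (f ∘ inject₁) + f (fromℕ r)
        ∑-snoc {zero}  f = +-comm _ _
        ∑-snoc {suc r} f = ≈-trans
          (+-congˡ (≈-trans (tail f) (≈-trans (∑-snoc (f ∘ suc)) (+-congʳ (≈-sym (tail (f ∘ inject₁)))))))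
          (≈-sym (+-assoc _ _ _))
          where
          tail : ∀ {r} (f : Fin (suc r) → Carrier) → ∑ (List.tabulate suc) f ≈ ∑ (allFin r) (f ∘ suc)
          tail f = reflexive (trans (cong (λ xs → ∑ xs f) (sym (Listₚ.map-tabulate (λ i → i) suc))) (∑-map suc (allFin _) f))

      -- The operator in front always has the sign of the leftmost column reached, so adding D
      -- replaces the sign of its right neighbour by that of D; `Φ-τ` records the change as the new
      -- summand. C_1 stays in place throughout, so `base` is handed down unchanged.
      Θ-formula : ∀ {r} (C : Fin (suc r) → Column) → σ j (C zero) ≡ Sign.+ →
                  Ψ (C zero ∷⁺ S) ≈ t * (Tᵢ⁻¹ j * Ψ (sᶜ j (C zero) ∷⁺ S)) →
                  Θ C ≈ τ j (σ j (C (fromℕ r))) (Θ (Ω j (suc r) C)) + correction C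
      Θ-formula {zero}  C σ≡+ base = ≈-trans base (≈-trans
        (reflexive (cong (λ ς → τ j ς (Θ (Ω j 1 C))) (sym σ≡+))) (≈-sym (+-identityʳ _)))
      Θ-formula {suc r} C σ≡+ base = begin
        Θ C                                                  ≈⟨ Θ-suc C ⟩
        Φ D (Θ C′)                                           ≈⟨ Φ-cong D (Θ-formula C′ σ≡+ base) ⟩
        Φ D (τ j (σ j (C′ (fromℕ r))) X + correction C′)     ≈⟨ ≈-trans (Φ-+ D _ _) (+-congʳ (Φ-τ j D _ X)) ⟩
        (τ j (σ j D) (Φ (sᶜ j D) X) + new) + Φ D (correction C′)
          ≈⟨ ≈-trans (+-assoc _ new _) (+-cong (τ-cong j (σ j D) (Θ-Ω-full C)) (≈-trans (+-comm new _) (correction-suc C))) ⟩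
        τ j (σ j D) (Θ (Ω j (suc (suc r)) C)) + correction C ∎
        where
        C′ = C ∘ inject₁
        D = C (fromℕ (suc r))
        X = Θ (Ω j (suc r) C′)
        new = if does (signChange? C (fromℕ r)) then σ j (C′ (fromℕ r)) · ((1# - t) * Φ D X) else 0#

  σ-neg : ∀ j C → inject₁ j ∈ C × suc j ∉ C → σ j C ≡ Sign.-
  σ-neg j C (p , q) = cong₂ (λ b b′ → if b ∧ not b′ then Sign.- else Sign.+)
    (dec-true (inject₁ j ∈? C) p) (dec-false (suc j ∈? C) q)

  σ-pos : ∀ j C → ¬ (inject₁ j ∈ C × suc j ∉ C) → σ j C ≡ Sign.+
  σ-pos j C ¬neg with inject₁ j ∈? C | suc j ∈? C
  ... | yes p | yes _ = refl
  ... | yes p | no q  = contradiction (p , q) ¬neg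
  ... | no _  | _     = refl

theorem6p2 :
    (m r : ℕ) → let open AffineHecke m in
    (C : Fin (suc r) → Column) →
    (∀ i → 1 ≤ ∣ C i ∣) →
    (∀ i k → i Fin.≤ k → ∣ C i ∣ ≤ ∣ C k ∣) →
      (¬ Semistandard (⨂ C) → Ψ (⨂ C) ≈ 0#)
    × (HighestWeight (⨂ C) → Ψ (⨂ C) ≈ 𝟏 (shape (⨂ C)))
    × ((μ : Weight) → Dominant μ → nonzeroParts μ ≤ ∣ C zero ∣ → Semistandard (⨂ C ⊗ T⁰ μ) →
       (j : Fin m) → inject₁ j ∉ C zero → suc j ∈ C zero →
       let Ψ-Ω : ℕ → Carrier
           Ψ-Ω k = Ψ (⨂ (Ω j k C) ⊗ T⁰ μ)
           signChanges = filter (λ k → (σ j (C (inject₁ k)) Sign.* σ j (C (suc k))) Sign.≟ Sign.-) (allFin r)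
           Σ = ∑[ k ∈ signChanges ] σ j (C (inject₁ k)) · ((1# - t) * Ψ-Ω (suc (toℕ k)))
       in (inject₁ j ∈ C (fromℕ r) × suc j ∉ C (fromℕ r) →
             Ψ (⨂ C ⊗ T⁰ μ) ≈ Tᵢ j * Ψ-Ω (suc r) + Σ)
        × (¬ (inject₁ j ∈ C (fromℕ r) × suc j ∉ C (fromℕ r)) →
             Ψ (⨂ C ⊗ T⁰ μ) ≈ t * (Tᵢ⁻¹ j * Ψ-Ω (suc r)) + Σ))
theorem6p2 m r C _ sizes =
    Ψ-non-semistandard _ _ (⨂-linked C sizes)
  , Ψ-highest _ _
  , λ μ μ-dom _ ss j j∉ j⁺∈ →
      let S       = T⁰ μ
          -- As j ∉ C_1, the sign of C_1 is +, so the recursion starts with t T_j⁻¹.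
          formula = Θ-formula j S C (σ-pos j (C zero) (λ (p , _) → j∉ p))
            (Ψ-base j (C zero) S (∉⇒false (C zero) j∉) (Vecₚ.[]=⇒lookup j⁺∈) (T⁰-top μ μ-dom) (T⁰-nested μ)
              (⨂-semistandard C S ss))
          signed  = λ ς → τ j ς (Θ j S (Ω j (suc r) C)) + correction j S C
      -- The two cases of the theorem are the two values of the sign of C_r, substituted into one
      -- formula.
      in (λ neg → subst (λ ς → Θ j S C ≈ signed ς) (σ-neg j (C (fromℕ r)) neg) formula)
       , (λ pos → subst (λ ς → Θ j S C ≈ signed ς) (σ-pos j (C (fromℕ r)) pos) formula)
  where
  open AffineHecke m
  open HeckeTableaux m
  ∉⇒false : ∀ {n} (C : Subset n) {i} → i ∉ C → Vec.lookup C i ≡ false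
  ∉⇒false C {i} i∉ = Boolₚ.¬-not (i∉ ∘ Vecₚ.lookup⇒[]= i C)
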